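{- Let $n\ge1$, $N\ge1$, $p_1,\dots,p_N\ge1$ and consider the $n$-triangulated polygon $\mathcal P(p_1,\dots,p_N)$. Let $a(p_1,\dots,p_M)$ be the numerator of the (reduced) continued fraction $[1;p_1,\dots,p_M]$, with $a(\emptyset)=1$. Then, counting terms with multiplicity: (i) for $1\le l\le n$, the Laurent expansion $D_l^{[p_1,\dots,p_N]}$ of the $l$-th cluster variable on the diagonal $AB$ has precisely $a(p_1,\dots,p_N)^{l(n+1-l)}$ terms; (ii) for positive integers $i,j$ with $i+j\le n$, the Laurent expansion $I^{[p_1,\dots,p_N]}_{(i,j)}$ of the corresponding inner cluster variable of the triangle $AVB$ has precisely $a(p_1,\dots,p_N)^{i(n+1-i-j)}\,a(p_1,\dots,p_{N-1})^{j(n+1-i-j)}$ terms.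
   Context: **The triangulated polygon $\mathcal P(p_1,\dots,p_N)$.** Put $P_0=0$, $P_i=p_1+\dots+p_i$. The polygon is an $m$-gon with $m=3+P_N$, triangulated by triangles $\tau_1,\dots,\tau_{m-2}$ glued consecutively from a vertex $A$ to a vertex $B$, as follows. There are fan centres $C_1,\dots,C_N$ (put $V:=C_N$) and vertices $W_{i,s}$ ($1\le i\le N$, $1\le s\le p_i+1$), with identifications $W_{i,1}=C_{i-1}$ for $i\ge2$, $W_{i,p_i+1}=C_{i+1}$ for $i<N$, and $W_{N,p_N+1}=B$. Otherwise the vertices are distinct. The triangles are $\tau_1=AC_1W_{1,1}$ and $\tau_{P_{i-1}+1+s}=C_iW_{i,s}W_{i,s+1}$ for $1\le i\le N$, $1\le s\le p_i$. Consecutive triangles $\tau_r,\tau_{r+1}$ share a diagonal $e_r$, $1\le r\le m-3$. The diagonal $AB$ crosses each $e_r$ exactly once. **Cluster structure.** Mutation of a seed at a mutable vertex $k$ replaces $x_k$ by $x_k'=\frac1{x_k}\left(\prod_{k\to i}x_i+\prod_{j\to k}x_j\right)$ together with the usual quiver mutation. For a triangle with corners $P,Q,R$ in clockwise order, the quiver vertices are the points $(a,b,c):=\frac{aP+bQ+cR}{n+1}$, $a,b,c\in\mathbb Z_{\ge0}$, $a+b+c=n+1$, except the corners. For every $(u_1,u_2,u_3)\in\mathbb Z_{\ge1}^3$ with sum $n+2$ there is a 3-cycle $(u_1-1,u_2,u_3)\to(u_1,u_2,u_3-1)\to(u_1,u_2-1,u_3)\to(u_1-1,u_2,u_3)$.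 Glue along common edges. Boundary vertices are frozen, others mutable. **Flip of a diagonal.** Identify the quadrilateral around it with $[0,n+1]^2$ so that the diagonal joins $(0,0)$ and $(n+1,n+1)$ and the quiver vertices are the non-corner integer points. For $k=1,\dots,n$ successively, mutate at all $(i,j)$ with $i-j\equiv k-1\pmod 2$, $|i-j|\le k-1$, $|i+j-(n+1)|\le n-k$. The result is the $n$-triangulated quiver for the other diagonal. **The variables.** Flip $e_1,e_2,\dots,e_{m-3}$ successively. This ends with the diagonal $AB$ and the triangle $AVB$. $D_l^{[p_1,\dots,p_N]}$ is the variable at the $l$-th quiver vertex on $AB$ counted from $A$ to $B$. $I_{(i,j)}^{[p_1,\dots,p_N]}$ is the variable at the point $\frac{(n+1-i-j)A+jV+iB}{n+1}$ of the triangle $AVB$. Both are Laurent polynomials in the initial variables with positive integer coefficients. The number of terms counted with multiplicity is the sum of the coefficients. -}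

module Defs where

open import Data.Bool using (Bool; true; false; if_then_else_; not)
open import Data.Nat as ℕ using (ℕ; zero; suc; _+_; _*_; _∸_; _≤_; _<_; ∣_-_∣; _≡ᵇ_)
open import Data.Nat.DivMod using (_%_)
open import Data.Nat.ListAction using (sum)
open import Data.Integer as ℤ using (ℤ; +_; 0ℤ; 1ℤ)
open import Data.Rational as ℚ using (ℚ; ↥_; 0ℚ)
open import Data.Fin using (Fin; toℕ)
import Data.Fin as Fin
open import Data.List as List using (List; []; _∷_; _++_; foldl; foldr; filter; upTo; allFin; concatMap; take; length; lookup; deduplicate)
open import Data.List.NonEmpty as List⁺ using (List⁺)
open import Data.Vec as Vec using (Vec; []; _∷_; tabulate; zipWith; _[_]≔_)
import Data.Vec.Properties as Vec
import Data.Product.Properties as Product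
open import Data.Product using (_×_; _,_; proj₁; proj₂; ∃-syntax; uncurry)
open import Relation.Nullary using (Dec; yes; no; does)
open import Relation.Nullary.Decidable using (_×-dec_)
open import Relation.Binary.Definitions using (DecidableEquality)
open import Relation.Binary.PropositionalEquality using (_≡_; _≢_)

------------------------------------------------------------------------
-- Continued fractions

-- The value 0 at 0 is junk; it is not reached for positive partial quotients.
recip : ℚ → ℚ
recip q with q ℚ.≟ 0ℚ
... | yes _  = 0ℚ
... | no q≢0 = ℚ.1/_ q {{ℚ.≢-nonZero q≢0}}

-- [c₀; c₁, …, cₖ]
continuedFraction : ℕ → List ℕ → ℚ
continuedFraction c₀ []       = (+ c₀) ℚ./ 1
continuedFraction c₀ (c ∷ cs) = ((+ c₀) ℚ./ 1) ℚ.+ recip (continuedFraction c cs)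

-- Elements of ℚ are in lowest terms, so ↥ is the reduced numerator.
a : List ℕ → ℕ
a ps = ℤ.∣ ↥ continuedFraction 1 ps ∣

------------------------------------------------------------------------
-- Laurent polynomials and rational functions in K variables

-- Exponent vectors.
Monomial : ℕ → Set
Monomial K = Vec ℤ K

_·_ : ∀ {K} → Monomial K → Monomial K → Monomial K
_·_ = zipWith ℤ._+_

-- Finite sums of integer multiples of monomials; a monomial may be repeated,
-- and equality is equality of all coefficients.
Laurent : ℕ → Set
Laurent K = List (ℤ × Monomial K)

coefficient : ∀ {K} → Laurent K → Monomial K → ℤ
coefficient []            e = 0ℤ
coefficient ((c , d) ∷ L) e = (if does (Vec.≡-dec ℤ._≟_ d e) then c else 0ℤ) ℤ.+ coefficient L e

_≈_ : ∀ {K} → Laurent K → Laurent K → Set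
L ≈ M = ∀ e → coefficient L e ≡ coefficient M e

_⊛_ : ∀ {K} → Laurent K → Laurent K → Laurent K
L ⊛ M = concatMap (λ { (c , d) → List.map (λ { (c′ , d′) → c ℤ.* c′ , d · d′ }) M }) L

-- The number of terms counted with multiplicity: the sum of the coefficients.
-- It depends only on the ≈-class.
terms : ∀ {K} → Laurent K → ℤ
terms L = foldr (λ t s → proj₁ t ℤ.+ s) 0ℤ L

-- Nonzero Laurent polynomials with nonnegative coefficients, as nonempty
-- multisets of monomials.
Positive : ℕ → Set
Positive K = List⁺ (Monomial K)

_⊗_ : ∀ {K} → Positive K → Positive K → Positive K
p ⊗ q = List⁺.concatMap (λ d → List⁺.map (d ·_) q) p

laurent : ∀ {K} → Positive K → Laurent K
laurent p = List.map (1ℤ ,_) (List⁺.toList p)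

-- Cluster variables arise from the initial ones by addition, multiplication
-- and division only, so we work in the semifield of subtraction-free rational
-- functions inside ℚ(x₁,…,x_K).  Its elements are fractions of nonzero
-- polynomials with nonnegative coefficients, hence all divisions are defined.
record Rational⁺ (K : ℕ) : Set where
  constructor _//_
  field
    numerator denominator : Positive K
open Rational⁺ public

infixl 6 _⊞_
infixl 7 _⊠_ _÷_

one : ∀ {K} → Rational⁺ K
one = List⁺.[ Vec.replicate _ 0ℤ ] // List⁺.[ Vec.replicate _ 0ℤ ]

x⟨_⟩ : ∀ {K} → Fin K → Rational⁺ K
x⟨ v ⟩ = List⁺.[ Vec.replicate _ 0ℤ [ v ]≔ 1ℤ ] // List⁺.[ Vec.replicate _ 0ℤ ]

_⊞_ _⊠_ _÷_ : ∀ {K} → Rational⁺ K → Rational⁺ K → Rational⁺ K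
(p // q) ⊞ (r // s) = ((p ⊗ s) List⁺.⁺++⁺ (r ⊗ q)) // (q ⊗ s)
(p // q) ⊠ (r // s) = (p ⊗ r) // (q ⊗ s)
(p // q) ÷ (r // s) = (p ⊗ s) // (q ⊗ r)

_^^_ : ∀ {K} → Rational⁺ K → ℕ → Rational⁺ K
f ^^ zero  = one
f ^^ suc k = f ⊠ (f ^^ k)

∏ : ∀ {K} → (Fin K → Rational⁺ K) → Rational⁺ K
∏ {K} f = foldr (λ v g → f v ⊠ g) one (allFin K)

-- L = f in ℚ(x₁,…,x_K).  Such an L is unique up to ≈.
_IsLaurentExpansionOf_ : ∀ {K} → Laurent K → Rational⁺ K → Set
L IsLaurentExpansionOf f = (L ⊛ laurent (denominator f)) ≈ laurent (numerator f)

-- By the Laurent phenomenon every cluster variable has a Laurent expansion.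
_HasTerms_ : ∀ {K} → Rational⁺ K → ℕ → Set
f HasTerms t = ∀ L → L IsLaurentExpansionOf f → terms L ≡ + t

------------------------------------------------------------------------
-- Seeds

-- arrows u v is the number of arrows u → v.
record Seed (K : ℕ) : Set where
  field
    arrows : Fin K → Fin K → ℕ
    var    : Fin K → Rational⁺ K
open Seed public

-- Quiver mutation: add an arrow u → v for each path u → k → v, reverse the
-- arrows at k, and cancel 2-cycles.
mutateArrows : ∀ {K} → Fin K → (Fin K → Fin K → ℕ) → Fin K → Fin K → ℕ
mutateArrows k b u v with u Fin.≟ k | v Fin.≟ k
... | yes _ | _     = b v u
... | no _  | yes _ = b v u
... | no _  | no _  = (b u v + b u k * b k v) ∸ (b v u + b v k * b k u)

mutate : ∀ {K} → Seed K → Fin K → Seed K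
mutate S k = record
  { arrows = mutateArrows k (arrows S)
  ; var    = λ v → if does (v Fin.≟ k) then exchanged else var S v
  }
  where
  exchanged = (∏ (λ i → var S i ^^ arrows S k i) ⊞ ∏ (λ j → var S j ^^ arrows S j k)) ÷ var S k

------------------------------------------------------------------------
-- The n-triangulated polygon 𝒫(p₁,…,p_N) with ps = p₁ ∷ … ∷ p_N ∷ [].
-- The flag fixes one of the two mirror images of the polygon in the plane.

module Polygon (n : ℕ) (ps : List ℕ) (mirror : Bool) where

  N : ℕ
  N = length ps

  P : ℕ → ℕ
  P i = sum (take i ps)

  m : ℕ
  m = 3 + P N

  -- The vertices of the polygon are numbered 0, …, m ∸ 1 in the order in which
  -- τ₁, τ₂, … introduce them, starting with A, C₁, W₁,₁.  Each later triangle
  -- C_i W_{i,s} W_{i,s+1} introduces W_{i,s+1}, whose number is P_{i-1} + s + 2;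
  -- in particular W_{i,p_i+1} has number P_i + 2.  Index 0 below is unused.
  A : ℕ
  A = 0

  C : ℕ → ℕ
  C 0             = 0
  C 1             = 1
  C (suc (suc i)) = P (suc i) + 2

  W : ℕ → ℕ → ℕ
  W 0             s = 0
  W 1             s = 1 + s
  W (suc (suc i)) 1 = C (suc i)
  W (suc (suc i)) s = P (suc i) + (1 + s)

  V B : ℕ
  V = C N
  B = P N + 2

  -- The pairs (i , s) with 1 ≤ i ≤ N and 1 ≤ s ≤ p_i, lexicographically.
  fanIndices : List (ℕ × ℕ)
  fanIndices = go 1 ps
    where
    go : ℕ → List ℕ → List (ℕ × ℕ)
    go i []       = []
    go i (q ∷ qs) = List.map (λ s → i , suc s) (upTo q) ++ go (suc i) qs

  -- Two consecutive fans traverse their common diagonal C_i C_{i+1} in the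
  -- same direction when their triangles are written C_i W_{i,s} W_{i,s+1}, so
  -- the orientation of these triples alternates with i.
  clockwise : ℕ → Bool
  clockwise zero    = mirror
  clockwise (suc i) = not (clockwise i)

  orient : ℕ → ℕ × ℕ × ℕ → ℕ × ℕ × ℕ
  orient i (X , Y , Z) = if clockwise i then (X , Y , Z) else (X , Z , Y)

  -- τ₁, …, τ_{m-2} with corners in clockwise order; τ₁ is C₁ A W₁,₁ and has the
  -- orientation of the first fan.
  triangles : List (ℕ × ℕ × ℕ)
  triangles = orient 1 (C 1 , A , W 1 1)
            ∷ List.map (λ { (i , s) → orient i (C i , W i s , W i (suc s)) }) fanIndices

  -- The point (1/(n+1)) Σ w_X X is stored as the vector of its weights w_X, so
  -- points on a common edge of two triangles are glued automatically.
  Point : Set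
  Point = Vec ℕ m

  _≟ᴾ_ : DecidableEquality Point
  _≟ᴾ_ = Vec.≡-dec ℕ._≟_

  infixl 6 _⊕_
  infix  7 _⊙_

  _⊙_ : ℕ → ℕ → Point
  w ⊙ X = tabulate (λ Y → if toℕ Y ≡ᵇ X then w else 0)

  _⊕_ : Point → Point → Point
  _⊕_ = zipWith _+_

  weight : ∀ {k} → ℕ → Vec ℕ k → ℕ
  weight X       []       = 0
  weight zero    (w ∷ ws) = w
  weight (suc X) (w ∷ ws) = weight X ws

  -- All (a , b , c) with a + b + c ≡ k.
  triples : ℕ → List (ℕ × ℕ × ℕ)
  triples k = concatMap (λ a → List.map (λ b → a , b , k ∸ a ∸ b) (upTo (suc (k ∸ a)))) (upTo (suc k))

  pointsOf : ℕ × ℕ × ℕ → List Point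
  pointsOf (X , Y , Z) =
    List.map (λ { (a , b , c) → a ⊙ X ⊕ b ⊙ Y ⊕ c ⊙ Z })
      (filter (λ { (a , b , c) → (a ℕ.≤? n) ×-dec (b ℕ.≤? n) ×-dec (c ℕ.≤? n) }) (triples (suc n)))

  -- The 3-cycles, with (u₁ , u₂ , u₃) = (a + 1 , b + 1 , c + 1).
  arrowsOf : ℕ × ℕ × ℕ → List (Point × Point)
  arrowsOf (X , Y , Z) = concatMap cycle (triples (n ∸ 1))
    where
    cycle : ℕ × ℕ × ℕ → List (Point × Point)
    cycle (a , b , c) = (u , v) ∷ (v , w) ∷ (w , u) ∷ []
      where
      u v w : Point
      u = a     ⊙ X ⊕ suc b ⊙ Y ⊕ suc c ⊙ Z
      v = suc a ⊙ X ⊕ suc b ⊙ Y ⊕ c     ⊙ Z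
      w = suc a ⊙ X ⊕ b     ⊙ Y ⊕ suc c ⊙ Z

  vertices : List Point
  vertices = deduplicate _≟ᴾ_ (concatMap pointsOf triangles)

  K : ℕ
  K = length vertices

  -- A seed together with the positions of the quiver vertices in the current
  -- triangulation of the polygon.
  record State : Set where
    constructor _at_
    field
      seed     : Seed K
      position : Fin K → Point
  open State public

  initial : State
  initial = record { arrows = count ; var = x⟨_⟩ } at lookup vertices
    where
    count : Fin K → Fin K → ℕ
    count u v = length (filter (λ e → Product.≡-dec _≟ᴾ_ _≟ᴾ_ e (lookup vertices u , lookup vertices v))
                               (concatMap arrowsOf triangles))

  -- The flip replacing the diagonal XY by RS in the quadrilateral X R Y S of the
  -- current triangulation.  The affine identification with [0,n+1]² sends X, Y
  -- to (0,0), (n+1,n+1) on each of the triangles XRY and XSY, and R, S to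
  -- (n+1,0), (0,n+1); it also is affine on XRS and YRS.
  module Flip (X Y R S : ℕ) where

    InQuadrilateral : Point → Set
    InQuadrilateral p = weight X p + weight Y p + weight R p + weight S p ≡ suc n

    inQuadrilateral? : ∀ p → Dec (InQuadrilateral p)
    inQuadrilateral? p = _ ℕ.≟ _

    coordinates : Point → ℕ × ℕ
    coordinates p = weight R p + weight Y p , weight S p + weight Y p

    -- The step k + 1, so that k = 0, …, n ∸ 1.
    InStep : ℕ → ℕ × ℕ → Set
    InStep k (i , j) = (∣ i - j ∣ % 2 ≡ k % 2) × (∣ i - j ∣ ≤ k) × (∣ i + j - suc n ∣ ≤ n ∸ suc k)

    inStep? : ∀ k ij → Dec (InStep k ij)
    inStep? k (i , j) = (_ ℕ.≟ _) ×-dec (_ ℕ.≤? _) ×-dec (_ ℕ.≤? _)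

    -- InStep forces 1 ≤ i , j ≤ n, so only points inside the quadrilateral are
    -- mutated and the frozen boundary vertices never are.  The mutations within
    -- one step commute.
    step : (Fin K → Point) → Seed K → ℕ → Seed K
    step pos s k =
      foldl mutate s
        (filter (λ v → inQuadrilateral? (pos v) ×-dec inStep? k (coordinates (pos v))) (allFin K))

    -- The point with the given coordinates, as a point of XRS or YRS.
    newPoint : ℕ × ℕ → Point
    newPoint (i , j) = (suc n ∸ (i + j)) ⊙ X ⊕ y ⊙ Y ⊕ (i ∸ y) ⊙ R ⊕ (j ∸ y) ⊙ S
      where
      y : ℕ
      y = (i + j) ∸ suc n

    move : Point → Point
    move p = if does (inQuadrilateral? p) then newPoint (coordinates p) else p

    flip : State → State
    flip (s at pos) = foldl (step pos) s (upTo n) at (λ v → move (pos v))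

  -- With r = P_{i-1} + s the diagonal e_r is C_i W_{i,s}.  It lies in
  -- τ_{r+1} = C_i W_{i,s} W_{i,s+1} and, once e₁, …, e_{r-1} are flipped, in the
  -- triangle A C_i W_{i,s}.
  final : State
  final = foldl (λ { st (i , s) → Flip.flip (C i) (W i s) A (W i (suc s)) st }) initial fanIndices

  -- The variable at the point p of the final triangulation satisfies Q.
  VariableAt : Point → (Rational⁺ K → Set) → Set
  VariableAt p Q = (∃[ v ] position final v ≡ p)
                 × (∀ v → position final v ≡ p → Q (var (seed final) v))

  D : ℕ → (Rational⁺ K → Set) → Set
  D l = VariableAt ((suc n ∸ l) ⊙ A ⊕ l ⊙ B)

  I : ℕ → ℕ → (Rational⁺ K → Set) → Set
  I i j = VariableAt ((suc n ∸ i ∸ j) ⊙ A ⊕ j ⊙ V ⊕ i ⊙ B)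

-- The number of terms of a Laurent expansion is its value at x₁ = … = x_K = 1,
-- so it suffices to follow the values of all cluster variables at this point.
-- Let λ(P,Q) be the λ-lengths of the polygon with all initial edges and diagonals
-- of length 1.  The variable at the point with weights w_P has the value
-- ∏ λ(P,Q)^(w_P w_Q): during the flip of a diagonal X Y of a quadrilateral X R Y S
-- the vertices move through the lattice points of the tetrahedron X Y R S, and for
-- this product the exchange relation reduces to Ptolemy's relation.  All λ-lengths
-- that occur are 1, except those of the diagonals at A, for which Ptolemy's relation
-- gives the recursion of the continuants; the exponents of λ(A,B) and λ(A,V) are the
-- asserted ones.
--
-- To know the exchange relations, describe the quiver during a flip by a lattice
-- surface in the tetrahedron, given by its heights over the square [0,n+1]².  The
-- signed number of arrows between two vertices is an affine function of the heights,
-- and lowering the surface at a local maximum changes it exactly as the mutation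
-- at this vertex, which has only four neighbours there.

module Submission where

open import Defs
open import Data.Bool using (Bool; true; false; if_then_else_; not)
open import Data.Empty using (⊥)
open import Data.Nat as ℕ using (ℕ; zero; suc; pred; _+_; _*_; _∸_; _^_; _≤_; _<_; z≤n; s≤s; _≟_; _≤?_; _⊓_; ∣_-_∣)
open import Data.Nat.Properties
open import Data.Nat.ListAction using (sum)
open import Data.Nat.DivMod using (_%_)
open import Data.Nat.Tactic.RingSolver using (solve-∀)
import Data.Integer as ℤ
open import Data.Integer using (ℤ; +_; -[1+_]; 0ℤ; 1ℤ)
import Data.Integer.Properties as ℤ
import Data.Integer.Tactic.RingSolver as ℤ-Solver
import Data.Rational as ℚ
open import Data.Rational using (0ℚ; ↥_)
import Data.Rational.Properties as ℚ
import Data.Nat.Coprimality as Coprimality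
open import Data.Nat.Coprimality using (Coprime; coprime-+; 1-coprimeTo)
open import Data.Fin as Fin using (Fin; toℕ)
import Data.Fin.Properties as Fin
open import Data.List as List using (List; []; _∷_; _++_; foldl; foldr; filter; upTo; allFin; concatMap; take; length; lookup; deduplicate)
import Data.List.Properties as List
open import Data.List.NonEmpty as List⁺ using (List⁺; _∷_)
open import Data.List.Relation.Unary.All as All using (All; []; _∷_)
import Data.List.Relation.Unary.All.Properties as All
open import Data.List.Relation.Unary.Any as Any using (Any; here; there)
import Data.List.Relation.Unary.Any.Properties as Any
open import Data.List.Relation.Unary.AllPairs using ([]; _∷_)
open import Data.List.Relation.Unary.Unique.Propositional using (Unique)
import Data.List.Relation.Unary.Unique.Propositional.Properties as Unique
open import Data.List.Relation.Unary.Unique.DecPropositional.Properties using (deduplicate-!)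
open import Data.List.Membership.Propositional using (_∈_; find; lose)
open import Data.List.Membership.Propositional.Properties
open import Data.Vec as Vec using (Vec; []; _∷_)
import Data.Vec.Properties as Vec
open import Data.Product using (_×_; _,_; proj₁; proj₂; ∃)
import Data.Product.Properties as Product
import Data.Sum
open import Data.Sum using (_⊎_; inj₁; inj₂; [_,_]′)
open import Data.Unit using (⊤)
open import Function using (_∘_; id)
open import Relation.Nullary using (Dec; yes; no; does; ¬_; contradiction)
open import Relation.Nullary.Decidable using (_×-dec_; dec-true; dec-false)
open import Relation.Binary.Definitions using (DecidableEquality)
open import Relation.Binary.PropositionalEquality using (_≡_; _≢_; refl; sym; trans; cong; cong₂; subst; module ≡-Reasoning)

-- The obstacle is that an exchange relation depends on the whole quiver, while the surface
-- describes only one quadrilateral. The exchange matrix is therefore the form of the surface plus a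
-- fixed remainder `rest`, which must vanish on the row of every mutated vertex. It does: such a
-- vertex starts with positive weight at both ends X, Y of the flipped diagonal, and no triangle
-- outside the quadrilateral contains both ends. Quivers are stored as natural numbers with
-- truncated subtraction. They are compared with positive parts of skew integer matrices, which
-- agree with mutation only if 2-cycles are absent at the start; that holds because an arrow
-- determines its triangle. A mutation takes the weights (x,y,r,s) to (x-1,y-1,r+1,s+1). A vertex
-- moves in step r+s, and its four neighbours then have r+s larger by 1, so the order within a step
-- is immaterial. The surface descends from the faces XRY, XYS of the tetrahedron to the faces XRS,
-- RYS. Since R = A in every flip and all lengths away from A are 1, the product of λ-lengths
-- collapses to a monomial in the lengths at A, raised to the weight of A.

-- Finite integer sums and Iverson brackets

∑ : ∀ {A : Set} → List A → (A → ℤ) → ℤ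
∑ xs f = foldr (λ x s → f x ℤ.+ s) 0ℤ xs

∑-cong : ∀ {A : Set} (xs : List A) {f g : A → ℤ} → (∀ x → f x ≡ g x) → ∑ xs f ≡ ∑ xs g
∑-cong []       eq = refl
∑-cong (x ∷ xs) eq = cong₂ ℤ._+_ (eq x) (∑-cong xs eq)

∑-zero : ∀ {A : Set} (xs : List A) → ∑ xs (λ _ → 0ℤ) ≡ 0ℤ
∑-zero []       = refl
∑-zero (x ∷ xs) = trans (ℤ.+-identityˡ _) (∑-zero xs)

∑-+ : ∀ {A : Set} (xs : List A) (f g : A → ℤ) → ∑ xs (λ x → f x ℤ.+ g x) ≡ ∑ xs f ℤ.+ ∑ xs g
∑-+ []       f g = refl
∑-+ (x ∷ xs) f g = trans (cong (ℤ._+_ (f x ℤ.+ g x)) (∑-+ xs f g)) (interchange (f x) (g x) (∑ xs f) (∑ xs g))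
  where
  interchange : ∀ a b c d → a ℤ.+ b ℤ.+ (c ℤ.+ d) ≡ a ℤ.+ c ℤ.+ (b ℤ.+ d)
  interchange = ℤ-Solver.solve-∀

∑-*ˡ : ∀ {A : Set} (xs : List A) c (f : A → ℤ) → ∑ xs (λ x → c ℤ.* f x) ≡ c ℤ.* ∑ xs f
∑-*ˡ []       c f = sym (ℤ.*-zeroʳ c)
∑-*ˡ (x ∷ xs) c f = trans (cong (ℤ._+_ (c ℤ.* f x)) (∑-*ˡ xs c f)) (sym (ℤ.*-distribˡ-+ c (f x) (∑ xs f)))

∑-++ : ∀ {A : Set} (xs ys : List A) (f : A → ℤ) → ∑ (xs ++ ys) f ≡ ∑ xs f ℤ.+ ∑ ys f
∑-++ []       ys f = sym (ℤ.+-identityˡ _)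
∑-++ (x ∷ xs) ys f = trans (cong (ℤ._+_ (f x)) (∑-++ xs ys f)) (sym (ℤ.+-assoc (f x) _ _))

∑-concatMap : ∀ {A B : Set} (h : A → List B) (xs : List A) (f : B → ℤ) → ∑ (concatMap h xs) f ≡ ∑ xs (λ x → ∑ (h x) f)
∑-concatMap h []       f = refl
∑-concatMap h (x ∷ xs) f = trans (∑-++ (h x) _ f) (cong (ℤ._+_ (∑ (h x) f)) (∑-concatMap h xs f))

∑-map : ∀ {A B : Set} (h : A → B) (xs : List A) (f : B → ℤ) → ∑ (List.map h xs) f ≡ ∑ xs (f ∘ h)
∑-map h []       f = refl
∑-map h (x ∷ xs) f = cong (ℤ._+_ (f (h x))) (∑-map h xs f)

-- The Iverson bracket. Adjacency and numbers of arrows are written with it, so that case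
-- distinctions become integer identities for the ring solver.
⟦_⟧ : ∀ {P : Set} → Dec P → ℤ
⟦ p ⟧ = if does p then 1ℤ else 0ℤ

⟦⟧-true : ∀ {P : Set} (p : Dec P) → P → ⟦ p ⟧ ≡ 1ℤ
⟦⟧-true p h rewrite dec-true p h = refl

⟦⟧-false : ∀ {P : Set} (p : Dec P) → ¬ P → ⟦ p ⟧ ≡ 0ℤ
⟦⟧-false p h rewrite dec-false p h = refl

⟦⟧-cong : ∀ {P Q : Set} (p : Dec P) (q : Dec Q) → (P → Q) → (Q → P) → ⟦ p ⟧ ≡ ⟦ q ⟧
⟦⟧-cong (yes p) q f g = sym (⟦⟧-true q (f p))
⟦⟧-cong (no ¬p) q f g = sym (⟦⟧-false q (¬p ∘ g))

⟦⟧-× : ∀ {P Q : Set} (p : Dec P) (q : Dec Q) → ⟦ p ×-dec q ⟧ ≡ ⟦ p ⟧ ℤ.* ⟦ q ⟧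
⟦⟧-× (yes _) (yes _) = refl
⟦⟧-× (yes _) (no _)  = refl
⟦⟧-× (no _)  (yes _) = refl
⟦⟧-× (no _)  (no _)  = refl

∑-indicator : ∀ {A : Set} (_≟_ : DecidableEquality A) {xs : List A} {x : A} → Unique xs → x ∈ xs → ∑ xs (λ y → ⟦ x ≟ y ⟧) ≡ 1ℤ
∑-indicator {A} _≟_ {y ∷ ys} {x} (y# ∷ u) (here refl) = cong₂ ℤ._+_ (⟦⟧-true (x ≟ x) refl) (absent ys y#)
  where
  absent : ∀ zs → All (x ≢_) zs → ∑ zs (λ y → ⟦ x ≟ y ⟧) ≡ 0ℤ
  absent []       []       = refl
  absent (z ∷ zs) (p ∷ ps) = cong₂ ℤ._+_ (⟦⟧-false (x ≟ z) p) (absent zs ps)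
∑-indicator _≟_ {y ∷ ys} {x} (y# ∷ u) (there x∈) =
  cong₂ ℤ._+_ (⟦⟧-false (x ≟ y) (λ x≡y → All.lookup y# x∈ (sym x≡y))) (∑-indicator _≟_ u x∈)

-- Evaluation at x₁ = … = x_K = 1

-- The value of a multiset of monomials at the point 1 is its number of elements, so this is
-- multiplicativity of the evaluation.
length-⊗ : ∀ {K} (p q : Positive K) → List⁺.length (p ⊗ q) ≡ List⁺.length p * List⁺.length q
length-⊗ (d ∷ p) (e ∷ q) = cong suc (trans (List.length-++ (List.map (d ·_) q)) (cong₂ _+_ (List.length-map (d ·_) q) (rest p)))
  where
  rest : ∀ p → length (List.concat (List.map List⁺.toList (List.map (λ d → List⁺.map (d ·_) (e ∷ q)) p))) ≡ length p * suc (length q)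
  rest []      = refl
  rest (d ∷ p) = cong suc (trans (List.length-++ (List.map (d ·_) q)) (cong₂ _+_ (List.length-map (d ·_) q) (rest p)))

terms-⊛ : ∀ {K} (L M : Laurent K) → terms (L ⊛ M) ≡ terms L ℤ.* terms M
terms-⊛ L M = begin
  terms (L ⊛ M)                                 ≡⟨ ∑-concatMap _ L proj₁ ⟩
  ∑ L (λ t → ∑ (List.map _ M) proj₁)            ≡⟨ ∑-cong L (λ t → trans (∑-map _ M proj₁) (∑-*ˡ M (proj₁ t) proj₁)) ⟩
  ∑ L (λ t → proj₁ t ℤ.* terms M)               ≡⟨ ∑-cong L (λ t → ℤ.*-comm (proj₁ t) (terms M)) ⟩
  ∑ L (λ t → terms M ℤ.* proj₁ t)               ≡⟨ ∑-*ˡ L (terms M) proj₁ ⟩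
  terms M ℤ.* terms L                           ≡⟨ ℤ.*-comm (terms M) (terms L) ⟩
  terms L ℤ.* terms M                           ∎
  where open ≡-Reasoning

terms-laurent : ∀ {K} (p : Positive K) → terms (laurent p) ≡ + List⁺.length p
terms-laurent (d ∷ p) = cong (ℤ._+_ 1ℤ) (rest p)
  where
  rest : ∀ p → terms (List.map (1ℤ ,_) p) ≡ + length p
  rest []      = refl
  rest (d ∷ p) = cong (ℤ._+_ 1ℤ) (rest p)

-- Each listed term contributes to exactly one exponent in `es`. The right-hand side sees only
-- coefficients, which is what makes `terms` invariant under `≈`.
terms≡∑-coefficient : ∀ {K} (L : Laurent K) {es} → Unique es → (∀ {t} → t ∈ L → proj₂ t ∈ es) → terms L ≡ ∑ es (coefficient L)
terms≡∑-coefficient []            {es} u ⊆es = sym (∑-zero es)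
terms≡∑-coefficient ((c , d) ∷ L) {es} u ⊆es = sym (begin
  ∑ es (coefficient ((c , d) ∷ L))                                   ≡⟨ ∑-+ es (λ e → if does (d ≟ᴹ e) then c else 0ℤ) (coefficient L) ⟩
  ∑ es (λ e → if does (d ≟ᴹ e) then c else 0ℤ) ℤ.+ ∑ es (coefficient L)
    ≡⟨ cong₂ ℤ._+_ head (sym (terms≡∑-coefficient L u (⊆es ∘ there))) ⟩
  c ℤ.+ terms L                                                      ∎)
  where
  open ≡-Reasoning
  _≟ᴹ_ : DecidableEquality (Monomial _)
  _≟ᴹ_ = Vec.≡-dec ℤ._≟_
  scale : ∀ b → (if b then c else 0ℤ) ≡ c ℤ.* (if b then 1ℤ else 0ℤ)
  scale false = sym (ℤ.*-zeroʳ c)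
  scale true  = sym (ℤ.*-identityʳ c)
  head : ∑ es (λ e → if does (d ≟ᴹ e) then c else 0ℤ) ≡ c
  head = begin
    ∑ es (λ e → if does (d ≟ᴹ e) then c else 0ℤ)   ≡⟨ ∑-cong es (λ e → scale (does (d ≟ᴹ e))) ⟩
    ∑ es (λ e → c ℤ.* ⟦ d ≟ᴹ e ⟧)                  ≡⟨ ∑-*ˡ es c _ ⟩
    c ℤ.* ∑ es (λ e → ⟦ d ≟ᴹ e ⟧)                  ≡⟨ cong (c ℤ.*_) (∑-indicator _≟ᴹ_ u (⊆es (here refl))) ⟩
    c ℤ.* 1ℤ                                       ≡⟨ ℤ.*-identityʳ c ⟩
    c                                              ∎

terms-cong : ∀ {K} (L M : Laurent K) → L ≈ M → terms L ≡ terms M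
terms-cong {K} L M L≈M = begin
  terms L                ≡⟨ terms≡∑-coefficient L unique (λ t∈ → ∈-deduplicate⁺ _≟ᴹ_ (∈-++⁺ˡ (∈-map⁺ proj₂ t∈))) ⟩
  ∑ es (coefficient L)   ≡⟨ ∑-cong es L≈M ⟩
  ∑ es (coefficient M)   ≡⟨ terms≡∑-coefficient M unique (λ t∈ → ∈-deduplicate⁺ _≟ᴹ_ (∈-++⁺ʳ (List.map proj₂ L) (∈-map⁺ proj₂ t∈))) ⟨
  terms M                ∎
  where
  open ≡-Reasoning
  _≟ᴹ_ : DecidableEquality (Monomial K)
  _≟ᴹ_ = Vec.≡-dec ℤ._≟_
  es : List (Monomial K)
  es = deduplicate _≟ᴹ_ (List.map proj₂ L ++ List.map proj₂ M)
  unique : Unique es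
  unique = deduplicate-! _≟ᴹ_ (List.map proj₂ L ++ List.map proj₂ M)

-- The value of a fraction at the point 1, with the denominator cleared. Natural values suffice
-- because all λ-lengths that occur are integers.
record _at𝟙≡_ {K : ℕ} (f : Rational⁺ K) (t : ℕ) : Set where
  constructor at𝟙
  field ratio : List⁺.length (numerator f) ≡ t * List⁺.length (denominator f)
open _at𝟙≡_

-- Evaluate L · denominator = numerator at 1 and cancel the number of terms of the denominator,
-- which is positive because a `Positive` is nonempty.
hasTerms : ∀ {K} {f : Rational⁺ K} {t} → f at𝟙≡ t → f HasTerms t
hasTerms {f = f} {t} (at𝟙 eq) L expansion = ℤ.*-cancelʳ-≡ (terms L) (+ t) (+ suc _) (begin
  terms L ℤ.* + List⁺.length (denominator f)      ≡⟨ cong (terms L ℤ.*_) (terms-laurent (denominator f)) ⟨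
  terms L ℤ.* terms (laurent (denominator f))     ≡⟨ terms-⊛ L _ ⟨
  terms (L ⊛ laurent (denominator f))             ≡⟨ terms-cong (L ⊛ laurent (denominator f)) (laurent (numerator f)) expansion ⟩
  terms (laurent (numerator f))                   ≡⟨ terms-laurent (numerator f) ⟩
  + List⁺.length (numerator f)                    ≡⟨ cong +_ eq ⟩
  + (t * List⁺.length (denominator f))            ≡⟨ ℤ.pos-* t _ ⟩
  + t ℤ.* + List⁺.length (denominator f)          ∎)
  where open ≡-Reasoning

one-at𝟙 : ∀ {K} → one {K} at𝟙≡ 1
one-at𝟙 = at𝟙 refl

x-at𝟙 : ∀ {K} (v : Fin K) → x⟨ v ⟩ at𝟙≡ 1
x-at𝟙 v = at𝟙 refl

⊠-at𝟙 : ∀ {K} {f g : Rational⁺ K} {s t} → f at𝟙≡ s → g at𝟙≡ t → (f ⊠ g) at𝟙≡ (s * t)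
⊠-at𝟙 {f = p // q} {p′ // q′} {s} {t} (at𝟙 e) (at𝟙 e′) = at𝟙 (begin
  # (p ⊗ p′)              ≡⟨ length-⊗ p p′ ⟩
  # p * # p′              ≡⟨ cong₂ _*_ e e′ ⟩
  s * # q * (t * # q′)    ≡⟨ rearrange s (# q) t (# q′) ⟩
  s * t * (# q * # q′)    ≡⟨ cong (s * t *_) (length-⊗ q q′) ⟨
  s * t * # (q ⊗ q′)      ∎)
  where
  open ≡-Reasoning
  # : ∀ {A : Set} → List⁺ A → ℕ
  # = List⁺.length
  rearrange : ∀ a b c d → a * b * (c * d) ≡ a * c * (b * d)
  rearrange = solve-∀

⊞-at𝟙 : ∀ {K} {f g : Rational⁺ K} {s t} → f at𝟙≡ s → g at𝟙≡ t → (f ⊞ g) at𝟙≡ (s + t)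
⊞-at𝟙 {f = p // q} {p′ // q′} {s} {t} (at𝟙 e) (at𝟙 e′) = at𝟙 (begin
  # ((p ⊗ q′) List⁺.⁺++⁺ (p′ ⊗ q))        ≡⟨ List.length-++ (List⁺.toList (p ⊗ q′)) ⟩
  # (p ⊗ q′) + # (p′ ⊗ q)                 ≡⟨ cong₂ _+_ (length-⊗ p q′) (length-⊗ p′ q) ⟩
  # p * # q′ + # p′ * # q                 ≡⟨ cong₂ (λ x y → x * # q′ + y * # q) e e′ ⟩
  s * # q * # q′ + t * # q′ * # q         ≡⟨ rearrange s (# q) t (# q′) ⟩
  (s + t) * (# q * # q′)                  ≡⟨ cong ((s + t) *_) (length-⊗ q q′) ⟨
  (s + t) * # (q ⊗ q′)                    ∎)
  where
  open ≡-Reasoning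
  # : ∀ {A : Set} → List⁺ A → ℕ
  # = List⁺.length
  rearrange : ∀ a b c d → a * b * d + c * d * b ≡ (a + c) * (b * d)
  rearrange = solve-∀

-- The form in which the exchange relation is used: t is the old value of the mutated vertex, s the
-- new one, and t * s the value of the exchange binomial.
÷-at𝟙 : ∀ {K} {f g : Rational⁺ K} {s t} → 1 ≤ t → f at𝟙≡ (t * s) → g at𝟙≡ t → (f ÷ g) at𝟙≡ s
÷-at𝟙 {f = p // q} {p′ // q′} {s} {t@(suc _)} _ (at𝟙 e) (at𝟙 e′) = at𝟙 (*-cancelˡ-≡ _ _ t (begin
  t * # (p ⊗ q′)            ≡⟨ cong (t *_) (length-⊗ p q′) ⟩
  t * (# p * # q′)          ≡⟨ cong (λ x → t * (x * # q′)) e ⟩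
  t * (t * s * # q * # q′)  ≡⟨ rearrange t s (# q) (# q′) ⟩
  t * (s * (# q * (t * # q′)))  ≡⟨ cong (λ x → t * (s * (# q * x))) e′ ⟨
  t * (s * (# q * # p′))    ≡⟨ cong (λ x → t * (s * x)) (length-⊗ q p′) ⟨
  t * (s * # (q ⊗ p′))      ∎))
  where
  open ≡-Reasoning
  # : ∀ {A : Set} → List⁺ A → ℕ
  # = List⁺.length
  rearrange : ∀ t s b d → t * (t * s * b * d) ≡ t * (s * (b * (t * d)))
  rearrange = solve-∀

^^-at𝟙 : ∀ {K} {f : Rational⁺ K} {s} → f at𝟙≡ s → ∀ k → (f ^^ k) at𝟙≡ (s ^ k)
^^-at𝟙 e zero    = one-at𝟙
^^-at𝟙 e (suc k) = ⊠-at𝟙 e (^^-at𝟙 e k)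

∏ℕ : ∀ {A : Set} → List A → (A → ℕ) → ℕ
∏ℕ xs f = foldr (λ x s → f x * s) 1 xs

∏-at𝟙 : ∀ {K} {f : Fin K → Rational⁺ K} {t : Fin K → ℕ} → (∀ v → f v at𝟙≡ t v) → ∏ f at𝟙≡ ∏ℕ (allFin K) t
∏-at𝟙 {K} {f} {t} e = over (allFin K)
  where
  over : ∀ vs → foldr (λ v g → f v ⊠ g) one vs at𝟙≡ ∏ℕ vs t
  over []       = one-at𝟙
  over (v ∷ vs) = ⊠-at𝟙 (e v) (over vs)

-- Continued fractions

-- The continuants: `[p₁; p₂, …]` is `cfNumerator / cfRest`, with the empty continued fraction read
-- as 1/0.
cfNumerator cfRest : List ℕ → ℕ
cfNumerator []       = 1
cfNumerator (p ∷ ps) = p * cfNumerator ps + cfRest ps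
cfRest []       = 0
cfRest (p ∷ ps) = cfNumerator ps

coprime-*+ : ∀ {m n} x → Coprime m n → Coprime (x * n + m) n
coprime-*+ zero    c = c
coprime-*+ {m} {n} (suc x) c = subst (λ h → Coprime h n) (sym (+-assoc n (x * n) m)) (coprime-+ (coprime-*+ x c))

-- The Euclidean algorithm read backwards. It shows that the continuants are already reduced, so `↥`
-- returns them unchanged.
cf-coprime : ∀ ps → Coprime (cfNumerator ps) (cfRest ps)
cf-coprime []       = 1-coprimeTo 0
cf-coprime (p ∷ ps) = coprime-*+ p (Coprimality.sym (cf-coprime ps))

-- Stated with a predecessor because `mkℚ` stores the denominator minus one.
cfNumerator-positive : ∀ {ps} → All (1 ≤_) ps → ∃ λ k → cfNumerator ps ≡ suc k
cfNumerator-positive []              = 0 , refl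
cfNumerator-positive {suc p ∷ ps} (_ ∷ ps≥1) with k , eq ← cfNumerator-positive ps≥1 =
  _ , cong (λ h → h + p * cfNumerator ps + cfRest ps) eq

mkℚ-cong : ∀ {n n′ k} .{c : Coprime n (suc k)} .{c′ : Coprime n′ (suc k)} → n ≡ n′ → ℚ.mkℚ (+ n) k c ≡ ℚ.mkℚ (+ n′) k c′
mkℚ-cong refl = refl

integer : ∀ x .{c : Coprime x 1} → (+ x) ℚ./ 1 ≡ ℚ.mkℚ (+ x) 0 c
integer x {c} = ℚ.normalize-coprime c

recip-mkℚ : ∀ h k .{c : Coprime (suc h) (suc k)} → recip (ℚ.mkℚ (+ suc h) k c) ≡ ℚ.mkℚ (+ suc k) h (Coprimality.sym c)
recip-mkℚ h k {c} with ℚ.mkℚ (+ suc h) k c ℚ.≟ 0ℚ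
... | no _ = refl

-- The reciprocal of the tail `[p; ps]` is `cfNumerator ps / cfNumerator (p ∷ ps)`, and adding an
-- integer keeps a fraction reduced.
continuedFraction≡ : ∀ x {ps k} → All (1 ≤_) ps → cfNumerator ps ≡ suc k → .(c : Coprime (x * suc k + cfRest ps) (suc k)) →
  continuedFraction x ps ≡ ℚ.mkℚ (+ (x * suc k + cfRest ps)) k c
continuedFraction≡ x []  refl c = trans (integer x {Coprimality.sym (1-coprimeTo x)}) (mkℚ-cong {c = Coprimality.sym (1-coprimeTo x)} {c} (sym (trans (+-identityʳ _) (*-identityʳ x))))
continuedFraction≡ x {p ∷ ps} {k} (_ ∷ ps≥1) eq c with l , eq′ ← cfNumerator-positive ps≥1 = begin
  (+ x) ℚ./ 1 ℚ.+ recip (continuedFraction p ps)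
    ≡⟨ cong₂ (λ y z → y ℚ.+ recip z) (integer x {Coprimality.sym (1-coprimeTo x)}) (continuedFraction≡ p {ps} ps≥1 eq′ c₁) ⟩
  q₀ ℚ.+ recip (ℚ.mkℚ (+ (p * suc l + cfRest ps)) l c₁)
    ≡⟨ cong (λ z → q₀ ℚ.+ recip z) (mkℚ-cong {c = c₁} {c₂} eq₁) ⟩
  q₀ ℚ.+ recip (ℚ.mkℚ (+ suc k) l c₂)
    ≡⟨ cong (ℚ._+_ q₀) (recip-mkℚ k l {c₂}) ⟩
  q₀ ℚ.+ ℚ.mkℚ (+ suc l) k (Coprimality.sym c₂)
    -- Addition in ℚ unfolds to a quotient with denominator `1 * suc k`, that is, `suc (k + 0)`.
    ≡⟨ cong₂ (λ n d → n ℚ./ suc d) numerators (+-identityʳ k) ⟩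
  (+ (x * suc k + cfNumerator ps)) ℚ./ suc k
    ≡⟨ ℚ.normalize-coprime c ⟩
  ℚ.mkℚ (+ (x * suc k + cfNumerator ps)) k c ∎
  where
  open ≡-Reasoning
  q₀ : ℚ.ℚ
  q₀ = ℚ.mkℚ (+ x) 0 (Coprimality.sym (1-coprimeTo x))
  eq₁ : p * suc l + cfRest ps ≡ suc k
  eq₁ = subst (λ h → p * h + cfRest ps ≡ suc k) eq′ eq
  c₁ : Coprime (p * suc l + cfRest ps) (suc l)
  c₁ = coprime-*+ p (Coprimality.sym (subst (λ h → Coprime h (cfRest ps)) eq′ (cf-coprime ps)))
  c₂ : Coprime (suc k) (suc l)
  c₂ = subst (λ h → Coprime h (suc l)) eq₁ c₁
  numerators : (+ x) ℤ.* (+ suc k) ℤ.+ (+ suc l) ℤ.* 1ℤ ≡ + (x * suc k + cfNumerator ps)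
  numerators = trans (cong₂ ℤ._+_ (sym (ℤ.pos-* x (suc k))) (trans (ℤ.*-identityʳ (+ suc l)) (cong +_ (sym eq′)))) refl

a≡cfNumerator+cfRest : ∀ {ps} → All (1 ≤_) ps → a ps ≡ cfNumerator ps + cfRest ps
a≡cfNumerator+cfRest {ps} ps≥1 with k , eq ← cfNumerator-positive ps≥1 =
  trans (cong (λ q → ℤ.∣ ↥ q ∣) (continuedFraction≡ 1 ps≥1 eq c)) (cong (_+ cfRest ps) (trans (*-identityˡ (suc k)) (sym eq)))
  where
  c : Coprime (1 * suc k + cfRest ps) (suc k)
  c = coprime-*+ 1 (Coprimality.sym (subst (λ h → Coprime h (cfRest ps)) eq (cf-coprime ps)))

-- The λ-lengths of A C_{i+1} and A C_i after i fans, in terms of those of A C₁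
-- and A W₁,₁.
fanLengths : ℕ × ℕ → List ℕ → ℕ × ℕ
fanLengths (c , w) []       = c , w
fanLengths (c , w) (p ∷ ps) = fanLengths (w + p * c , c) ps

-- Every fan acts linearly on the pair of lengths, and the coefficients obey the recursion of the
-- continuants.
fanLengths-linear : ∀ c w ps → proj₁ (fanLengths (c , w) ps) ≡ cfNumerator ps * c + cfRest ps * w
fanLengths-linear c w []       = solve-∀′ c w
  where
  solve-∀′ : ∀ c w → c ≡ 1 * c + 0 * w
  solve-∀′ = solve-∀
fanLengths-linear c w (p ∷ ps) = trans (fanLengths-linear (w + p * c) c ps) (rearrange (cfNumerator ps) (cfRest ps) c w p)
  where
  rearrange : ∀ x y c w p → x * (w + p * c) + y * c ≡ (p * x + y) * c + x * w
  rearrange = solve-∀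

fanLengths₁≡a : ∀ {ps} → All (1 ≤_) ps → proj₁ (fanLengths (1 , 1) ps) ≡ a ps
fanLengths₁≡a {ps} ps≥1 = trans (fanLengths-linear 1 1 ps)
  (trans (cong₂ _+_ (*-identityʳ (cfNumerator ps)) (*-identityʳ (cfRest ps))) (sym (a≡cfNumerator+cfRest ps≥1)))

-- A fan moves its first length to the second place, so the last second length is the first length
-- one fan earlier; `take (length ps)` removes the last fan.
fanLengths₂ : ∀ s p ps → proj₂ (fanLengths s (p ∷ ps)) ≡ proj₁ (fanLengths s (take (length ps) (p ∷ ps)))
fanLengths₂ s p []       = refl
fanLengths₂ (c , w) p (q ∷ ps) = fanLengths₂ (w + p * c , c) q ps

fanLengths₂≡a : ∀ {ps} → All (1 ≤_) ps → 1 ≤ length ps → proj₂ (fanLengths (1 , 1) ps) ≡ a (take (length ps ∸ 1) ps)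
fanLengths₂≡a {p ∷ ps} ps≥1 _ = trans (fanLengths₂ (1 , 1) p ps) (fanLengths₁≡a (All.take⁺ (length ps) ps≥1))

-- The signed quiver of a lattice surface over the square [0,n+1]²

Coord : Set
Coord = ℕ × ℕ

_≟ᶜ_ : DecidableEquality Coord
_≟ᶜ_ = Product.≡-dec _≟_ _≟_

east north : Coord → Coord
east  (i , j) = suc i , j
north (i , j) = i , suc j

-- Lets a factor be evaluated under the adjacency that its bracket asserts, so that only the heights
-- of true neighbours enter.
⟦⟧-guard : ∀ {P : Set} (p : Dec P) {e e′ : ℤ} → (P → e ≡ e′) → ⟦ p ⟧ ℤ.* e ≡ ⟦ p ⟧ ℤ.* e′
⟦⟧-guard (yes p) eq = cong (1ℤ ℤ.*_) (eq p)
⟦⟧-guard (no _)  eq = refl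

⟦⟧-swap : ∀ {P Q P′ Q′ : Set} (p : Dec P) (q : Dec Q) (p′ : Dec P′) (q′ : Dec Q′) →
  (P → Q → P′ × Q′) → (P′ → Q′ → P × Q) → ⟦ p ⟧ ℤ.* ⟦ q ⟧ ≡ ⟦ p′ ⟧ ℤ.* ⟦ q′ ⟧
⟦⟧-swap p q p′ q′ f g = trans (sym (⟦⟧-× p q)) (trans (⟦⟧-cong (p ×-dec q) (p′ ×-dec q′) (λ { (x , y) → f x y }) (λ { (x , y) → g x y })) (⟦⟧-× p′ q′))

eastAt northAt : Coord → Coord → ℤ
eastAt  p v = ⟦ east p ≟ᶜ v ⟧
northAt p v = ⟦ north p ≟ᶜ v ⟧

horizontal vertical : Coord → Coord → ℤ
horizontal p v = eastAt p v ℤ.+ eastAt v p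
vertical   p v = northAt p v ℤ.+ northAt v p

module SurfaceQuiver (n : ℕ) where

  -- A row or column of the square off its boundary. Horizontal and vertical edges in the remaining
  -- rows and columns lie on the sides of the quadrilateral and carry no arrows.
  Inner : ℕ → Set
  Inner i = (1 ≤ i) × (i ≤ n)

  inner? : ∀ i → Dec (Inner i)
  inner? i = (1 ≤? i) ×-dec (i ≤? n)

  Interior : Coord → Set
  Interior p = Inner (proj₁ p) × Inner (proj₂ p)

  -- The surface consists of the points with barycentric coordinates
  -- (n+1+y-i-j , y , i-y , j-y) with respect to X, Y, R, S, where y is the height
  -- at (i , j).  The 3-cycles of its small triangles add up to a skew form that is
  -- affine in the heights.
  edges : (Coord → ℤ) → Coord → Coord → ℤ
  edges y u v =
        eastAt u v ℤ.* (⟦ inner? (proj₂ u) ⟧ ℤ.* (1ℤ ℤ.- + 2 ℤ.* (y v ℤ.- y u)))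
    ℤ.- northAt u v ℤ.* (⟦ inner? (proj₁ u) ⟧ ℤ.* (1ℤ ℤ.- + 2 ℤ.* (y v ℤ.- y u)))
    ℤ.+ ⟦ east (north u) ≟ᶜ v ⟧ ℤ.* (y (proj₁ v , proj₂ u) ℤ.- y (proj₁ u , proj₂ v))
    ℤ.+ ⟦ east v ≟ᶜ north u ⟧ ℤ.* (1ℤ ℤ.- (y (proj₁ u , proj₂ v) ℤ.- y (proj₁ v , proj₂ u)))

  -- `edges` lists each possible edge once, pointing east, north, northeast or northwest. A level
  -- step to the east counts 1 and a rising one -1, to the north with opposite signs;
  -- antisymmetrizing gives the signed number of arrows.
  form : (Coord → ℤ) → Coord → Coord → ℤ
  form y u v = edges y u v ℤ.- edges y v u

  form-skew : ∀ y u v → form y v u ≡ ℤ.- form y u v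
  form-skew y u v = skew (edges y u v) (edges y v u)
    where
    skew : ∀ a b → b ℤ.- a ≡ ℤ.- (a ℤ.- b)
    skew = ℤ-Solver.solve-∀

  form-local : ∀ {y y′ : Coord → ℤ} u v → y u ≡ y′ u → y v ≡ y′ v →
    y (proj₁ v , proj₂ u) ≡ y′ (proj₁ v , proj₂ u) → y (proj₁ u , proj₂ v) ≡ y′ (proj₁ u , proj₂ v) → form y u v ≡ form y′ u v
  form-local u v eqᵤ eqᵥ eq₁ eq₂ rewrite eqᵤ | eqᵥ | eq₁ | eq₂ = refl

  form-cong : ∀ {y y′ : Coord → ℤ} → (∀ g → y g ≡ y′ g) → ∀ u v → form y u v ≡ form y′ u v
  form-cong eq u v = form-local u v (eq u) (eq v) (eq (proj₁ v , proj₂ u)) (eq (proj₁ u , proj₂ v))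

  -- Matrix mutation at a vertex p whose row is `horizontal p - vertical p`: the first summand is
  -- minus twice the row and column of p, which reverses them; the second counts the paths through
  -- p.
  mutationChange : Coord → Coord → Coord → ℤ
  mutationChange p u v =
        ℤ.- (+ 2 ℤ.* (⟦ p ≟ᶜ u ⟧ ℤ.* (horizontal p v ℤ.- vertical p v) ℤ.- ⟦ p ≟ᶜ v ⟧ ℤ.* (horizontal p u ℤ.- vertical p u)))
    ℤ.- (horizontal p u ℤ.* vertical p v ℤ.- horizontal p v ℤ.* vertical p u)

  module _ {p : Coord} (interior : Interior p) where

    private
      δ : Coord → ℤ
      δ g = ⟦ p ≟ᶜ g ⟧

    edgesChange : Coord → Coord → ℤ
    edgesChange u v =
          + 2 ℤ.* (δ v ℤ.* eastAt u p ℤ.- δ u ℤ.* eastAt p v)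
      ℤ.- + 2 ℤ.* (δ v ℤ.* northAt u p ℤ.- δ u ℤ.* northAt p v)
      ℤ.+ (northAt u p ℤ.* eastAt p v ℤ.- eastAt u p ℤ.* northAt p v)
      ℤ.+ (northAt u p ℤ.* eastAt v p ℤ.- eastAt p u ℤ.* northAt p v)

    -- `edges` is affine in the heights, so lowering at p adds the coefficient of the height of p.
    -- The product of an edge bracket with the bracket of p fixes u and v relative to p, and is
    -- rewritten by adjacencies to p.
    edges-lower : ∀ {y y′ : Coord → ℤ} → (∀ g → y′ g ≡ y g ℤ.- δ g) → ∀ u v → edges y′ u v ≡ edges y u v ℤ.+ edgesChange u v
    edges-lower {y} {y′} lower u v
      rewrite lower u | lower v | lower (proj₁ v , proj₂ u) | lower (proj₁ u , proj₂ v) = begin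
        e ℤ.* (cₕ ℤ.* (1ℤ ℤ.- + 2 ℤ.* ((y v ℤ.- δ v) ℤ.- (y u ℤ.- δ u))))
          ℤ.- n′ ℤ.* (cᵥ ℤ.* (1ℤ ℤ.- + 2 ℤ.* ((y v ℤ.- δ v) ℤ.- (y u ℤ.- δ u))))
          ℤ.+ d ℤ.* ((y b ℤ.- δ b) ℤ.- (y c ℤ.- δ c))
          ℤ.+ t ℤ.* (1ℤ ℤ.- ((y c ℤ.- δ c) ℤ.- (y b ℤ.- δ b)))
          ≡⟨ expand e cₕ n′ cᵥ d t (y u) (y v) (y b) (y c) (δ u) (δ v) (δ b) (δ c) ⟩
        edges y u v ℤ.+ (+ 2 ℤ.* (e ℤ.* δ v ℤ.* cₕ ℤ.- e ℤ.* δ u ℤ.* cₕ) ℤ.- + 2 ℤ.* (n′ ℤ.* δ v ℤ.* cᵥ ℤ.- n′ ℤ.* δ u ℤ.* cᵥ) ℤ.+ (d ℤ.* δ c ℤ.- d ℤ.* δ b) ℤ.+ (t ℤ.* δ c ℤ.- t ℤ.* δ b))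
          ≡⟨ cong (ℤ._+_ (edges y u v)) (cong₂ ℤ._+_ (cong₂ ℤ._+_ (cong₂ ℤ._-_
               (cong (+ 2 ℤ.*_) (cong₂ ℤ._-_ e-v e-u)) (cong (+ 2 ℤ.*_) (cong₂ ℤ._-_ n-v n-u))) (cong₂ ℤ._-_ d-c d-b)) (cong₂ ℤ._-_ t-c t-b)) ⟩
        edges y u v ℤ.+ edgesChange u v ∎
      where
      open ≡-Reasoning
      b c : Coord
      b = proj₁ v , proj₂ u
      c = proj₁ u , proj₂ v
      e n′ d t cₕ cᵥ : ℤ
      e = eastAt u v
      n′ = northAt u v
      d = ⟦ east (north u) ≟ᶜ v ⟧
      t = ⟦ east v ≟ᶜ north u ⟧
      cₕ = ⟦ inner? (proj₂ u) ⟧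
      cᵥ = ⟦ inner? (proj₁ u) ⟧
      expand : ∀ e h n′ w d t yu yv yb yc δu δv δb δc →
        e ℤ.* (h ℤ.* (1ℤ ℤ.- + 2 ℤ.* ((yv ℤ.- δv) ℤ.- (yu ℤ.- δu))))
          ℤ.- n′ ℤ.* (w ℤ.* (1ℤ ℤ.- + 2 ℤ.* ((yv ℤ.- δv) ℤ.- (yu ℤ.- δu))))
          ℤ.+ d ℤ.* ((yb ℤ.- δb) ℤ.- (yc ℤ.- δc))
          ℤ.+ t ℤ.* (1ℤ ℤ.- ((yc ℤ.- δc) ℤ.- (yb ℤ.- δb)))
        ≡ e ℤ.* (h ℤ.* (1ℤ ℤ.- + 2 ℤ.* (yv ℤ.- yu)))
          ℤ.- n′ ℤ.* (w ℤ.* (1ℤ ℤ.- + 2 ℤ.* (yv ℤ.- yu)))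
          ℤ.+ d ℤ.* (yb ℤ.- yc)
          ℤ.+ t ℤ.* (1ℤ ℤ.- (yc ℤ.- yb))
          ℤ.+ (+ 2 ℤ.* (e ℤ.* δv ℤ.* h ℤ.- e ℤ.* δu ℤ.* h) ℤ.- + 2 ℤ.* (n′ ℤ.* δv ℤ.* w ℤ.- n′ ℤ.* δu ℤ.* w) ℤ.+ (d ℤ.* δc ℤ.- d ℤ.* δb) ℤ.+ (t ℤ.* δc ℤ.- t ℤ.* δb))
      expand = ℤ-Solver.solve-∀
      -- The boundary guard equals 1 as soon as one end of the edge is the interior point p.
      drop : ∀ {P Q R S : Set} (p : Dec P) (q : Dec Q) (r : Dec R) {s : ℤ} → ⟦ p ⟧ ℤ.* ⟦ q ⟧ ≡ s → (P → Q → R) → ⟦ p ⟧ ℤ.* ⟦ q ⟧ ℤ.* ⟦ r ⟧ ≡ s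
      drop (yes a) (yes b) r eq f = trans (cong (1ℤ ℤ.*_) (⟦⟧-true r (f a b))) eq
      drop (yes _) (no _)  r eq f = eq
      drop (no _)  (yes _) r eq f = eq
      drop (no _)  (no _)  r eq f = eq
      e-v : e ℤ.* δ v ℤ.* cₕ ≡ δ v ℤ.* eastAt u p
      e-v = drop {S = ⊤} (east u ≟ᶜ v) (p ≟ᶜ v) (inner? (proj₂ u))
        (⟦⟧-swap (east u ≟ᶜ v) (p ≟ᶜ v) (p ≟ᶜ v) (east u ≟ᶜ p) (λ { refl refl → refl , refl }) (λ { refl refl → refl , refl }))
        (λ { refl refl → proj₂ interior })
      e-u : e ℤ.* δ u ℤ.* cₕ ≡ δ u ℤ.* eastAt p v
      e-u = drop {S = ⊤} (east u ≟ᶜ v) (p ≟ᶜ u) (inner? (proj₂ u))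
        (⟦⟧-swap (east u ≟ᶜ v) (p ≟ᶜ u) (p ≟ᶜ u) (east p ≟ᶜ v) (λ { refl refl → refl , refl }) (λ { refl refl → refl , refl }))
        (λ { refl refl → proj₂ interior })
      n-v : n′ ℤ.* δ v ℤ.* cᵥ ≡ δ v ℤ.* northAt u p
      n-v = drop {S = ⊤} (north u ≟ᶜ v) (p ≟ᶜ v) (inner? (proj₁ u))
        (⟦⟧-swap (north u ≟ᶜ v) (p ≟ᶜ v) (p ≟ᶜ v) (north u ≟ᶜ p) (λ { refl refl → refl , refl }) (λ { refl refl → refl , refl }))
        (λ { refl refl → proj₁ interior })
      n-u : n′ ℤ.* δ u ℤ.* cᵥ ≡ δ u ℤ.* northAt p v
      n-u = drop {S = ⊤} (north u ≟ᶜ v) (p ≟ᶜ u) (inner? (proj₁ u))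
        (⟦⟧-swap (north u ≟ᶜ v) (p ≟ᶜ u) (p ≟ᶜ u) (north p ≟ᶜ v) (λ { refl refl → refl , refl }) (λ { refl refl → refl , refl }))
        (λ { refl refl → proj₁ interior })
      d-c : d ℤ.* δ c ≡ northAt u p ℤ.* eastAt p v
      d-c = ⟦⟧-swap (east (north u) ≟ᶜ v) (p ≟ᶜ c) (north u ≟ᶜ p) (east p ≟ᶜ v) (λ { refl refl → refl , refl }) (λ { refl refl → refl , refl })
      d-b : d ℤ.* δ b ≡ eastAt u p ℤ.* northAt p v
      d-b = ⟦⟧-swap (east (north u) ≟ᶜ v) (p ≟ᶜ b) (east u ≟ᶜ p) (north p ≟ᶜ v) (λ { refl refl → refl , refl }) (λ { refl refl → refl , refl })
      t-c : t ℤ.* δ c ≡ northAt u p ℤ.* eastAt v p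
      t-c = ⟦⟧-swap (east v ≟ᶜ north u) (p ≟ᶜ c) (north u ≟ᶜ p) (east v ≟ᶜ p) (λ { refl refl → refl , refl }) (λ { refl refl → refl , refl })
      t-b : t ℤ.* δ b ≡ eastAt p u ℤ.* northAt p v
      t-b = ⟦⟧-swap (east v ≟ᶜ north u) (p ≟ᶜ b) (east p ≟ᶜ u) (north p ≟ᶜ v) (λ { refl refl → refl , refl }) (λ { refl refl → refl , refl })

    form-lower : ∀ {y y′ : Coord → ℤ} → (∀ g → y′ g ≡ y g ℤ.- δ g) → ∀ u v → form y′ u v ≡ form y u v ℤ.+ mutationChange p u v
    form-lower {y} lower u v = trans (cong₂ ℤ._-_ (edges-lower {y} lower u v) (edges-lower {y} lower v u))
      (collect (edges y u v) (edges y v u) (δ u) (δ v) (eastAt u p) (eastAt p u) (northAt u p) (northAt p u) (eastAt v p) (eastAt p v) (northAt v p) (northAt p v))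
      where
      collect : ∀ a b δu δv eu e′u nu n′u ev e′v nv n′v →
        (a ℤ.+ (+ 2 ℤ.* (δv ℤ.* eu ℤ.- δu ℤ.* e′v) ℤ.- + 2 ℤ.* (δv ℤ.* nu ℤ.- δu ℤ.* n′v) ℤ.+ (nu ℤ.* e′v ℤ.- eu ℤ.* n′v) ℤ.+ (nu ℤ.* ev ℤ.- e′u ℤ.* n′v)))
        ℤ.- (b ℤ.+ (+ 2 ℤ.* (δu ℤ.* ev ℤ.- δv ℤ.* e′u) ℤ.- + 2 ℤ.* (δu ℤ.* nv ℤ.- δv ℤ.* n′u) ℤ.+ (nv ℤ.* e′u ℤ.- ev ℤ.* n′u) ℤ.+ (nv ℤ.* eu ℤ.- e′v ℤ.* n′u)))
        ≡ (a ℤ.- b) ℤ.+ (ℤ.- (+ 2 ℤ.* (δu ℤ.* ((e′v ℤ.+ ev) ℤ.- (n′v ℤ.+ nv)) ℤ.- δv ℤ.* ((e′u ℤ.+ eu) ℤ.- (n′u ℤ.+ nu))))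
          ℤ.- ((e′u ℤ.+ eu) ℤ.* (n′v ℤ.+ nv) ℤ.- (e′v ℤ.+ ev) ℤ.* (n′u ℤ.+ nu)))
      collect = ℤ-Solver.solve-∀

  module _ {i j : ℕ} (interior : Interior (suc i , suc j)) (y : Coord → ℤ) {h : ℤ}
    (at : y (suc i , suc j) ≡ h)
    (atEast : y (suc (suc i) , suc j) ≡ h) (atNorth : y (suc i , suc (suc j)) ≡ h)
    (atWest : y (i , suc j) ≡ h ℤ.- 1ℤ) (atSouth : y (suc i , j) ≡ h ℤ.- 1ℤ) where

    private
      p : Coord
      p = suc i , suc j

    innerEdge : ∀ {k a b c d} → Inner k → a ≡ b → c ≡ d → ⟦ inner? k ⟧ ℤ.* (1ℤ ℤ.- + 2 ℤ.* (a ℤ.- c)) ≡ 1ℤ ℤ.* (1ℤ ℤ.- + 2 ℤ.* (b ℤ.- d))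
    innerEdge {k} inner refl refl = cong (ℤ._* _) (⟦⟧-true (inner? k) inner)

    -- The diagonal terms vanish: the heights to the east and north agree, and the height to the
    -- north exceeds the one to the west by exactly 1.
    row-out : ∀ v → edges y p v ≡ eastAt p v ℤ.- northAt p v
    row-out v = trans (cong₂ ℤ._+_ (cong₂ ℤ._+_ (cong₂ ℤ._-_
        (⟦⟧-guard (east p ≟ᶜ v) {e′ = 1ℤ} λ { refl → trans (innerEdge (proj₂ interior) atEast at) (flat h) })
        (⟦⟧-guard (north p ≟ᶜ v) {e′ = 1ℤ} λ { refl → trans (innerEdge (proj₁ interior) atNorth at) (flat h) }))
        (⟦⟧-guard (east (north p) ≟ᶜ v) {e′ = 0ℤ} λ { refl → trans (cong₂ ℤ._-_ atEast atNorth) (ℤ.+-inverseʳ h) }))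
        (⟦⟧-guard (east v ≟ᶜ north p) {e′ = 0ℤ} λ { refl → trans (cong₂ (λ x z → 1ℤ ℤ.- (x ℤ.- z)) atNorth atWest) (level h) }))
      (drop (eastAt p v) (northAt p v) ⟦ east (north p) ≟ᶜ v ⟧ ⟦ east v ≟ᶜ north p ⟧)
      where
      flat : ∀ h → 1ℤ ℤ.* (1ℤ ℤ.- + 2 ℤ.* (h ℤ.- h)) ≡ 1ℤ
      flat = ℤ-Solver.solve-∀
      level : ∀ h → 1ℤ ℤ.- (h ℤ.- (h ℤ.- 1ℤ)) ≡ 0ℤ
      level = ℤ-Solver.solve-∀
      drop : ∀ a b c d → a ℤ.* 1ℤ ℤ.- b ℤ.* 1ℤ ℤ.+ c ℤ.* 0ℤ ℤ.+ d ℤ.* 0ℤ ≡ a ℤ.- b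
      drop = ℤ-Solver.solve-∀

    row-in : ∀ v → edges y v p ≡ northAt v p ℤ.- eastAt v p
    row-in v = trans (cong₂ ℤ._+_ (cong₂ ℤ._+_ (cong₂ ℤ._-_
        (⟦⟧-guard (east v ≟ᶜ p) {e′ = ℤ.- 1ℤ} λ { refl → trans (innerEdge (proj₂ interior) at atWest) (steep h) })
        (⟦⟧-guard (north v ≟ᶜ p) {e′ = ℤ.- 1ℤ} λ { refl → trans (innerEdge (proj₁ interior) at atSouth) (steep h) }))
        (⟦⟧-guard (east (north v) ≟ᶜ p) {e′ = 0ℤ} λ { refl → trans (cong₂ ℤ._-_ atSouth atWest) (ℤ.+-inverseʳ (h ℤ.- 1ℤ)) }))
        (⟦⟧-guard (east p ≟ᶜ north v) {e′ = 0ℤ} λ { refl → trans (cong₂ (λ x z → 1ℤ ℤ.- (x ℤ.- z)) atEast atSouth) (level h) }))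
      (drop (eastAt v p) (northAt v p) ⟦ east (north v) ≟ᶜ p ⟧ ⟦ east p ≟ᶜ north v ⟧)
      where
      steep : ∀ h → 1ℤ ℤ.* (1ℤ ℤ.- + 2 ℤ.* (h ℤ.- (h ℤ.- 1ℤ))) ≡ ℤ.- 1ℤ
      steep = ℤ-Solver.solve-∀
      level : ∀ h → 1ℤ ℤ.- (h ℤ.- (h ℤ.- 1ℤ)) ≡ 0ℤ
      level = ℤ-Solver.solve-∀
      drop : ∀ a b c d → a ℤ.* ℤ.- 1ℤ ℤ.- b ℤ.* ℤ.- 1ℤ ℤ.+ c ℤ.* 0ℤ ℤ.+ d ℤ.* 0ℤ ≡ b ℤ.- a
      drop = ℤ-Solver.solve-∀

    -- A level step leaving p and a rising step entering p give the same sign, so opposite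
    -- neighbours have equal entries and arrows leave along one axis and enter along the other.
    form-row : ∀ v → form y p v ≡ horizontal p v ℤ.- vertical p v
    form-row v = trans (cong₂ ℤ._-_ (row-out v) (row-in v)) (collect (eastAt p v) (northAt p v) (eastAt v p) (northAt v p))
      where
      collect : ∀ a b c d → (a ℤ.- b) ℤ.- (d ℤ.- c) ≡ (a ℤ.+ c) ℤ.- (b ℤ.+ d)
      collect = ℤ-Solver.solve-∀

-- Mutation at a vertex at which the surface has a local maximum

positivePart : ℤ → ℕ
positivePart (+ k)    = k
positivePart -[1+ k ] = 0

-- The sign of an orientation: reflecting a triangle reverses all its arrows.
signed : Bool → ℤ → ℤ
signed true  z = z
signed false z = ℤ.- z

signed-neg : ∀ σ z → signed σ (ℤ.- z) ≡ ℤ.- signed σ z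
signed-neg true  z = refl
signed-neg false z = refl

signed-+ : ∀ σ y z → signed σ (y ℤ.+ z) ≡ signed σ y ℤ.+ signed σ z
signed-+ true  y z = refl
signed-+ false y z = ℤ.neg-distrib-+ y z

positivePart-⊖ : ∀ k l → positivePart (k ℤ.⊖ l) ≡ k ∸ l
positivePart-⊖ zero    zero    = refl
positivePart-⊖ zero    (suc l) = refl
positivePart-⊖ (suc k) zero    = refl
positivePart-⊖ (suc k) (suc l) = trans (cong positivePart (ℤ.[1+m]⊖[1+n]≡m⊖n k l)) (positivePart-⊖ k l)

Skew : ∀ {K} → (Fin K → Fin K → ℤ) → Set
Skew ε = ∀ u v → ε v u ≡ ℤ.- ε u v

PositivePartOf : ∀ {K} → (Fin K → Fin K → ℤ) → (Fin K → Fin K → ℕ) → Set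
PositivePartOf ε b = ∀ u v → b u v ≡ positivePart (ε u v)

-- For positive parts of a skew matrix, `b u v - b v u` is `ε u v`. Cancelling 2-cycles by truncated
-- subtraction is therefore the positive part of the ordinary matrix mutation.
mutateArrows-positivePart : ∀ {K} {ε ε′ : Fin K → Fin K → ℤ} {b} (p : Fin K) → Skew ε → PositivePartOf ε b →
  (∀ v → ε′ p v ≡ ℤ.- ε p v) → (∀ u → ε′ u p ≡ ℤ.- ε u p) →
  (∀ {u v} → u ≢ p → v ≢ p → ε′ u v ≡ ε u v ℤ.+ (+ (b u p * b p v) ℤ.- + (b v p * b p u))) →
  PositivePartOf ε′ (mutateArrows p b)
mutateArrows-positivePart {ε = ε} {ε′} {b} p skew b≡ row col other u v with u Fin.≟ p | v Fin.≟ p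
... | yes refl | _        = trans (b≡ v u) (cong positivePart (trans (skew u v) (sym (row v))))
... | no _     | yes refl = trans (b≡ v u) (cong positivePart (trans (skew u v) (sym (col u))))
... | no u≢p   | no v≢p   = sym (begin
  positivePart (ε′ u v)                                  ≡⟨ cong positivePart (other u≢p v≢p) ⟩
  positivePart (ε u v ℤ.+ (+ s ℤ.- + t))                 ≡⟨ cong (λ e → positivePart (e ℤ.+ (+ s ℤ.- + t))) ε≡ ⟩
  positivePart ((+ b u v ℤ.- + b v u) ℤ.+ (+ s ℤ.- + t)) ≡⟨ cong positivePart (regroup (+ b u v) (+ b v u) (+ s) (+ t)) ⟩
  positivePart (+ (b u v + s) ℤ.- + (b v u + t))         ≡⟨ cong positivePart (ℤ.m-n≡m⊖n (b u v + s) (b v u + t)) ⟩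
  positivePart ((b u v + s) ℤ.⊖ (b v u + t))             ≡⟨ positivePart-⊖ (b u v + s) (b v u + t) ⟩
  (b u v + s) ∸ (b v u + t)                              ∎)
  where
  open ≡-Reasoning
  s t : ℕ
  s = b u p * b p v
  t = b v p * b p u
  regroup : ∀ a b c d → (a ℤ.- b) ℤ.+ (c ℤ.- d) ≡ (a ℤ.+ c) ℤ.- (b ℤ.+ d)
  regroup = ℤ-Solver.solve-∀
  split : ∀ z → z ≡ + positivePart z ℤ.- + positivePart (ℤ.- z)
  split (+ zero)  = refl
  split (+ suc k) = sym (ℤ.+-identityʳ (+ suc k))
  split -[1+ k ]  = sym (ℤ.+-identityˡ -[1+ k ])
  ε≡ : ε u v ≡ + b u v ℤ.- + b v u
  ε≡ = trans (split (ε u v)) (cong₂ (λ x y → + x ℤ.- + y) (sym (b≡ u v)) (trans (cong positivePart (sym (skew u v))) (sym (b≡ v u))))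

data Axes (p v : Coord) : Set where
  horizontally : horizontal p v ≡ 1ℤ → vertical p v ≡ 0ℤ → Axes p v
  vertically   : horizontal p v ≡ 0ℤ → vertical p v ≡ 1ℤ → Axes p v
  neither      : horizontal p v ≡ 0ℤ → vertical p v ≡ 0ℤ → Axes p v

axes : ∀ p v → Axes p v
axes p v with east p ≟ᶜ v | east v ≟ᶜ p | north p ≟ᶜ v | north v ≟ᶜ p
... | yes refl | yes ()   | _        | _
... | yes refl | no _     | yes ()   | _
... | yes refl | no _     | no _     | yes ()
... | yes refl | no w     | no s     | no s′    = horizontally (cong₂ ℤ._+_ (⟦⟧-true (east p ≟ᶜ v) refl) (⟦⟧-false (east v ≟ᶜ p) w)) (cong₂ ℤ._+_ (⟦⟧-false (north p ≟ᶜ v) s) (⟦⟧-false (north v ≟ᶜ p) s′))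
... | no e     | yes refl | yes ()   | _
... | no e     | yes refl | no _     | yes ()
... | no e     | yes refl | no s     | no s′    = horizontally (cong₂ ℤ._+_ (⟦⟧-false (east p ≟ᶜ v) e) (⟦⟧-true (east v ≟ᶜ p) refl)) (cong₂ ℤ._+_ (⟦⟧-false (north p ≟ᶜ v) s) (⟦⟧-false (north v ≟ᶜ p) s′))
... | no e     | no w     | yes refl | yes ()
... | no e     | no w     | yes refl | no s′    = vertically (cong₂ ℤ._+_ (⟦⟧-false (east p ≟ᶜ v) e) (⟦⟧-false (east v ≟ᶜ p) w)) (cong₂ ℤ._+_ (⟦⟧-true (north p ≟ᶜ v) refl) (⟦⟧-false (north v ≟ᶜ p) s′))
... | no e     | no w     | no s     | yes refl = vertically (cong₂ ℤ._+_ (⟦⟧-false (east p ≟ᶜ v) e) (⟦⟧-false (east v ≟ᶜ p) w)) (cong₂ ℤ._+_ (⟦⟧-false (north p ≟ᶜ v) s) (⟦⟧-true (north v ≟ᶜ p) refl))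
... | no e     | no w     | no s     | no s′    = neither (cong₂ ℤ._+_ (⟦⟧-false (east p ≟ᶜ v) e) (⟦⟧-false (east v ≟ᶜ p) w)) (cong₂ ℤ._+_ (⟦⟧-false (north p ≟ᶜ v) s) (⟦⟧-false (north v ≟ᶜ p) s′))

-- At a peak the two monomials of the exchange relation belong to the two axes; the orientation only
-- decides which of them is outgoing.
outAxis inAxis : Bool → Coord → Coord → ℤ
outAxis σ p v = if σ then horizontal p v else vertical p v
inAxis  σ p v = if σ then vertical p v else horizontal p v

positivePart-row : ∀ σ p v →
  + positivePart (signed σ (horizontal p v ℤ.- vertical p v)) ≡ outAxis σ p v ×
  + positivePart (ℤ.- signed σ (horizontal p v ℤ.- vertical p v)) ≡ inAxis σ p v
positivePart-row true  p v with axes p v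
... | horizontally h w rewrite h | w = refl , refl
... | vertically h w   rewrite h | w = refl , refl
... | neither h w      rewrite h | w = refl , refl
positivePart-row false p v with axes p v
... | horizontally h w rewrite h | w = refl , refl
... | vertically h w   rewrite h | w = refl , refl
... | neither h w      rewrite h | w = refl , refl

horizontal-self : ∀ p → horizontal p p ≡ 0ℤ
horizontal-self p = cong₂ ℤ._+_ (⟦⟧-false (east p ≟ᶜ p) (λ ())) (⟦⟧-false (east p ≟ᶜ p) (λ ()))

vertical-self : ∀ p → vertical p p ≡ 0ℤ
vertical-self p = cong₂ ℤ._+_ (⟦⟧-false (north p ≟ᶜ p) (λ ())) (⟦⟧-false (north p ≟ᶜ p) (λ ()))

module _ (n : ℕ) where
  open SurfaceQuiver n

  mutationChange-row : ∀ p v → mutationChange p p v ≡ ℤ.- (+ 2 ℤ.* (horizontal p v ℤ.- vertical p v))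
  mutationChange-row p v rewrite ⟦⟧-true (p ≟ᶜ p) refl | horizontal-self p | vertical-self p =
    simplify ⟦ p ≟ᶜ v ⟧ (horizontal p v) (vertical p v)
    where
    simplify : ∀ d h w → ℤ.- (+ 2 ℤ.* (1ℤ ℤ.* (h ℤ.- w) ℤ.- d ℤ.* (0ℤ ℤ.- 0ℤ))) ℤ.- (0ℤ ℤ.* w ℤ.- h ℤ.* 0ℤ) ≡ ℤ.- (+ 2 ℤ.* (h ℤ.- w))
    simplify = ℤ-Solver.solve-∀

  mutationChange-away : ∀ σ {p u v} → p ≢ u → p ≢ v →
    signed σ (mutationChange p u v) ≡ inAxis σ p u ℤ.* outAxis σ p v ℤ.- inAxis σ p v ℤ.* outAxis σ p u
  mutationChange-away σ {p} {u} {v} p≢u p≢v rewrite ⟦⟧-false (p ≟ᶜ u) p≢u | ⟦⟧-false (p ≟ᶜ v) p≢v = case σ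
    where
    simplify : ∀ h k w z → ℤ.- (+ 2 ℤ.* (0ℤ ℤ.* (k ℤ.- z) ℤ.- 0ℤ ℤ.* (h ℤ.- w))) ℤ.- (h ℤ.* z ℤ.- k ℤ.* w) ≡ w ℤ.* k ℤ.- z ℤ.* h
    simplify = ℤ-Solver.solve-∀
    simplify′ : ∀ h k w z → ℤ.- (ℤ.- (+ 2 ℤ.* (0ℤ ℤ.* (k ℤ.- z) ℤ.- 0ℤ ℤ.* (h ℤ.- w))) ℤ.- (h ℤ.* z ℤ.- k ℤ.* w)) ≡ h ℤ.* z ℤ.- k ℤ.* w
    simplify′ = ℤ-Solver.solve-∀
    case : ∀ σ → signed σ (ℤ.- (+ 2 ℤ.* (0ℤ ℤ.* (horizontal p v ℤ.- vertical p v) ℤ.- 0ℤ ℤ.* (horizontal p u ℤ.- vertical p u))) ℤ.- (horizontal p u ℤ.* vertical p v ℤ.- horizontal p v ℤ.* vertical p u))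
      ≡ inAxis σ p u ℤ.* outAxis σ p v ℤ.- inAxis σ p v ℤ.* outAxis σ p u
    case true  = simplify (horizontal p u) (horizontal p v) (vertical p u) (vertical p v)
    case false = simplify′ (horizontal p u) (horizontal p v) (vertical p u) (vertical p v)

∏ℕ-cong : ∀ {A : Set} (xs : List A) {f g : A → ℕ} → (∀ x → f x ≡ g x) → ∏ℕ xs f ≡ ∏ℕ xs g
∏ℕ-cong []       eq = refl
∏ℕ-cong (x ∷ xs) eq = cong₂ _*_ (eq x) (∏ℕ-cong xs eq)

∏ℕ-* : ∀ {A : Set} (xs : List A) (f g : A → ℕ) → ∏ℕ xs (λ x → f x * g x) ≡ ∏ℕ xs f * ∏ℕ xs g
∏ℕ-* []       f g = refl
∏ℕ-* (x ∷ xs) f g = trans (cong ((f x * g x) *_) (∏ℕ-* xs f g)) (interchange (f x) (g x) (∏ℕ xs f) (∏ℕ xs g))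
  where
  interchange : ∀ a b c d → a * b * (c * d) ≡ a * c * (b * d)
  interchange = solve-∀

∏ℕ-indicator : ∀ {A : Set} (_≟_ : DecidableEquality A) (t : A → ℕ) {xs x} → Unique xs → x ∈ xs →
  ∏ℕ xs (λ y → t y ^ positivePart ⟦ x ≟ y ⟧) ≡ t x
∏ℕ-indicator {A} _≟_ t {y ∷ ys} {x} (y# ∷ u) (here refl) =
  trans (cong₂ _*_ (trans (cong (λ e → t x ^ positivePart e) (⟦⟧-true (x ≟ x) refl)) (*-identityʳ (t x))) (absent ys y#)) (*-identityʳ (t x))
  where
  absent : ∀ zs → All (x ≢_) zs → ∏ℕ zs (λ y → t y ^ positivePart ⟦ x ≟ y ⟧) ≡ 1
  absent []       []       = refl
  absent (z ∷ zs) (p ∷ ps) = cong₂ _*_ (cong (λ e → t z ^ positivePart e) (⟦⟧-false (x ≟ z) p)) (absent zs ps)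
∏ℕ-indicator _≟_ t {y ∷ ys} {x} (y# ∷ u) (there x∈) =
  trans (cong₂ _*_ (cong (λ e → t y ^ positivePart e) (⟦⟧-false (x ≟ y) (λ x≡y → All.lookup y# x∈ (sym x≡y)))) (∏ℕ-indicator _≟_ t u x∈)) (+-identityʳ (t x))

-- Reduces a product over all vertices of the quiver to the two neighbours of a peak on one axis.
∏ℕ-pair : ∀ {K} (t : Fin K → ℕ) (e : Fin K → ℤ) (u v : Fin K) →
  (∀ w → e w ≡ ⟦ u Fin.≟ w ⟧ ℤ.+ ⟦ v Fin.≟ w ⟧) → ∏ℕ (allFin K) (λ w → t w ^ positivePart (e w)) ≡ t u * t v
∏ℕ-pair {K} t e u v eq = begin
  ∏ℕ (allFin K) (λ w → t w ^ positivePart (e w))                                            ≡⟨ ∏ℕ-cong (allFin K) split ⟩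
  ∏ℕ (allFin K) (λ w → t w ^ positivePart ⟦ u Fin.≟ w ⟧ * t w ^ positivePart ⟦ v Fin.≟ w ⟧) ≡⟨ ∏ℕ-* (allFin K) (λ w → t w ^ positivePart ⟦ u Fin.≟ w ⟧) (λ w → t w ^ positivePart ⟦ v Fin.≟ w ⟧) ⟩
  ∏ℕ (allFin K) (λ w → t w ^ positivePart ⟦ u Fin.≟ w ⟧) * ∏ℕ (allFin K) (λ w → t w ^ positivePart ⟦ v Fin.≟ w ⟧)
    ≡⟨ cong₂ _*_ (∏ℕ-indicator Fin._≟_ t (Unique.allFin⁺ K) (∈-allFin u)) (∏ℕ-indicator Fin._≟_ t (Unique.allFin⁺ K) (∈-allFin v)) ⟩
  t u * t v                                                                                 ∎
  where
  open ≡-Reasoning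
  +-parts : ∀ {P Q : Set} (p : Dec P) (q : Dec Q) → positivePart (⟦ p ⟧ ℤ.+ ⟦ q ⟧) ≡ positivePart ⟦ p ⟧ + positivePart ⟦ q ⟧
  +-parts (yes _) (yes _) = refl
  +-parts (yes _) (no _)  = refl
  +-parts (no _)  (yes _) = refl
  +-parts (no _)  (no _)  = refl
  split : ∀ w → t w ^ positivePart (e w) ≡ t w ^ positivePart ⟦ u Fin.≟ w ⟧ * t w ^ positivePart ⟦ v Fin.≟ w ⟧
  split w = trans (cong (λ z → t w ^ positivePart z) (eq w)) (trans (cong (t w ^_) (+-parts (u Fin.≟ w) (v Fin.≟ w))) (^-distribˡ-+-* (t w) (positivePart ⟦ u Fin.≟ w ⟧) _))

-- During a flip a vertex keeps its coordinates `κ` and changes only its height, so its value is a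
-- function `val v` of the height. Injectivity is asked only inside the square because all vertices
-- outside the quadrilateral share one coordinate. `rest` holds the arrows of the other triangles.
module FlipQuiver (n : ℕ) {K : ℕ} (κ : Fin K → Coord)
  (κ-injective : ∀ {u v} → proj₁ (κ u) ≤ suc n → proj₂ (κ u) ≤ suc n → κ u ≡ κ v → u ≡ v)
  (rest : Fin K → Fin K → ℤ) (rest-skew : Skew rest)
  (σ : Bool) (val : Fin K → ℕ → ℕ) where

  open SurfaceQuiver n

  exchangeMatrix : (Coord → ℕ) → Fin K → Fin K → ℤ
  exchangeMatrix y u v = rest u v ℤ.+ signed σ (form (+_ ∘ y) (κ u) (κ v))

  record SeedAt (y : Coord → ℕ) (s : Seed K) : Set where
    constructor seedAt
    field
      arrows≡ : PositivePartOf (exchangeMatrix y) (arrows s)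
      values  : ∀ v → var s v at𝟙≡ val v (y (κ v))
  open SeedAt

  exchangeMatrix-skew : ∀ y → Skew (exchangeMatrix y)
  exchangeMatrix-skew y u v = trans
    (cong₂ ℤ._+_ (rest-skew u v) (trans (cong (signed σ) (form-skew (+_ ∘ y) (κ u) (κ v))) (signed-neg σ (form (+_ ∘ y) (κ u) (κ v)))))
    (sym (ℤ.neg-distrib-+ (rest u v) (signed σ (form (+_ ∘ y) (κ u) (κ v)))))

  SeedAt-cong : ∀ {y y′ s} → (∀ g → y g ≡ y′ g) → SeedAt y s → SeedAt y′ s
  SeedAt-cong {y} {y′} {s} eq (seedAt a≡ vs) = seedAt
    (λ u v → trans (a≡ u v) (cong (λ f → positivePart (rest u v ℤ.+ signed σ f)) (form-cong (λ g → cong +_ (eq g)) (κ u) (κ v))))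
    (λ v → subst (λ h → var s v at𝟙≡ val v h) (eq (κ v)) (vs v))

  module _ {i j h : ℕ} {p e w nn ss : Fin K} {y y′ : Coord → ℕ}
    (κp : κ p ≡ (suc i , suc j)) (interior : Interior (suc i , suc j))
    (κe : κ e ≡ (suc (suc i) , suc j)) (κw : κ w ≡ (i , suc j)) (κn : κ nn ≡ (suc i , suc (suc j))) (κs : κ ss ≡ (suc i , j))
    (rest-zero : ∀ v → rest p v ≡ 0ℤ)
    (at : y (suc i , suc j) ≡ suc h)
    (atEast : y (suc (suc i) , suc j) ≡ suc h) (atNorth : y (suc i , suc (suc j)) ≡ suc h)
    (atWest : y (i , suc j) ≡ h) (atSouth : y (suc i , j) ≡ h)
    (at′ : y′ (suc i , suc j) ≡ h) (elsewhere : ∀ {g} → g ≢ (suc i , suc j) → y′ g ≡ y g)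
    (positive : 1 ≤ val p (suc h))
    (exchange : val p (suc h) * val p h ≡ val e (suc h) * val w h + val nn (suc h) * val ss h)
    {s : Seed K} (S : SeedAt y s) where

    private
      P : Coord
      P = suc i , suc j

      p-unique : ∀ {v} → P ≡ κ v → p ≡ v
      p-unique eq = κ-injective (subst (λ k → proj₁ k ≤ suc n) (sym κp) (m≤n⇒m≤1+n (proj₂ (proj₁ interior))))
        (subst (λ k → proj₂ k ≤ suc n) (sym κp) (m≤n⇒m≤1+n (proj₂ (proj₂ interior)))) (trans κp eq)

      lower : ∀ g → + y′ g ≡ + y g ℤ.- ⟦ P ≟ᶜ g ⟧
      lower g with P ≟ᶜ g
      ... | yes refl rewrite at | at′ = refl
      ... | no P≢g   = trans (cong +_ (elsewhere (P≢g ∘ sym))) (sym (ℤ.+-identityʳ (+ y g)))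

      changed : ∀ u v → exchangeMatrix y′ u v ≡ exchangeMatrix y u v ℤ.+ signed σ (mutationChange P (κ u) (κ v))
      changed u v = trans
        (cong (ℤ._+_ (rest u v)) (trans (cong (signed σ) (form-lower interior {+_ ∘ y} lower (κ u) (κ v))) (signed-+ σ (form (+_ ∘ y) (κ u) (κ v)) (mutationChange P (κ u) (κ v)))))
        (sym (ℤ.+-assoc (rest u v) _ _))

      row : ∀ v → exchangeMatrix y p v ≡ signed σ (horizontal P (κ v) ℤ.- vertical P (κ v))
      row v = trans (cong₂ (λ r k → r ℤ.+ signed σ (form (+_ ∘ y) k (κ v))) (rest-zero v) κp)
        (trans (ℤ.+-identityˡ _) (cong (signed σ) (form-row interior (+_ ∘ y) (cong +_ at) (cong +_ atEast) (cong +_ atNorth) (cong +_ atWest) (cong +_ atSouth) (κ v))))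

      arrows-out : ∀ v → + arrows s p v ≡ outAxis σ P (κ v)
      arrows-out v = trans (cong +_ (trans (arrows≡ S p v) (cong positivePart (row v)))) (proj₁ (positivePart-row σ P (κ v)))

      arrows-in : ∀ v → + arrows s v p ≡ inAxis σ P (κ v)
      arrows-in v = trans (cong +_ (trans (arrows≡ S v p) (cong positivePart (trans (exchangeMatrix-skew y p v) (cong ℤ.-_ (row v)))))) (proj₂ (positivePart-row σ P (κ v)))

      changed-row : ∀ v → exchangeMatrix y′ p v ≡ ℤ.- exchangeMatrix y p v
      changed-row v = begin
        exchangeMatrix y′ p v                                                       ≡⟨ changed p v ⟩
        exchangeMatrix y p v ℤ.+ signed σ (mutationChange P (κ p) (κ v))            ≡⟨ cong₂ ℤ._+_ (row v) (cong (signed σ) (trans (cong (λ k → mutationChange P k (κ v)) κp) (mutationChange-row n P (κ v)))) ⟩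
        signed σ r ℤ.+ signed σ (ℤ.- (+ 2 ℤ.* r))                                   ≡⟨ signed-+ σ r (ℤ.- (+ 2 ℤ.* r)) ⟨
        signed σ (r ℤ.- + 2 ℤ.* r)                                                  ≡⟨ cong (signed σ) (negate r) ⟩
        signed σ (ℤ.- r)                                                            ≡⟨ signed-neg σ r ⟩
        ℤ.- signed σ r                                                              ≡⟨ cong ℤ.-_ (row v) ⟨
        ℤ.- exchangeMatrix y p v                                                    ∎
        where
        open ≡-Reasoning
        r : ℤ
        r = horizontal P (κ v) ℤ.- vertical P (κ v)
        negate : ∀ r → r ℤ.- + 2 ℤ.* r ≡ ℤ.- r
        negate = ℤ-Solver.solve-∀

      changed-column : ∀ u → exchangeMatrix y′ u p ≡ ℤ.- exchangeMatrix y u p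
      changed-column u = trans (exchangeMatrix-skew y′ p u) (cong ℤ.-_ (trans (changed-row u) (sym (exchangeMatrix-skew y p u))))

      changed-away : ∀ {u v} → u ≢ p → v ≢ p →
        exchangeMatrix y′ u v ≡ exchangeMatrix y u v ℤ.+ (+ (arrows s u p * arrows s p v) ℤ.- + (arrows s v p * arrows s p u))
      changed-away {u} {v} u≢p v≢p = trans (changed u v) (cong (ℤ._+_ (exchangeMatrix y u v))
        (trans (mutationChange-away n σ (u≢p ∘ sym ∘ p-unique) (v≢p ∘ sym ∘ p-unique)) (cong₂ ℤ._-_ (product u v) (product v u))))
        where
        product : ∀ u v → inAxis σ P (κ u) ℤ.* outAxis σ P (κ v) ≡ + (arrows s u p * arrows s p v)
        product u v = trans (cong₂ ℤ._*_ (sym (arrows-in u)) (sym (arrows-out v))) (sym (ℤ.pos-* (arrows s u p) (arrows s p v)))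

      t : Fin K → ℕ
      t v = val v (y (κ v))

      at-vertex : ∀ {v g k} → κ v ≡ g → y g ≡ k → t v ≡ val v k
      at-vertex refl refl = refl

      indicator : ∀ {g x} → κ x ≡ g → proj₁ g ≤ suc n → proj₂ g ≤ suc n → ∀ v → ⟦ g ≟ᶜ κ v ⟧ ≡ ⟦ x Fin.≟ v ⟧
      indicator {x = x} refl b₁ b₂ v = ⟦⟧-cong (κ x ≟ᶜ κ v) (x Fin.≟ v) (κ-injective b₁ b₂) (cong κ)

      shifted : ∀ {f : Coord → Coord} {g} → f g ≡ P → (∀ {a b} → f a ≡ f b → a ≡ b) → ∀ v → ⟦ f (κ v) ≟ᶜ P ⟧ ≡ ⟦ g ≟ᶜ κ v ⟧
      shifted {f} {g} fg inj v = ⟦⟧-cong (f (κ v) ≟ᶜ P) (g ≟ᶜ κ v) (λ eq → inj (trans fg (sym eq))) (λ { refl → fg })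

      i≤ : suc i ≤ suc n
      i≤ = m≤n⇒m≤1+n (proj₂ (proj₁ interior))
      j≤ : suc j ≤ suc n
      j≤ = m≤n⇒m≤1+n (proj₂ (proj₂ interior))

      horizontalProduct : ∏ℕ (allFin K) (λ v → t v ^ positivePart (horizontal P (κ v))) ≡ val e (suc h) * val w h
      horizontalProduct = trans (∏ℕ-pair t (horizontal P ∘ κ) e w (λ v → cong₂ ℤ._+_
          (indicator κe (s≤s (proj₂ (proj₁ interior))) j≤ v)
          (trans (shifted {east} refl (λ { refl → refl }) v) (indicator κw (≤-trans (n≤1+n i) i≤) j≤ v))))
        (cong₂ _*_ (at-vertex κe atEast) (at-vertex κw atWest))

      verticalProduct : ∏ℕ (allFin K) (λ v → t v ^ positivePart (vertical P (κ v))) ≡ val nn (suc h) * val ss h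
      verticalProduct = trans (∏ℕ-pair t (vertical P ∘ κ) nn ss (λ v → cong₂ ℤ._+_
          (indicator κn i≤ (s≤s (proj₂ (proj₂ interior))) v)
          (trans (shifted {north} refl (λ { refl → refl }) v) (indicator κs i≤ (≤-trans (n≤1+n j) j≤) v))))
        (cong₂ _*_ (at-vertex κn atNorth) (at-vertex κs atSouth))

      exponents : ∀ {f : Fin K → ℕ} {g : Fin K → ℤ} → (∀ v → + f v ≡ g v) →
        ∏ℕ (allFin K) (λ v → t v ^ f v) ≡ ∏ℕ (allFin K) (λ v → t v ^ positivePart (g v))
      exponents eq = ∏ℕ-cong (allFin K) (λ v → cong (λ z → t v ^ positivePart z) (eq v))

      sumOfProducts : ∀ σ → (∀ v → + arrows s p v ≡ outAxis σ P (κ v)) → (∀ v → + arrows s v p ≡ inAxis σ P (κ v)) →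
        ∏ℕ (allFin K) (λ v → t v ^ arrows s p v) + ∏ℕ (allFin K) (λ v → t v ^ arrows s v p) ≡ val p (suc h) * val p h
      sumOfProducts true out in′ = trans (cong₂ _+_ (trans (exponents out) horizontalProduct) (trans (exponents in′) verticalProduct)) (sym exchange)
      sumOfProducts false out in′ = trans (cong₂ _+_ (trans (exponents out) verticalProduct) (trans (exponents in′) horizontalProduct)) (trans (+-comm _ (val e (suc h) * val w h)) (sym exchange))

      outgoing incoming : Fin K → Rational⁺ K
      outgoing v = var s v ^^ arrows s p v
      incoming v = var s v ^^ arrows s v p

      newValue : ((∏ outgoing ⊞ ∏ incoming) ÷ var s p) at𝟙≡ val p h
      newValue = ÷-at𝟙 {f = ∏ outgoing ⊞ ∏ incoming} {var s p} positive
        (subst ((∏ outgoing ⊞ ∏ incoming) at𝟙≡_) (sumOfProducts σ arrows-out arrows-in)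
          (⊞-at𝟙 {f = ∏ outgoing} {∏ incoming}
            (∏-at𝟙 {f = outgoing} (λ v → ^^-at𝟙 (values S v) (arrows s p v)))
            (∏-at𝟙 {f = incoming} (λ v → ^^-at𝟙 (values S v) (arrows s v p)))))
        (subst (var s p at𝟙≡_) (at-vertex κp at) (values S p))

    -- As `rest` vanishes on the row of p, the arrows at p are those of the peak; hence mutating
    -- there and lowering the surface have the same effect, and `exchange` supplies the new value.
    SeedAt-mutate : SeedAt y′ (mutate s p)
    SeedAt-mutate = seedAt
      (mutateArrows-positivePart p (exchangeMatrix-skew y) (arrows≡ S) changed-row changed-column changed-away)
      values′
      where
      values′ : ∀ v → var (mutate s p) v at𝟙≡ val v (y′ (κ v))
      values′ v with v Fin.≟ p
      ... | yes refl = subst (λ k → ((∏ outgoing ⊞ ∏ incoming) ÷ var s p) at𝟙≡ val p k) (sym (trans (cong y′ κp) at′)) newValue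
      ... | no v≢p   = subst (λ k → var s v at𝟙≡ val v k) (sym (elsewhere (λ eq → v≢p (sym (p-unique (sym eq)))))) (values S v)

-- The heights of the surface during a flip

parity-step : ∀ k → suc k % 2 ≢ k % 2
parity-step zero          ()
parity-step (suc zero)    ()
parity-step (suc (suc k)) eq = parity-step k eq

parity-∣-∣ : ∀ r s → ∣ r - s ∣ % 2 ≡ (r + s) % 2
parity-∣-∣ zero    s       = refl
parity-∣-∣ (suc r) zero    = cong (λ t → suc t % 2) (sym (+-identityʳ r))
parity-∣-∣ (suc r) (suc s) = trans (parity-∣-∣ r s) (cong (λ t → suc t % 2) (sym (+-suc r s)))

∣-∣-zero : ∀ r s → r ≡ 0 ⊎ s ≡ 0 → ∣ r - s ∣ ≡ r + s
∣-∣-zero r s (inj₁ refl) = refl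
∣-∣-zero r s (inj₂ refl) = trans (∣-∣-identityʳ r) (sym (+-identityʳ r))

≤1⇒zero : ∀ x y → x + y ≤ 1 → x ≡ 0 ⊎ y ≡ 0
≤1⇒zero zero    y       _ = inj₁ refl
≤1⇒zero (suc x) zero    _ = inj₂ refl
≤1⇒zero (suc x) (suc y) (s≤s le) with () ← ≤-trans (≤-reflexive (sym (+-suc x y))) le

positive⊎zero : ∀ x y → (1 ≤ x × 1 ≤ y) ⊎ (x ≡ 0 ⊎ y ≡ 0)
positive⊎zero zero    y       = inj₂ (inj₁ refl)
positive⊎zero (suc x) zero    = inj₂ (inj₂ refl)
positive⊎zero (suc x) (suc y) = inj₁ (s≤s z≤n , s≤s z≤n)

module Heights (n : ℕ) where

  InStep : ℕ → Coord → Set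
  InStep k (i , j) = (∣ i - j ∣ % 2 ≡ k % 2) × (∣ i - j ∣ ≤ k) × (∣ i + j - suc n ∣ ≤ n ∸ suc k)

  inStep? : ∀ k g → Dec (InStep k g)
  inStep? k (i , j) = (_ ≟ _) ×-dec (_ ≤? _) ×-dec (_ ≤? _)

  -- (x , y , r , s) are the weights of X, Y, R, S; mutation takes them to
  -- (x - 1 , y - 1 , r + 1 , s + 1) and happens in step r + s.  Hence before step k
  -- a point with r + s < k has reached its final position and a point with
  -- r + s > k + 1 has not yet left its initial one.
  record Surface (k i j y : ℕ) : Set where
    constructor surface
    field
      {x r s} : ℕ
      i≡      : r + y ≡ i
      j≡      : s + y ≡ j
      total   : (x + y) + (r + s) ≡ suc n
      late    : k ≤ r + s ⊎ (x ≡ 0 ⊎ y ≡ 0)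
      early   : r + s ≤ suc k ⊎ (r ≡ 0 ⊎ s ≡ 0)

  module _ {k x y r s : ℕ} (k<n : k < n) (total : (x + y) + (r + s) ≡ suc n) where

    private
      diagonal : ∣ r + y - s + y ∣ ≡ ∣ r - s ∣
      diagonal = trans (cong₂ ∣_-_∣ (+-comm r y) (+-comm s y)) (∣m+n-m+o∣≡∣n-o∣ y r s)

      antidiagonal : ∣ (r + y) + (s + y) - suc n ∣ ≡ ∣ y - x ∣
      antidiagonal = trans (cong₂ ∣_-_∣ (regroup₁ r s y) (trans (sym total) (regroup₂ x y r s))) (∣m+n-m+o∣≡∣n-o∣ (y + (r + s)) y x)
        where
        regroup₁ : ∀ r s y → (r + y) + (s + y) ≡ (y + (r + s)) + y
        regroup₁ = solve-∀
        regroup₂ : ∀ x y r s → (x + y) + (r + s) ≡ (y + (r + s)) + x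
        regroup₂ = solve-∀

    -- In these weights |i-j| = |r-s| and |i+j-(n+1)| = |y-x|. If x or y is 0, the latter is x+y and
    -- the third condition forces r+s to be at least k+2; if r or s is 0, the second forces r+s to
    -- be at most k. Otherwise r+s is k or k+1, and the parity selects k.
    inStep⇒ : k ≤ r + s ⊎ (x ≡ 0 ⊎ y ≡ 0) → r + s ≤ suc k ⊎ (r ≡ 0 ⊎ s ≡ 0) →
      InStep k (r + y , s + y) → r + s ≡ k × 1 ≤ x × 1 ≤ y
    inStep⇒ late early (parity , near , far) = now , positive (positive⊎zero x y)
      where
      finished : x ≡ 0 ⊎ y ≡ 0 → suc (suc k) ≤ r + s
      finished none = +-cancelˡ-≤ (x + y) _ _ (begin
        (x + y) + suc (suc k)            ≡⟨ +-suc (x + y) (suc k) ⟩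
        suc ((x + y) + suc k)            ≡⟨ cong (λ d → suc (d + suc k)) (trans (+-comm x y) (sym (∣-∣-zero y x ([ inj₂ , inj₁ ]′ none)))) ⟩
        suc (∣ y - x ∣ + suc k)          ≡⟨ cong (λ d → suc (d + suc k)) antidiagonal ⟨
        suc (∣ (r + y) + (s + y) - suc n ∣ + suc k) ≤⟨ s≤s (+-monoˡ-≤ (suc k) far) ⟩
        suc (n ∸ suc k + suc k)          ≡⟨ cong suc (m∸n+n≡m k<n) ⟩
        suc n                            ≡⟨ total ⟨
        (x + y) + (r + s)                ∎)
        where open ≤-Reasoning
      started : r ≡ 0 ⊎ s ≡ 0 → r + s ≤ k
      started none = subst (_≤ k) (trans diagonal (∣-∣-zero r s none)) near
      lower : k ≤ r + s
      lower = [ id , (λ z → ≤-trans (≤-trans (n≤1+n k) (n≤1+n (suc k))) (finished z)) ]′ late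
      upper : r + s ≤ suc k
      upper = [ id , (λ z → m≤n⇒m≤1+n (started z)) ]′ early
      now : r + s ≡ k
      now with m≤n⇒m<n∨m≡n lower
      ... | inj₂ eq = sym eq
      ... | inj₁ lt = contradiction
        (trans (cong (_% 2) (≤-antisym lt upper)) (trans (sym (parity-∣-∣ r s)) (trans (cong (_% 2) (sym diagonal)) parity)))
        (parity-step k)
      positive : (1 ≤ x × 1 ≤ y) ⊎ (x ≡ 0 ⊎ y ≡ 0) → 1 ≤ x × 1 ≤ y
      positive (inj₁ p) = p
      positive (inj₂ z) = contradiction (≤-trans (finished z) (≤-reflexive now)) (λ le → <-irrefl refl (≤-trans (n≤1+n (suc k)) le))

    -- |r-s| has the parity of r+s, and for positive x and y the difference |y-x| is at most
    -- (x-1)+(y-1) = n-1-k.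
    inStep⇐ : r + s ≡ k → 1 ≤ x → 1 ≤ y → InStep k (r + y , s + y)
    inStep⇐ refl (s≤s {n = x′} _) (s≤s {n = y′} _) =
      trans (cong (_% 2) diagonal) (parity-∣-∣ r s) ,
      subst (_≤ k) (sym diagonal) (≤-trans (∣m-n∣≤m⊔n r s) (m⊔n≤m+n r s)) ,
      subst (_≤ n ∸ suc k) (sym antidiagonal) (begin
        ∣ y′ - x′ ∣                      ≤⟨ ≤-trans (∣m-n∣≤m⊔n y′ x′) (m⊔n≤m+n y′ x′) ⟩
        y′ + x′                          ≡⟨ m+n∸n≡m (y′ + x′) (suc k) ⟨
        (y′ + x′) + suc k ∸ suc k        ≡⟨ cong (_∸ suc k) (suc-injective (trans (regroup x′ y′ k) total)) ⟩
        n ∸ suc k                        ∎)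
      where
      open ≤-Reasoning
      regroup : ∀ x y k → suc ((y + x) + suc k) ≡ (suc x + suc y) + k
      regroup = solve-∀

  -- 2i is at most (i+j)+|i-j|, hence at most (n+1)+(n-1-k)+k = 2n; likewise for j.
  inStep-bounded : ∀ {k i j} → k < n → InStep k (i , j) → i ≤ n × j ≤ n
  inStep-bounded {k} {i} {j} k<n (_ , near , far) =
    half i (≤-trans (+-monoʳ-≤ i (≤-trans (m≤n+∣m-n∣ i j) (+-monoʳ-≤ j near))) (≤-reflexive (sym (+-assoc i j k)))) ,
    half j (≤-trans (+-monoʳ-≤ j (≤-trans (m≤n+∣n-m∣ j i) (+-monoʳ-≤ i near))) (≤-reflexive (regroup i j k)))
    where
    open ≤-Reasoning
    regroup : ∀ i j k → j + (i + k) ≡ (i + j) + k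
    regroup = solve-∀
    bound : suc ((i + j) + k) ≤ suc (n + n)
    bound = begin
      suc ((i + j) + k)                                     ≤⟨ s≤s (+-monoˡ-≤ k (m≤n+∣m-n∣ (i + j) (suc n))) ⟩
      suc (suc n + ∣ i + j - suc n ∣ + k)                   ≤⟨ s≤s (+-monoˡ-≤ k (+-monoʳ-≤ (suc n) far)) ⟩
      suc (suc n + (n ∸ suc k) + k)                         ≡⟨ regroup′ n (n ∸ suc k) k ⟩
      suc (n + (n ∸ suc k + suc k))                         ≡⟨ cong (λ t → suc (n + t)) (m∸n+n≡m k<n) ⟩
      suc (n + n)                                           ∎
      where
      regroup′ : ∀ n d k → suc (suc n + d + k) ≡ suc (n + (d + suc k))
      regroup′ = solve-∀
    half : ∀ i′ → i′ + i′ ≤ (i + j) + k → i′ ≤ n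
    half i′ le with i′ ≤? n
    ... | yes p = p
    ... | no ¬p = contradiction (≤-trans (+-mono-≤ (≰⇒> ¬p) (≰⇒> ¬p)) (≤-trans le (≤-pred bound)))
      (λ le′ → <-irrefl refl (≤-trans (s≤s (m≤n+m (n + n) 1)) (≤-trans (≤-reflexive (cong suc (sym (+-suc n n)))) le′)))

  -- If two points lie over one coordinate, the lower one has r and s larger by the same positive
  -- amount, hence both positive, so its r+s is at most k+1. The upper one has positive x and y, so
  -- its r+s is at least k. But the two sums differ by at least 2.
  surface-unique : ∀ {k i j y y′} → Surface k i j y → Surface k i j y′ → y ≡ y′
  surface-unique {k} {y = y} {y′} S S′ = ≤-antisym (≮⇒≥ (higher S′ S)) (≮⇒≥ (higher S S′))
    where
    higher : ∀ {i j y y′} → Surface k i j y → Surface k i j y′ → ¬ y < y′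
    higher {y = y} {y′} (surface {x} {r} {s} refl refl t late early) (surface {x′} {r′} {s′} i≡ j≡ t′ late′ early′) y<y′
      with d , refl ← m≤n⇒∃[o]m+o≡n y<y′ = contradiction′ late′
      where
      r≡ : r ≡ r′ + suc d
      r≡ = +-cancelʳ-≡ y r (r′ + suc d) (trans (sym i≡) (regroup r′ y d))
        where
        regroup : ∀ r y d → r + (suc y + d) ≡ r + suc d + y
        regroup = solve-∀
      s≡ : s ≡ s′ + suc d
      s≡ = +-cancelʳ-≡ y s (s′ + suc d) (trans (sym j≡) (regroup s′ y d))
        where
        regroup : ∀ r y d → r + (suc y + d) ≡ r + suc d + y
        regroup = solve-∀
      x≡ : x′ ≡ x + suc d
      x≡ = +-cancelʳ-≡ ((suc y + d) + (r′ + s′)) x′ (x + suc d)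
        (trans (trans (sym (+-assoc x′ (suc y + d) (r′ + s′))) (trans t′ (sym t))) (trans (cong₂ (λ a b → x + y + (a + b)) r≡ s≡) (regroup x y r′ s′ d)))
        where
        regroup : ∀ x y r s d → x + y + (r + suc d + (s + suc d)) ≡ x + suc d + ((suc y + d) + (r + s))
        regroup = solve-∀
      below : r + s ≤ suc k
      below = [ id , (λ { (inj₁ z) → contradiction (trans (sym r≡) z) (m+1+n≢0 r′) ; (inj₂ z) → contradiction (trans (sym s≡) z) (m+1+n≢0 s′) }) ]′ early
      contradiction′ : k ≤ r′ + s′ ⊎ (x′ ≡ 0 ⊎ suc y + d ≡ 0) → ⊥
      contradiction′ (inj₁ k≤) = <-irrefl refl (begin
        suc (suc k)                   ≤⟨ s≤s (s≤s k≤) ⟩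
        suc (suc (r′ + s′))           ≤⟨ s≤s (s≤s (m≤m+n (r′ + s′) (d + d))) ⟩
        suc (suc (r′ + s′ + (d + d))) ≡⟨ regroup r′ s′ d ⟩
        r′ + suc d + (s′ + suc d)     ≡⟨ cong₂ _+_ r≡ s≡ ⟨
        r + s                         ≤⟨ below ⟩
        suc k                         ∎)
        where
        open ≤-Reasoning
        regroup : ∀ r s d → suc (suc (r + s + (d + d))) ≡ r + suc d + (s + suc d)
        regroup = solve-∀
      contradiction′ (inj₂ (inj₁ z)) = m+1+n≢0 x (trans (sym x≡) z)

  -- The initial height `i ⊓ j` describes the points with r = 0 or s = 0, the two triangles along
  -- the diagonal X Y.
  height : ℕ → Coord → ℕ
  height zero    (i , j) = i ⊓ j
  height (suc k) g       = if does (inStep? k g) then pred (height k g) else height k g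

  height-mutated : ∀ {k g} → InStep k g → height (suc k) g ≡ pred (height k g)
  height-mutated {k} {g} now = cong (if_then pred (height k g) else height k g) (dec-true (inStep? k g) now)

  height-kept : ∀ {k g} → ¬ InStep k g → height (suc k) g ≡ height k g
  height-kept {k} {g} ¬now = cong (if_then pred (height k g) else height k g) (dec-false (inStep? k g) ¬now)

  surface-initial : ∀ {i j} → i ≤ suc n → j ≤ suc n → Surface 0 i j (i ⊓ j)
  surface-initial {i} {j} i≤ j≤ with ≤-total i j
  ... | inj₁ i≤j = subst (Surface 0 i j) (sym (m≤n⇒m⊓n≡m i≤j))
    (surface {x = suc n ∸ j} {0} {j ∸ i} refl (m∸n+n≡m i≤j)
      (trans (+-assoc (suc n ∸ j) i (j ∸ i)) (trans (cong (_+_ (suc n ∸ j)) (m+[n∸m]≡n i≤j)) (m∸n+n≡m j≤)))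
      (inj₁ z≤n) (inj₂ (inj₁ refl)))
  ... | inj₂ j≤i = subst (Surface 0 i j) (sym (m≥n⇒m⊓n≡n j≤i))
    (surface {x = suc n ∸ i} {i ∸ j} {0} (m∸n+n≡m j≤i) refl
      (trans (cong (_+_ (suc n ∸ i + j)) (+-identityʳ (i ∸ j))) (trans (+-assoc (suc n ∸ i) j (i ∸ j)) (trans (cong (_+_ (suc n ∸ i)) (m+[n∸m]≡n j≤i)) (m∸n+n≡m i≤))))
      (inj₁ z≤n) (inj₂ (inj₂ refl)))

  surface-mutated : ∀ {k i j y} → k < n → Surface k i j y → InStep k (i , j) → ∃ λ y′ → y ≡ suc y′ × Surface (suc k) i j y′
  surface-mutated {k} {y = y} k<n (surface {x} {r} {s} refl refl total late early) now with inStep⇒ {x = x} {y} {r} {s} k<n total late early now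
  ... | refl , s≤s {n = x′} _ , s≤s {n = y′} _ = y′ , refl ,
    surface {x = x′} {suc r} {suc s} (sym (+-suc r y′)) (sym (+-suc s y′)) (trans (regroup x′ y′ r s) total)
      (inj₁ (s≤s (+-monoʳ-≤ r (n≤1+n s)))) (inj₁ (s≤s (≤-reflexive (+-suc r s))))
    where
    regroup : ∀ x y r s → x + y + (suc r + suc s) ≡ suc x + suc y + (r + s)
    regroup = solve-∀

  surface-kept : ∀ {k i j y} → k < n → Surface k i j y → ¬ InStep k (i , j) → Surface (suc k) i j y
  surface-kept {k} {y = y} k<n (surface {x} {r} {s} refl refl total late early) ¬now =
    surface refl refl total ([ finished , inj₂ ]′ late) ([ inj₁ ∘ m≤n⇒m≤1+n , inj₂ ]′ early)
    where
    finished : k ≤ r + s → suc k ≤ r + s ⊎ (x ≡ 0 ⊎ y ≡ 0)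
    finished k≤ with m≤n⇒m<n∨m≡n k≤ | positive⊎zero x y
    ... | inj₁ lt | _                = inj₁ lt
    ... | inj₂ eq | inj₁ (x≥1 , y≥1) = contradiction (inStep⇐ {x = x} {y} {r} {s} k<n total (sym eq) x≥1 y≥1) ¬now
    ... | inj₂ eq | inj₂ z           = inj₂ z

  surface-height : ∀ {k i j} → k ≤ n → i ≤ suc n → j ≤ suc n → Surface k i j (height k (i , j))
  surface-height {zero}          k≤n i≤ j≤ = surface-initial i≤ j≤
  surface-height {suc k} {i} {j} k<n i≤ j≤ = step (inStep? k (i , j))
    where
    step : Dec (InStep k (i , j)) → Surface (suc k) i j (height (suc k) (i , j))
    step (yes now) = let _ , eq , S = surface-mutated k<n (surface-height (<⇒≤ k<n) i≤ j≤) now in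
      subst (Surface (suc k) i j) (sym (trans (height-mutated now) (cong pred eq))) S
    step (no ¬now) = subst (Surface (suc k) i j) (sym (height-kept ¬now)) (surface-kept k<n (surface-height (<⇒≤ k<n) i≤ j≤) ¬now)

  -- After n steps a point with positive x and y would have r+s at least n, leaving at most 1 for
  -- x+y. So x or y is 0 and y equals the truncated difference y ∸ x.
  height-final : ∀ {i j} → i ≤ suc n → j ≤ suc n → height n (i , j) ≡ (i + j) ∸ suc n
  height-final {i} {j} i≤ j≤ with height n (i , j) | surface-height {n} ≤-refl i≤ j≤
  ... | y | surface {x} {r} {s} refl refl total late early = sym (trans (cong₂ _∸_ (regroup₁ r s y) (trans (sym total) (regroup₂ x y r s)))
      (trans ([m+n]∸[m+o]≡n∸o (y + (r + s)) y x) (final ([ low , id ]′ late))))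
    where
    regroup₁ : ∀ r s y → (r + y) + (s + y) ≡ (y + (r + s)) + y
    regroup₁ = solve-∀
    regroup₂ : ∀ x y r s → (x + y) + (r + s) ≡ (y + (r + s)) + x
    regroup₂ = solve-∀
    low : n ≤ r + s → x ≡ 0 ⊎ y ≡ 0
    low n≤ = ≤1⇒zero x y (+-cancelʳ-≤ n (x + y) 1 (≤-trans (+-monoʳ-≤ (x + y) n≤) (≤-reflexive total)))
    final : x ≡ 0 ⊎ y ≡ 0 → y ∸ x ≡ y
    final (inj₁ refl) = refl
    final (inj₂ refl) = 0∸n≡0 x

  -- The names are chosen so that the mutation goes from the weights (x+1, h+1, r, s) to (x, h, r+1,
  -- s+1).
  record Peak (k i j : ℕ) : Set where
    constructor peak
    field
      {x h r s} : ℕ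
      i≡      : i ≡ suc (r + h)
      j≡      : j ≡ suc (s + h)
      step≡   : r + s ≡ k
      total   : suc (suc (x + h + (r + s))) ≡ suc n
      height≡ : height k (i , j) ≡ suc h

  peak-inStep : ∀ {k i j} → k < n → InStep k (i , j) → Peak k i j
  peak-inStep {k} {i} {j} k<n now with bounds ← inStep-bounded k<n now
    with height k (i , j) in height≡ | surface-height {k} {i} {j} (<⇒≤ k<n) (m≤n⇒m≤1+n (proj₁ bounds)) (m≤n⇒m≤1+n (proj₂ bounds))
  ... | y | surface {x} {r} {s} refl refl total late early with inStep⇒ {x = x} {y} {r} {s} k<n total late early now
  ... | step≡ , s≤s {n = x′} _ , s≤s {n = h} _ = peak {x = x′} {h} {r} {s} (+-suc r h) (+-suc s h) step≡ (trans (regroup x′ h (r + s)) total) height≡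
    where
    regroup : ∀ x h t → suc (suc (x + h + t)) ≡ suc x + suc h + t
    regroup = solve-∀

  -- A point with r+s = k+1 satisfies both conditions of `Surface k`, so uniqueness gives the height
  -- there. It is not mutated in step k.
  beside-peak : ∀ {k i j} x y r s → k < n → r + y ≡ i → s + y ≡ j → (x + y) + (r + s) ≡ suc n → r + s ≡ suc k →
    height k (i , j) ≡ y × ¬ InStep k (i , j)
  beside-peak {k} x y r s k<n refl refl total next =
    surface-unique (surface-height (<⇒≤ k<n) i≤ j≤) here′ ,
    λ now → 1+n≢n (trans (sym next) (proj₁ (inStep⇒ {x = x} {y} {r} {s} k<n total (inj₁ late) (inj₁ early) now)))
    where
    late : k ≤ r + s
    late = subst (k ≤_) (sym next) (n≤1+n k)
    early : r + s ≤ suc k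
    early = ≤-reflexive next
    here′ : Surface k (r + y) (s + y) y
    here′ = surface {x = x} {r} {s} refl refl total (inj₁ late) (inj₁ early)
    i≤ : r + y ≤ suc n
    i≤ = ≤-trans (m≤m+n (r + y) (x + s)) (≤-reflexive (trans (regroup x y r s) total))
      where
      regroup : ∀ x y r s → r + y + (x + s) ≡ x + y + (r + s)
      regroup = solve-∀
    j≤ : s + y ≤ suc n
    j≤ = ≤-trans (m≤m+n (s + y) (x + r)) (≤-reflexive (trans (regroup x y r s) total))
      where
      regroup : ∀ x y r s → s + y + (x + r) ≡ x + y + (r + s)
      regroup = solve-∀

-- All mutations of one step of a flip

module FlipSteps (n : ℕ) {K : ℕ} (κ : Fin K → Coord)
  (κ-injective : ∀ {u v} → proj₁ (κ u) ≤ suc n → proj₂ (κ u) ≤ suc n → κ u ≡ κ v → u ≡ v)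
  (κ-surjective : ∀ {i j} → i ≤ suc n → j ≤ suc n → SurfaceQuiver.Inner n i ⊎ SurfaceQuiver.Inner n j → ∃ λ v → κ v ≡ (i , j))
  (rest : Fin K → Fin K → ℤ) (rest-skew : Skew rest)
  (rest-zero : ∀ p → SurfaceQuiver.Interior n (κ p) → ∀ v → rest p v ≡ 0ℤ)
  (σ : Bool) (val : Fin K → ℕ → ℕ) (val-positive : ∀ v h → 1 ≤ val v h)
  (exchange : ∀ {p e w nn ss} x h r s → suc (suc (x + h + (r + s))) ≡ suc n →
    κ p ≡ (suc (r + h) , suc (s + h)) → κ e ≡ (suc (suc (r + h)) , suc (s + h)) → κ w ≡ (r + h , suc (s + h)) →
    κ nn ≡ (suc (r + h) , suc (suc (s + h))) → κ ss ≡ (suc (r + h) , s + h) →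
    val p (suc h) * val p h ≡ val e (suc h) * val w h + val nn (suc h) * val ss h)
  where

  open SurfaceQuiver n
  open FlipQuiver n κ κ-injective rest rest-skew σ val public
  open Heights n

  -- Within a step some peaks are already lowered and others are not, so y is a mixture of
  -- `height k` and `height (suc k)`. Only p and points outside the step have to carry `height k`,
  -- and this includes the four neighbours.
  mutate-peak : ∀ {k p y y′ s} → k < n → InStep k (κ p) →
    (∀ {g} → g ≡ κ p ⊎ ¬ InStep k g → y g ≡ height k g) →
    y′ (κ p) ≡ pred (y (κ p)) → (∀ {g} → g ≢ κ p → y′ g ≡ y g) →
    SeedAt y s → SeedAt y′ (mutate s p)
  mutate-peak {k} {p} {y} {y′} {seed} k<n now y≡ lowered elsewhere S = dispatch refl
    where
    dispatch : ∀ {i j} → κ p ≡ (i , j) → SeedAt y′ (mutate seed p)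
    dispatch {i} {j} κp with peak-inStep {i = i} {j} k<n (subst (InStep k) κp now) | inStep-bounded {i = i} {j} k<n (subst (InStep k) κp now)
    ... | peak {x} {h} {r} {s} refl refl step≡ total height≡ | i≤ , j≤ =
      SeedAt-mutate {i = r + h} {s + h} {h} {p} {e} {w} {nn} {ss} {y} {y′}
        κp interior κe κw κn κs (rest-zero p (subst Interior (sym κp) interior))
        at (beside east≡) (beside north≡) (beside west≡) (beside south≡)
        (trans (cong y′ (sym κp)) (trans lowered (cong pred (trans (cong y κp) at))))
        (λ g≢ → elsewhere (λ eq → g≢ (trans eq κp)))
        (val-positive p (suc h)) (exchange x h r s total κp κe κw κn κs) S
      where
      interior : Interior (suc (r + h) , suc (s + h))
      interior = (s≤s z≤n , i≤) , (s≤s z≤n , j≤)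
      i≤′ : suc (r + h) ≤ suc n
      i≤′ = m≤n⇒m≤1+n i≤
      j≤′ : suc (s + h) ≤ suc n
      j≤′ = m≤n⇒m≤1+n j≤
      -- A neighbour of an interior point shares one coordinate with it, so it is never a corner of
      -- the square, where no quiver vertex lies.
      vertexE : ∃ λ v → κ v ≡ (suc (suc (r + h)) , suc (s + h))
      vertexE = κ-surjective (s≤s i≤) j≤′ (inj₂ (proj₂ interior))
      vertexW : ∃ λ v → κ v ≡ (r + h , suc (s + h))
      vertexW = κ-surjective (≤-trans (n≤1+n _) i≤′) j≤′ (inj₂ (proj₂ interior))
      vertexN : ∃ λ v → κ v ≡ (suc (r + h) , suc (suc (s + h)))
      vertexN = κ-surjective i≤′ (s≤s j≤) (inj₁ (proj₁ interior))
      vertexS : ∃ λ v → κ v ≡ (suc (r + h) , s + h)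
      vertexS = κ-surjective i≤′ (≤-trans (n≤1+n _) j≤′) (inj₁ (proj₁ interior))
      e w nn ss : Fin K
      e = proj₁ vertexE
      w = proj₁ vertexW
      nn = proj₁ vertexN
      ss = proj₁ vertexS
      κe : κ e ≡ (suc (suc (r + h)) , suc (s + h))
      κe = proj₂ vertexE
      κw : κ w ≡ (r + h , suc (s + h))
      κw = proj₂ vertexW
      κn : κ nn ≡ (suc (r + h) , suc (suc (s + h)))
      κn = proj₂ vertexN
      κs : κ ss ≡ (suc (r + h) , s + h)
      κs = proj₂ vertexS
      at : y (suc (r + h) , suc (s + h)) ≡ suc h
      at = trans (y≡ (inj₁ (sym κp))) height≡
      beside : ∀ {g z} → height k g ≡ z × ¬ InStep k g → y g ≡ z
      beside (eq , later) = trans (y≡ (inj₂ later)) eq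
      east≡ : height k (suc (suc (r + h)) , suc (s + h)) ≡ suc h × ¬ InStep k (suc (suc (r + h)) , suc (s + h))
      east≡ = beside-peak x (suc h) (suc r) s k<n (cong suc (+-suc r h)) (+-suc s h) (trans (regroup x h r s) total) (cong suc step≡)
        where
        regroup : ∀ x h r s → x + suc h + (suc r + s) ≡ suc (suc (x + h + (r + s)))
        regroup = solve-∀
      north≡ : height k (suc (r + h) , suc (suc (s + h))) ≡ suc h × ¬ InStep k (suc (r + h) , suc (suc (s + h)))
      north≡ = beside-peak x (suc h) r (suc s) k<n (+-suc r h) (cong suc (+-suc s h)) (trans (regroup x h r s) total) (trans (+-suc r s) (cong suc step≡))
        where
        regroup : ∀ x h r s → x + suc h + (r + suc s) ≡ suc (suc (x + h + (r + s)))
        regroup = solve-∀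
      west≡ : height k (r + h , suc (s + h)) ≡ h × ¬ InStep k (r + h , suc (s + h))
      west≡ = beside-peak (suc x) h r (suc s) k<n refl refl (trans (regroup x h r s) total) (trans (+-suc r s) (cong suc step≡))
        where
        regroup : ∀ x h r s → suc x + h + (r + suc s) ≡ suc (suc (x + h + (r + s)))
        regroup = solve-∀
      south≡ : height k (suc (r + h) , s + h) ≡ h × ¬ InStep k (suc (r + h) , s + h)
      south≡ = beside-peak (suc x) h (suc r) s k<n refl refl (trans (regroup x h r s) total) (cong suc step≡)
        where
        regroup : ∀ x h r s → suc x + h + (suc r + s) ≡ suc (suc (x + h + (r + s)))
        regroup = solve-∀

  private
    AllInStep : ℕ → List (Fin K) → Set
    AllInStep k = All (λ v → InStep k (κ v))

    _∈κ_ : Coord → List (Fin K) → Set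
    g ∈κ vs = Any (λ v → g ≡ κ v) vs

    -- The heights when the vertices vs are still to be mutated in step k.
    pending : ℕ → List (Fin K) → Coord → ℕ
    pending k vs g = if does (Any.any? (λ v → g ≟ᶜ κ v) vs) then height k g else height (suc k) g

    pending-∈ : ∀ {k vs g} → g ∈κ vs → pending k vs g ≡ height k g
    pending-∈ {k} {vs} {g} g∈ = cong (if_then height k g else height (suc k) g) (dec-true (Any.any? (λ v → g ≟ᶜ κ v) vs) g∈)

    pending-∉ : ∀ {k vs g} → ¬ g ∈κ vs → pending k vs g ≡ height (suc k) g
    pending-∉ {k} {vs} {g} g∉ = cong (if_then height k g else height (suc k) g) (dec-false (Any.any? (λ v → g ≟ᶜ κ v) vs) g∉)

    mutate-pending : ∀ {k vs s} → k < n → Unique vs → AllInStep k vs →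
      SeedAt (pending k vs) s → SeedAt (height (suc k)) (foldl mutate s vs)
    mutate-pending {vs = []}     k<n u now S = S
    mutate-pending {k} {v ∷ vs} k<n (v# ∷ u) (now ∷ nows) S =
      mutate-pending k<n u nows (mutate-peak {p = v} k<n now due (trans (pending-∉ {vs = vs} fresh) (trans (height-mutated now) (cong pred (sym (pending-∈ {k} {v ∷ vs} (here refl)))))) elsewhere S)
      where
      fresh : ¬ κ v ∈κ vs
      fresh v∈ with w , w∈ , eq ← find v∈ =
        All.lookup v# w∈ (κ-injective (m≤n⇒m≤1+n (proj₁ (inStep-bounded {i = proj₁ (κ v)} {proj₂ (κ v)} k<n now))) (m≤n⇒m≤1+n (proj₂ (inStep-bounded {i = proj₁ (κ v)} {proj₂ (κ v)} k<n now))) eq)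
      due : ∀ {g} → g ≡ κ v ⊎ ¬ InStep k g → pending k (v ∷ vs) g ≡ height k g
      due (inj₁ eq) = pending-∈ {vs = v ∷ vs} (here eq)
      due {g} (inj₂ later) = by (Any.any? (λ v → g ≟ᶜ κ v) (v ∷ vs))
        where
        by : Dec (g ∈κ (v ∷ vs)) → pending k (v ∷ vs) g ≡ height k g
        by (yes g∈) = pending-∈ {vs = v ∷ vs} g∈
        by (no g∉)  = trans (pending-∉ {vs = v ∷ vs} g∉) (height-kept later)
      elsewhere : ∀ {g} → g ≢ κ v → pending k vs g ≡ pending k (v ∷ vs) g
      elsewhere {g} g≢ = by (Any.any? (λ v → g ≟ᶜ κ v) vs)
        where
        by : Dec (g ∈κ vs) → pending k vs g ≡ pending k (v ∷ vs) g
        by (yes g∈) = trans (pending-∈ {vs = vs} g∈) (sym (pending-∈ {vs = v ∷ vs} (there g∈)))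
        by (no g∉)  = trans (pending-∉ {vs = vs} g∉) (sym (pending-∉ {vs = v ∷ vs} λ { (here eq) → g≢ eq ; (there g∈) → g∉ g∈ }))

  SeedAt-step : ∀ {k s vs} → k < n → Unique vs → (∀ {v} → v ∈ vs → InStep k (κ v)) → (∀ {v} → InStep k (κ v) → v ∈ vs) →
    SeedAt (height k) s → SeedAt (height (suc k)) (foldl mutate s vs)
  SeedAt-step {k} {s} {vs} k<n u sound complete S =
    mutate-pending k<n u (All.tabulate sound) (SeedAt-cong (λ g → sym (by g (Any.any? (λ v → g ≟ᶜ κ v) vs))) S)
    where
    -- Every coordinate in the step belongs to a vertex, which `complete` puts into `vs`; so at the
    -- beginning nothing in the step has been lowered.
    vertex : ∀ {i j} → InStep k (i , j) → ∃ λ v → κ v ≡ (i , j)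
    vertex {i} {j} now with peak-inStep {i = i} {j} k<n now | inStep-bounded {i = i} {j} k<n now
    ... | peak refl refl _ _ _ | i≤ , j≤ = κ-surjective (m≤n⇒m≤1+n i≤) (m≤n⇒m≤1+n j≤) (inj₁ (s≤s z≤n , i≤))
    by : ∀ g → Dec (g ∈κ vs) → pending k vs g ≡ height k g
    by g (yes g∈) = pending-∈ {vs = vs} g∈
    by g (no g∉)  = trans (pending-∉ {vs = vs} g∉) (height-kept λ now → let v , eq = vertex now in
      g∉ (lose (complete (subst (InStep k) (sym eq) now)) (sym eq)))

-- The quiver of a triangle in barycentric coordinates

-- One of the three arrows of a 3-cycle, parallel to the side X Z; the other two arise by rotating
-- the coordinates. A positive Y-weight keeps it off that side.
Shift : (px py pz qx qy qz : ℕ) → Set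
Shift px py pz qx qy qz = (1 ≤ py) × (qx ≡ suc px) × (qy ≡ py) × (pz ≡ suc qz)

m≡m+n⇒n≡0 : ∀ {N m k} → m ≡ N → m + k ≡ N → k ≡ 0
m≡m+n⇒n≡0 {m = m} {k} refl eq = +-cancelˡ-≡ m k 0 (trans eq (sym (+-identityʳ m)))

module TriangleArrows (n : ℕ) where

  open SurfaceQuiver n

  Arrow : (px py pz qx qy qz : ℕ) → Set
  Arrow px py pz qx qy qz = (px + py + pz ≡ suc n) × (qx + qy + qz ≡ suc n) × Shift px py pz qx qy qz

  arrow? : ∀ px py pz qx qy qz → Dec (Arrow px py pz qx qy qz)
  arrow? px py pz qx qy qz = (_ ≟ _) ×-dec (_ ≟ _) ×-dec (_ ≤? _) ×-dec (_ ≟ _) ×-dec (_ ≟ _) ×-dec (_ ≟ _)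

  record At (g : Coord) (x y r s : ℕ) : Set where
    constructor located
    field
      i≡    : r + y ≡ proj₁ g
      j≡    : s + y ≡ proj₂ g
      total : (x + y) + (r + s) ≡ suc n

  transpose : ∀ {i j x y r s} → At (i , j) x y r s → At (j , i) x y s r
  transpose {x = x} {y} {r} {s} (located i≡ j≡ total) = located j≡ i≡ (trans (cong (_+_ (x + y)) (+-comm s r)) total)

  -- One step east moves a unit of weight either from X to R, at constant height, or from S to Y,
  -- with the height rising by 1.
  data EastStep (x y r s x′ y′ r′ s′ : ℕ) : Set where
    flat  : x ≡ suc x′ → y′ ≡ y → r′ ≡ suc r → s′ ≡ s → EastStep x y r s x′ y′ r′ s′
    steep : x′ ≡ x → y′ ≡ suc y → r′ ≡ r → s ≡ suc s′ → EastStep x y r s x′ y′ r′ s′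

  eastStep : ∀ {u v x y r s x′ y′ r′ s′} → At u x y r s → At v x′ y′ r′ s′ → east u ≡ v →
    y′ ≡ y ⊎ y′ ≡ suc y → EastStep x y r s x′ y′ r′ s′
  eastStep {x = x} {y} {r} {s} {x′} {r′ = r′} {s′} (located refl refl t) (located i≡ j≡ t′) refl (inj₁ refl) = flat x≡ refl r≡ s≡
    where
    r≡ : r′ ≡ suc r
    r≡ = +-cancelʳ-≡ y r′ (suc r) i≡
    s≡ : s′ ≡ s
    s≡ = +-cancelʳ-≡ y s′ s j≡
    x≡ : x ≡ suc x′
    x≡ = +-cancelʳ-≡ (y + (r + s)) x (suc x′) (trans (trans (sym (+-assoc x y (r + s))) (trans t (sym t′))) (trans (cong₂ (λ a b → x′ + y + (a + b)) r≡ s≡) (regroup x′ y r s)))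
      where
      regroup : ∀ x y r s → x + y + (suc r + s) ≡ suc x + (y + (r + s))
      regroup = solve-∀
  eastStep {x = x} {y} {r} {s} {x′} {r′ = r′} {s′} (located refl refl t) (located i≡ j≡ t′) refl (inj₂ refl) = steep x≡ refl r≡ s≡
    where
    r≡ : r′ ≡ r
    r≡ = +-cancelʳ-≡ (suc y) r′ r (trans i≡ (sym (+-suc r y)))
    s≡ : s ≡ suc s′
    s≡ = +-cancelʳ-≡ y s (suc s′) (trans (sym j≡) (+-suc s′ y))
    x≡ : x′ ≡ x
    x≡ = +-cancelʳ-≡ (suc y + (r + s′)) x′ x (trans (trans (cong (λ a → x′ + (suc y + (a + s′))) (sym r≡)) (trans (sym (+-assoc x′ (suc y) (r′ + s′))) t′)) (trans (sym t) (trans (cong (λ b → x + y + (r + b)) s≡) (regroup x y r s′))))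
      where
      regroup : ∀ x y r s → x + y + (r + suc s) ≡ x + (suc y + (r + s))
      regroup = solve-∀

  weigh-flat : ∀ c {y y′} → y′ ≡ y → c ℤ.* (1ℤ ℤ.- + 2 ℤ.* (+ y′ ℤ.- + y)) ≡ c
  weigh-flat c {y} refl = flat-value c (+ y)
    where
    flat-value : ∀ c y → c ℤ.* (1ℤ ℤ.- + 2 ℤ.* (y ℤ.- y)) ≡ c
    flat-value = ℤ-Solver.solve-∀

  weigh-steep : ∀ c {y y′} → y′ ≡ suc y → c ℤ.* (1ℤ ℤ.- + 2 ℤ.* (+ y′ ℤ.- + y)) ≡ ℤ.- c
  weigh-steep c {y} refl = steep-value c (+ y)
    where
    steep-value : ∀ c y → c ℤ.* (1ℤ ℤ.- + 2 ℤ.* ((1ℤ ℤ.+ y) ℤ.- y)) ≡ ℤ.- c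
    steep-value = ℤ-Solver.solve-∀

  -- Along a horizontal step of the surface one of two arrows is present: flat
  -- steps carry A, steep steps carry the reversed arrow B.
  eastEdge : ∀ {A B : Set} (a : Dec A) (b : Dec B) {u v x y r s x′ y′ r′ s′} → At u x y r s → At v x′ y′ r′ s′ →
    (A → east u ≡ v) → (B → east u ≡ v) →
    (east u ≡ v → y′ ≡ y ⊎ y′ ≡ suc y) →
    (A → y′ ≡ y) → (B → y′ ≡ suc y) →
    (x ≡ suc x′ → y′ ≡ y → r′ ≡ suc r → s′ ≡ s → (A → Inner (proj₂ u)) × (Inner (proj₂ u) → A)) →
    (x′ ≡ x → y′ ≡ suc y → r′ ≡ r → s ≡ suc s′ → (B → Inner (proj₂ u)) × (Inner (proj₂ u) → B)) →
    ⟦ a ⟧ ℤ.- ⟦ b ⟧ ≡ eastAt u v ℤ.* (⟦ inner? (proj₂ u) ⟧ ℤ.* (1ℤ ℤ.- + 2 ℤ.* (+ y′ ℤ.- + y)))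
  eastEdge a b {u} {v} U V A⇒ B⇒ lip A⇒flat B⇒steep onFlat onSteep with east u ≟ᶜ v
  ... | no ¬e = cong₂ ℤ._-_ (⟦⟧-false a (¬e ∘ A⇒)) (⟦⟧-false b (¬e ∘ B⇒))
  ... | yes e with eastStep U V e (lip e)
  ... | flat x≡ y≡ r≡ s≡ = trans
    (cong₂ ℤ._-_ (⟦⟧-cong a (inner? (proj₂ u)) (proj₁ (onFlat x≡ y≡ r≡ s≡)) (proj₂ (onFlat x≡ y≡ r≡ s≡))) (⟦⟧-false b (λ B → 1+n≢n (trans (sym (B⇒steep B)) y≡))))
    (trans (ℤ.+-identityʳ _) (sym (trans (ℤ.*-identityˡ _) (weigh-flat ⟦ inner? (proj₂ u) ⟧ y≡))))
  ... | steep x≡ y≡ r≡ s≡ = trans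
    (cong₂ ℤ._-_ (⟦⟧-false a (λ A → 1+n≢n (trans (sym y≡) (A⇒flat A)))) (⟦⟧-cong b (inner? (proj₂ u)) (proj₁ (onSteep x≡ y≡ r≡ s≡)) (proj₂ (onSteep x≡ y≡ r≡ s≡))))
    (trans (ℤ.+-identityˡ _) (sym (trans (ℤ.*-identityˡ _) (weigh-steep ⟦ inner? (proj₂ u) ⟧ y≡))))

  arrow-reverse : ∀ {a b c a′ b′ c′} → Arrow a b c a′ b′ c′ → Arrow c′ b′ a′ c b a
  arrow-reverse {a} {b} {c} {a′} {b′} {c′} (p∈ , q∈ , 1≤b , a≡ , b≡ , c≡) =
    trans (backwards c′ b′ a′) q∈ , trans (backwards c b a) p∈ , ≤-trans 1≤b (≤-reflexive (sym b≡)) , c≡ , sym b≡ , a≡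
    where
    backwards : ∀ a b c → a + b + c ≡ c + b + a
    backwards = solve-∀

  ⟦reverse⟧ : ∀ a b c a′ b′ c′ → ⟦ arrow? a b c a′ b′ c′ ⟧ ≡ ⟦ arrow? c′ b′ a′ c b a ⟧
  ⟦reverse⟧ a b c a′ b′ c′ = ⟦⟧-cong (arrow? a b c a′ b′ c′) (arrow? c′ b′ a′ c b a) arrow-reverse arrow-reverse

  triangle : (px py pz qx qy qz : ℕ) → ℤ
  triangle px py pz qx qy qz = ⟦ arrow? px py pz qx qy qz ⟧ ℤ.+ ⟦ arrow? pz px py qz qx qy ⟧ ℤ.+ ⟦ arrow? py pz px qy qz qx ⟧

  triangleForm : (px py pz qx qy qz : ℕ) → ℤ
  triangleForm px py pz qx qy qz = triangle px py pz qx qy qz ℤ.- triangle qx qy qz px py pz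

  module _ {g : Coord} {x y r s : ℕ} (U : At g x y r s) where
    open At U

    private
      complement : (x + r) + proj₂ g ≡ suc n
      complement = trans (cong (_+_ (x + r)) (sym j≡)) (trans (regroup x y r s) total)
        where
        regroup : ∀ x y r s → x + r + (s + y) ≡ x + y + (r + s)
        regroup = solve-∀

    inner⇒ : Inner (proj₂ g) → (1 ≤ s + y) × (1 ≤ x + r)
    inner⇒ (j≥1 , j≤n) = ≤-trans j≥1 (≤-reflexive (sym j≡)) ,
      +-cancelʳ-≤ (proj₂ g) 1 (x + r) (≤-trans (s≤s j≤n) (≤-reflexive (sym complement)))

    inner⇐ : 1 ≤ s + y → 1 ≤ x + r → Inner (proj₂ g)
    inner⇐ sy xr = ≤-trans sy (≤-reflexive j≡) , ≤-pred (≤-trans (+-monoˡ-≤ (proj₂ g) xr) (≤-reflexive complement))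

    s-zero : ∀ {k} → k ≡ suc n → k ≡ x + y + r → s ≡ 0
    s-zero eq refl = m≡m+n⇒n≡0 eq (trans (+-assoc (x + y) r s) total)

    r-zero : ∀ {k} → k ≡ suc n → k ≡ x + y + s → r ≡ 0
    r-zero eq refl = m≡m+n⇒n≡0 eq (trans (regroup x y r s) total)
      where
      regroup : ∀ x y r s → x + y + s + r ≡ x + y + (r + s)
      regroup = solve-∀

    y-zero : ∀ {k} → k ≡ suc n → k ≡ x + r + s → y ≡ 0
    y-zero eq refl = m≡m+n⇒n≡0 eq (trans (regroup x y r s) total)
      where
      regroup : ∀ x y r s → x + r + s + y ≡ x + y + (r + s)
      regroup = solve-∀

    without-s : s ≡ 0 → r + y + x ≡ suc n
    without-s refl = trans (regroup x y r) total
      where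
      regroup : ∀ x y r → r + y + x ≡ x + y + (r + 0)
      regroup = solve-∀

    without-r : r ≡ 0 → s + x + y ≡ suc n
    without-r refl = trans (regroup x y s) total
      where
      regroup : ∀ x y s → s + x + y ≡ x + y + s
      regroup = solve-∀

    without-y : y ≡ 0 → r + s + x ≡ suc n
    without-y refl = trans (regroup x r s) total
      where
      regroup : ∀ x r s → r + s + x ≡ x + 0 + (r + s)
      regroup = solve-∀

    without-x : x ≡ 0 → s + r + y ≡ suc n
    without-x refl = trans (regroup y r s) total
      where
      regroup : ∀ y r s → s + r + y ≡ y + (r + s)
      regroup = solve-∀

    r⊎s-zero : y ≡ proj₁ g ⊓ proj₂ g → r ≡ 0 ⊎ s ≡ 0
    r⊎s-zero y≡ with positive⊎zero r s
    ... | inj₂ z = z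
    ... | inj₁ (s≤s _ , s≤s _) = contradiction
      (≤-trans (⊓-glb (≤-trans (s≤s (m≤n+m y _)) (≤-reflexive i≡)) (≤-trans (s≤s (m≤n+m y _)) (≤-reflexive j≡))) (≤-reflexive (sym y≡))) (<-irrefl refl)

    i+j≡ : proj₁ g + proj₂ g ≡ (y + (r + s)) + y
    i+j≡ = trans (cong₂ _+_ (sym i≡) (sym j≡)) (regroup r s y)
      where
      regroup : ∀ r s y → r + y + (s + y) ≡ y + (r + s) + y
      regroup = solve-∀

    N≡ : suc n ≡ (y + (r + s)) + x
    N≡ = trans (sym total) (regroup x y r s)
      where
      regroup : ∀ x y r s → x + y + (r + s) ≡ y + (r + s) + x
      regroup = solve-∀

    x⊎y-zero : y ≡ (proj₁ g + proj₂ g) ∸ suc n → x ≡ 0 ⊎ y ≡ 0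
    x⊎y-zero y≡ with positive⊎zero x y
    ... | inj₂ z = z
    ... | inj₁ (s≤s {n = x₀} _ , s≤s {n = y₀} _) = contradiction
      (≤-trans (≤-reflexive (trans y≡ (trans (cong₂ _∸_ i+j≡ N≡) ([m+n]∸[m+o]≡n∸o (y + (r + s)) y x)))) (m∸n≤m y₀ x₀)) (<-irrefl refl)

  suc-⊓ : ∀ i j → suc i ⊓ j ≡ i ⊓ j ⊎ suc i ⊓ j ≡ suc (i ⊓ j)
  suc-⊓ i       zero    = inj₁ (sym (⊓-zeroʳ i))
  suc-⊓ zero    (suc j) = inj₂ refl
  suc-⊓ (suc i) (suc j) with suc-⊓ i j
  ... | inj₁ eq = inj₁ (cong suc eq)
  ... | inj₂ eq = inj₂ (cong suc eq)

  suc-∸ : ∀ t N → suc t ∸ N ≡ t ∸ N ⊎ suc t ∸ N ≡ suc (t ∸ N)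
  suc-∸ t       zero    = inj₂ refl
  suc-∸ zero    (suc N) = inj₁ (0∸n≡0 N)
  suc-∸ (suc t) (suc N) = suc-∸ t N

  initialHeight finalHeight : Coord → ℤ
  initialHeight (i , j) = + (i ⊓ j)
  finalHeight   (i , j) = + (i + j ∸ suc n)

  horizontalTerm verticalTerm : Coord → Coord → ℕ → ℕ → ℤ
  horizontalTerm u v y y′ = eastAt u v ℤ.* (⟦ inner? (proj₂ u) ⟧ ℤ.* (1ℤ ℤ.- + 2 ℤ.* (+ y′ ℤ.- + y)))
  verticalTerm   u v y y′ = northAt u v ℤ.* (⟦ inner? (proj₁ u) ⟧ ℤ.* (1ℤ ℤ.- + 2 ℤ.* (+ y′ ℤ.- + y)))

  transposeVertical : ∀ {i j i′ j′} y y′ → horizontalTerm (j , i) (j′ , i′) y y′ ≡ verticalTerm (i , j) (i′ , j′) y y′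
  transposeVertical {i} {j} {i′} {j′} y y′ = cong (ℤ._* (⟦ inner? i ⟧ ℤ.* (1ℤ ℤ.- + 2 ℤ.* (+ y′ ℤ.- + y))))
    (⟦⟧-cong (east (j , i) ≟ᶜ (j′ , i′)) (north (i , j) ≟ᶜ (i′ , j′)) (λ { refl → refl }) (λ { refl → refl }))

  -- On the initial surface a level step east has s = 0 and lies in XRY, a rising one has r = 0 and
  -- lies in XYS. In both it is parallel to a side of the triangle, and `inner?` tests whether it
  -- lies on that side.
  initialEast : ∀ {u v x y r s x′ y′ r′ s′} → At u x y r s → At v x′ y′ r′ s′ →
    y ≡ proj₁ u ⊓ proj₂ u → y′ ≡ proj₁ v ⊓ proj₂ v →
    ⟦ arrow? r y x r′ y′ x′ ⟧ ℤ.- ⟦ arrow? s′ x′ y′ s x y ⟧ ≡ horizontalTerm u v y y′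
  initialEast {u} {v} {x} {y} {r} {s} {x′} {y′} {r′} {s′} U V y≡ y′≡ =
    eastEdge (arrow? r y x r′ y′ x′) (arrow? s′ x′ y′ s x y) U V A⇒ B⇒
      (λ { refl → [ (λ eq → inj₁ (trans y′≡ (trans eq (sym y≡)))) , (λ eq → inj₂ (trans y′≡ (trans eq (cong suc (sym y≡))))) ]′ (suc-⊓ (proj₁ u) (proj₂ u)) })
      (λ { (_ , _ , _ , _ , y≡ , _) → y≡ }) (λ { (_ , _ , _ , _ , _ , y≡) → y≡ }) onFlat onSteep
    where
    A⇒ : Arrow r y x r′ y′ x′ → east u ≡ v
    A⇒ (p∈ , q∈ , _ , r≡ , yy , _) = cong₂ _,_
      (trans (cong suc (sym (At.i≡ U))) (trans (cong₂ _+_ (sym r≡) (sym yy)) (At.i≡ V)))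
      (trans (sym (At.j≡ U)) (trans (cong₂ _+_ (trans (s-zero U p∈ (perm r y x)) (sym (s-zero V q∈ (perm r′ y′ x′)))) (sym yy)) (At.j≡ V)))
      where
      perm : ∀ r y x → r + y + x ≡ x + y + r
      perm = solve-∀
    B⇒ : Arrow s′ x′ y′ s x y → east u ≡ v
    B⇒ (q∈ , p∈ , _ , s≡ , _ , yy) = cong₂ _,_
      (trans (cong suc (trans (sym (At.i≡ U)) (cong (_+ y) (r-zero U p∈ (perm s x y))))) (trans (sym yy) (trans (cong (_+ y′) (sym (r-zero V q∈ (perm s′ x′ y′)))) (At.i≡ V))))
      (trans (sym (At.j≡ U)) (trans (cong (_+ y) s≡) (trans (sym (+-suc s′ y)) (trans (cong (_+_ s′) (sym yy)) (At.j≡ V)))))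
      where
      perm : ∀ s x y → s + x + y ≡ x + y + s
      perm = solve-∀
    onFlat : x ≡ suc x′ → y′ ≡ y → r′ ≡ suc r → s′ ≡ s → (Arrow r y x r′ y′ x′ → Inner (proj₂ u)) × (Inner (proj₂ u) → Arrow r y x r′ y′ x′)
    onFlat x≡ yy r≡ s≡ =
      (λ { (_ , _ , y≥1 , _) → inner⇐ U (≤-trans y≥1 (m≤n+m y s)) (≤-trans (s≤s z≤n) (≤-trans (≤-reflexive (sym x≡)) (m≤m+n x r))) }) ,
      (λ inner → without-s U s0 , without-s V s′0 , subst (λ z → 1 ≤ z + y) s0 (proj₁ (inner⇒ U inner)) , r≡ , yy , x≡)
      where
      s′0 : s′ ≡ 0
      s′0 = [ (λ z → contradiction (trans (sym r≡) z) (λ ())) , id ]′ (r⊎s-zero V y′≡)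
      s0 : s ≡ 0
      s0 = trans (sym s≡) s′0
    onSteep : x′ ≡ x → y′ ≡ suc y → r′ ≡ r → s ≡ suc s′ → (Arrow s′ x′ y′ s x y → Inner (proj₂ u)) × (Inner (proj₂ u) → Arrow s′ x′ y′ s x y)
    onSteep x≡ yy r≡ s≡ =
      (λ { (_ , _ , x≥1 , _) → inner⇐ U (≤-trans (s≤s z≤n) (≤-trans (≤-reflexive (sym s≡)) (m≤m+n s y))) (≤-trans (≤-trans x≥1 (≤-reflexive x≡)) (m≤m+n x r)) }) ,
      (λ inner → without-r V (trans r≡ r0) , without-r U r0 ,
        ≤-trans (subst (1 ≤_) (trans (cong (_+_ x) r0) (+-identityʳ x)) (proj₂ (inner⇒ U inner))) (≤-reflexive (sym x≡)) , s≡ , sym x≡ , yy)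
      where
      r0 : r ≡ 0
      r0 = [ id , (λ z → contradiction (trans (sym s≡) z) (λ ())) ]′ (r⊎s-zero U y≡)

  -- Now level steps have y = 0 and lie in XRS, while rising steps have x = 0 and lie in RYS.
  finalEast : ∀ {u v x y r s x′ y′ r′ s′} → At u x y r s → At v x′ y′ r′ s′ →
    y ≡ proj₁ u + proj₂ u ∸ suc n → y′ ≡ proj₁ v + proj₂ v ∸ suc n →
    ⟦ arrow? r s x r′ s′ x′ ⟧ ℤ.- ⟦ arrow? s′ r′ y′ s r y ⟧ ≡ horizontalTerm u v y y′
  finalEast {u} {v} {x} {y} {r} {s} {x′} {y′} {r′} {s′} U V y≡ y′≡ =
    eastEdge (arrow? r s x r′ s′ x′) (arrow? s′ r′ y′ s r y) U V A⇒ B⇒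
      (λ { refl → [ (λ eq → inj₁ (trans y′≡ (trans eq (sym y≡)))) , (λ eq → inj₂ (trans y′≡ (trans eq (cong suc (sym y≡))))) ]′ (suc-∸ (proj₁ u + proj₂ u) (suc n)) })
      (λ { (p∈ , q∈ , _) → trans (y-zero V q∈ (perm r′ s′ x′)) (sym (y-zero U p∈ (perm r s x))) }) (λ { (_ , _ , _ , _ , _ , y≡) → y≡ }) onFlat onSteep
    where
    perm : ∀ r s x → r + s + x ≡ x + r + s
    perm = solve-∀
    A⇒ : Arrow r s x r′ s′ x′ → east u ≡ v
    A⇒ (p∈ , q∈ , _ , r≡ , ss , _) = cong₂ _,_
      (trans (cong suc (sym (At.i≡ U))) (trans (cong₂ _+_ (sym r≡) yy) (At.i≡ V)))
      (trans (sym (At.j≡ U)) (trans (cong₂ _+_ (sym ss) yy) (At.j≡ V)))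
      where
      yy : y ≡ y′
      yy = trans (y-zero U p∈ (perm r s x)) (sym (y-zero V q∈ (perm r′ s′ x′)))
    B⇒ : Arrow s′ r′ y′ s r y → east u ≡ v
    B⇒ (_ , _ , _ , s≡ , r≡ , yy) = cong₂ _,_
      (trans (cong suc (sym (At.i≡ U))) (trans (sym (+-suc r y)) (trans (cong₂ _+_ r≡ (sym yy)) (At.i≡ V))))
      (trans (sym (At.j≡ U)) (trans (cong (_+ y) s≡) (trans (sym (+-suc s′ y)) (trans (cong (_+_ s′) (sym yy)) (At.j≡ V)))))
    onFlat : x ≡ suc x′ → y′ ≡ y → r′ ≡ suc r → s′ ≡ s → (Arrow r s x r′ s′ x′ → Inner (proj₂ u)) × (Inner (proj₂ u) → Arrow r s x r′ s′ x′)
    onFlat x≡ yy r≡ s≡ =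
      (λ { (_ , _ , s≥1 , _) → inner⇐ U (≤-trans s≥1 (m≤m+n s y)) (≤-trans (s≤s z≤n) (≤-trans (≤-reflexive (sym x≡)) (m≤m+n x r))) }) ,
      (λ inner → without-y U y0 , without-y V (trans yy y0) , subst (1 ≤_) (trans (cong (_+_ s) y0) (+-identityʳ s)) (proj₁ (inner⇒ U inner)) , r≡ , s≡ , x≡)
      where
      y0 : y ≡ 0
      y0 = [ (λ z → contradiction (trans (sym x≡) z) (λ ())) , id ]′ (x⊎y-zero U y≡)
    onSteep : x′ ≡ x → y′ ≡ suc y → r′ ≡ r → s ≡ suc s′ → (Arrow s′ r′ y′ s r y → Inner (proj₂ u)) × (Inner (proj₂ u) → Arrow s′ r′ y′ s r y)
    onSteep x≡ yy r≡ s≡ =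
      (λ { (_ , _ , r≥1 , _) → inner⇐ U (≤-trans (s≤s z≤n) (≤-trans (≤-reflexive (sym s≡)) (m≤m+n s y))) (≤-trans (≤-trans r≥1 (≤-reflexive r≡)) (m≤n+m r x)) }) ,
      (λ inner → without-x V x′0 , without-x U (trans (sym x≡) x′0) ,
        ≤-trans (subst (λ z → 1 ≤ z + r) (trans (sym x≡) x′0) (proj₂ (inner⇒ U inner))) (≤-reflexive (sym r≡)) , s≡ , sym r≡ , yy)
      where
      x′0 : x′ ≡ 0
      x′0 = [ id , (λ z → contradiction (trans (sym yy) z) (λ ())) ]′ (x⊎y-zero V y′≡)

  record NorthEast (x y r s x′ y′ r′ s′ : ℕ) : Set where
    constructor northEast
    field
      x≡ : x ≡ suc x′
      y≡ : y′ ≡ suc y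
      r≡ : r′ ≡ r
      s≡ : s′ ≡ s

  northEastStep : ∀ {u v x y r s x′ y′ r′ s′} → At u x y r s → At v x′ y′ r′ s′ → east (north u) ≡ v → y′ ≡ suc y → NorthEast x y r s x′ y′ r′ s′
  northEastStep {x = x} {y} {r} {s} {x′} {_} {r′} {s′} (located refl refl t) (located i≡ j≡ t′) refl refl = northEast x≡ refl r≡ s≡
    where
    r≡ : r′ ≡ r
    r≡ = +-cancelʳ-≡ (suc y) r′ r (trans i≡ (sym (+-suc r y)))
    s≡ : s′ ≡ s
    s≡ = +-cancelʳ-≡ (suc y) s′ s (trans j≡ (sym (+-suc s y)))
    x≡ : x ≡ suc x′
    x≡ = +-cancelʳ-≡ (y + (r + s)) x (suc x′) (trans (sym (+-assoc x y (r + s))) (trans t (trans (sym t′) (trans (cong₂ (λ a b → x′ + suc y + (a + b)) r≡ s≡) (regroup x′ y r s)))))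
      where
      regroup : ∀ x y r s → x + suc y + (r + s) ≡ suc x + (y + (r + s))
      regroup = solve-∀

  -- Edges to the northeast are parallel to the diagonal X Y. Their arrows point one way in XYS (r =
  -- 0), the other way in XRY (s = 0), and are absent on X Y itself (r = s = 0); the difference of
  -- the two minima takes exactly these values.
  initialNorthEast : ∀ {u v x y r s x′ y′ r′ s′} → At u x y r s → At v x′ y′ r′ s′ →
    y ≡ proj₁ u ⊓ proj₂ u → y′ ≡ proj₁ v ⊓ proj₂ v →
    ⟦ arrow? y s x y′ s′ x′ ⟧ ℤ.- ⟦ arrow? x′ r′ y′ x r y ⟧ ≡
    ⟦ east (north u) ≟ᶜ v ⟧ ℤ.* (initialHeight (proj₁ v , proj₂ u) ℤ.- initialHeight (proj₁ u , proj₂ v))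
  initialNorthEast {u} {v} {x} {y} {r} {s} {x′} {y′} {r′} {s′} U V y≡ y′≡ = by (east (north u) ≟ᶜ v)
    where
    A B : Set
    A = Arrow y s x y′ s′ x′
    B = Arrow x′ r′ y′ x r y
    α : Dec A
    α = arrow? y s x y′ s′ x′
    β : Dec B
    β = arrow? x′ r′ y′ x r y
    perm₁ : ∀ y s x → y + s + x ≡ x + y + s
    perm₁ = solve-∀
    perm₂ : ∀ x r y → x + r + y ≡ x + y + r
    perm₂ = solve-∀
    corner : r ≡ r′ → s ≡ s′ → y′ ≡ suc y → east (north u) ≡ v
    corner r≡ s≡ yy = cong₂ _,_
      (trans (cong suc (sym (At.i≡ U))) (trans (sym (+-suc r y)) (trans (cong₂ _+_ r≡ (sym yy)) (At.i≡ V))))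
      (trans (cong suc (sym (At.j≡ U))) (trans (sym (+-suc s y)) (trans (cong₂ _+_ s≡ (sym yy)) (At.j≡ V))))
    A⇒ : A → east (north u) ≡ v
    A⇒ (p∈ , q∈ , _ , yy , s≡ , _) = corner (trans (r-zero U p∈ (perm₁ y s x)) (sym (r-zero V q∈ (perm₁ y′ s′ x′)))) (sym s≡) yy
    B⇒ : B → east (north u) ≡ v
    B⇒ (q∈ , p∈ , _ , _ , r≡ , yy) = corner r≡ (trans (s-zero U p∈ (perm₂ x r y)) (sym (s-zero V q∈ (perm₂ x′ r′ y′)))) yy
    values : r ≡ 0 ⊎ s ≡ 0 → NorthEast x y r s x′ y′ r′ s′ →
      ⟦ α ⟧ ℤ.- ⟦ β ⟧ ≡ + (suc (r + y) ⊓ (s + y)) ℤ.- + ((r + y) ⊓ suc (s + y))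
    values z (northEast x≡ yy r≡ s≡) = split r s refl refl z
      where
      split : ∀ r₀ s₀ → r ≡ r₀ → s ≡ s₀ → r₀ ≡ 0 ⊎ s₀ ≡ 0 → ⟦ α ⟧ ℤ.- ⟦ β ⟧ ≡ + (suc (r + y) ⊓ (s + y)) ℤ.- + ((r + y) ⊓ suc (s + y))
      split zero zero refl refl _ = trans
        (cong₂ ℤ._-_ (⟦⟧-false α λ { (_ , _ , () , _) }) (⟦⟧-false β λ { (_ , _ , r′≥1 , _) → contradiction (≤-trans r′≥1 (≤-reflexive r≡)) (λ ()) }))
        (sym (trans (cong₂ (λ c d → + c ℤ.- + d) (m≥n⇒m⊓n≡n (n≤1+n y)) (m≤n⇒m⊓n≡m (n≤1+n y))) (ℤ.+-inverseʳ (+ y))))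
      split zero (suc s₀) refl refl _ = trans
        (cong₂ ℤ._-_ (⟦⟧-true α (trans (perm₁ y (suc s₀) x) (trans (regroup x y (suc s₀)) (without-r U refl)) , trans (perm₁ y′ s′ x′) (trans (regroup x′ y′ s′) (without-r V r≡)) , s≤s z≤n , yy , s≡ , x≡))
          (⟦⟧-false β λ { (_ , _ , r′≥1 , _) → contradiction (≤-trans r′≥1 (≤-reflexive r≡)) (λ ()) }))
        (sym (trans (cong₂ (λ c d → + c ℤ.- + d) (m≤n⇒m⊓n≡m (s≤s (m≤n+m y s₀))) (m≤n⇒m⊓n≡m (≤-trans (m≤n+m y s₀) (≤-trans (n≤1+n _) (n≤1+n _))))) (unit (+ y))))
        where
        regroup : ∀ x y s → x + y + s ≡ s + x + y
        regroup = solve-∀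
        unit : ∀ y → (1ℤ ℤ.+ y) ℤ.- y ≡ 1ℤ
        unit = ℤ-Solver.solve-∀
      split (suc r₀) zero refl refl _ = trans
        (cong₂ ℤ._-_ (⟦⟧-false α λ { (_ , _ , () , _) })
          (⟦⟧-true β (trans (regroup x′ r′ y′) (without-s V s≡) , trans (regroup x (suc r₀) y) (without-s U refl) , ≤-trans (s≤s z≤n) (≤-reflexive (sym r≡)) , x≡ , sym r≡ , yy)))
        (sym (trans (cong₂ (λ c d → + c ℤ.- + d) (m≥n⇒m⊓n≡n (≤-trans (m≤n+m y r₀) (≤-trans (n≤1+n _) (n≤1+n _)))) (m≥n⇒m⊓n≡n (s≤s (m≤n+m y r₀)))) (unit (+ y))))
        where
        regroup : ∀ x r y → x + r + y ≡ r + y + x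
        regroup = solve-∀
        unit : ∀ y → y ℤ.- (1ℤ ℤ.+ y) ≡ ℤ.- 1ℤ
        unit = ℤ-Solver.solve-∀
      split (suc _) (suc _) _ _ (inj₁ ())
      split (suc _) (suc _) _ _ (inj₂ ())
    by : (e : Dec (east (north u) ≡ v)) → ⟦ α ⟧ ℤ.- ⟦ β ⟧ ≡ ⟦ e ⟧ ℤ.* (initialHeight (proj₁ v , proj₂ u) ℤ.- initialHeight (proj₁ u , proj₂ v))
    by (no ¬e) = cong₂ ℤ._-_ (⟦⟧-false α (¬e ∘ A⇒)) (⟦⟧-false β (¬e ∘ B⇒))
    by (yes e@refl) = trans (values (r⊎s-zero U y≡) (northEastStep U V e (trans y′≡ (cong suc (sym y≡)))))
      (trans (cong₂ (λ c d → + (suc c ⊓ d) ℤ.- + (c ⊓ suc d)) (At.i≡ U) (At.j≡ U)) (sym (ℤ.*-identityˡ _)))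

  initialAnti : ∀ u v → ⟦ east v ≟ᶜ north u ⟧ ℤ.* (1ℤ ℤ.- (initialHeight (proj₁ u , proj₂ v) ℤ.- initialHeight (proj₁ v , proj₂ u))) ≡ 0ℤ
  initialAnti u v = trans (⟦⟧-guard (east v ≟ᶜ north u) {e′ = 0ℤ} λ { refl → level (+ (proj₁ v ⊓ proj₂ u)) }) (ℤ.*-zeroʳ ⟦ east v ≟ᶜ north u ⟧)
    where
    level : ∀ h → 1ℤ ℤ.- ((1ℤ ℤ.+ h) ℤ.- h) ≡ 0ℤ
    level = ℤ-Solver.solve-∀

  finalNorthEast : ∀ u v → ⟦ east (north u) ≟ᶜ v ⟧ ℤ.* (finalHeight (proj₁ v , proj₂ u) ℤ.- finalHeight (proj₁ u , proj₂ v)) ≡ 0ℤ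
  finalNorthEast u v = trans (⟦⟧-guard (east (north u) ≟ᶜ v) {e′ = 0ℤ} λ { refl →
    trans (cong (λ t → + (suc (proj₁ u) + proj₂ u ∸ suc n) ℤ.- + (t ∸ suc n)) (+-suc (proj₁ u) (proj₂ u))) (ℤ.+-inverseʳ (+ (suc (proj₁ u) + proj₂ u ∸ suc n))) })
    (ℤ.*-zeroʳ ⟦ east (north u) ≟ᶜ v ⟧)

  -- The counterpart for the new diagonal R S: arrows parallel to it point one way in XRS (y = 0),
  -- the other way in RYS (x = 0), and are absent on R S itself (x = y = 0).
  finalAnti : ∀ {u v x y r s x′ y′ r′ s′} → At u x y r s → At v x′ y′ r′ s′ →
    y ≡ proj₁ u + proj₂ u ∸ suc n → y′ ≡ proj₁ v + proj₂ v ∸ suc n →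
    ⟦ arrow? s x r s′ x′ r′ ⟧ ℤ.- ⟦ arrow? r′ y′ s′ r y s ⟧ ≡
    ⟦ east v ≟ᶜ north u ⟧ ℤ.* (1ℤ ℤ.- (finalHeight (proj₁ u , proj₂ v) ℤ.- finalHeight (proj₁ v , proj₂ u)))
  finalAnti {u} {v} {x} {y} {r} {s} {x′} {y′} {r′} {s′} U V y≡ y′≡ = by (east v ≟ᶜ north u)
    where
    A B : Set
    A = Arrow s x r s′ x′ r′
    B = Arrow r′ y′ s′ r y s
    α : Dec A
    α = arrow? s x r s′ x′ r′
    β : Dec B
    β = arrow? r′ y′ s′ r y s
    perm₁ : ∀ s x r → s + x + r ≡ x + r + s
    perm₁ = solve-∀
    perm₂ : ∀ r y s → r + y + s ≡ y + r + s
    perm₂ = solve-∀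
    corner : r ≡ suc r′ → s′ ≡ suc s → y ≡ y′ → east v ≡ north u
    corner r≡ s≡ yy = cong₂ _,_
      (trans (cong suc (sym (At.i≡ V))) (trans (cong₂ _+_ (sym r≡) (sym yy)) (At.i≡ U)))
      (trans (sym (At.j≡ V)) (trans (cong₂ _+_ s≡ (sym yy)) (cong suc (At.j≡ U))))
    A⇒ : A → east v ≡ north u
    A⇒ (p∈ , q∈ , _ , s≡ , _ , r≡) = corner r≡ s≡ (trans (y-zero U p∈ (perm₁ s x r)) (sym (y-zero V q∈ (perm₁ s′ x′ r′))))
    B⇒ : B → east v ≡ north u
    B⇒ (_ , _ , _ , r≡ , yy , s≡) = corner r≡ s≡ yy
    module _ (e : east v ≡ north u) where
      i≡ : suc (proj₁ v) ≡ proj₁ u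
      i≡ = cong proj₁ e
      j≡ : proj₂ v ≡ suc (proj₂ u)
      j≡ = cong proj₂ e
      yy : y ≡ y′
      yy = trans y≡ (trans (cong (_∸ suc n) (trans (cong (_+ proj₂ u) (sym i≡)) (trans (sym (+-suc (proj₁ v) (proj₂ u))) (cong (_+_ (proj₁ v)) (sym j≡))))) (sym y′≡))
      r≡ : r ≡ suc r′
      r≡ = +-cancelʳ-≡ y r (suc r′) (trans (At.i≡ U) (trans (sym i≡) (cong suc (trans (sym (At.i≡ V)) (cong (_+_ r′) (sym yy))))))
      s≡ : s′ ≡ suc s
      s≡ = +-cancelʳ-≡ y′ s′ (suc s) (trans (At.j≡ V) (trans j≡ (cong suc (trans (sym (At.j≡ U)) (cong (_+_ s) yy)))))
      x≡ : x′ ≡ x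
      x≡ = +-cancelʳ-≡ (y + (suc r′ + s)) x′ x (trans (regroup x′ y r′ s) (trans (cong₂ (λ c d → x′ + c + (r′ + d)) yy (sym s≡)) (trans (At.total V) (trans (sym (At.total U)) (trans (cong (λ c → x + y + (c + s)) r≡) (+-assoc x y (suc r′ + s)))))))
        where
        regroup : ∀ x y r s → x + (y + (suc r + s)) ≡ x + y + (r + suc s)
        regroup = solve-∀
      drop : proj₁ u + proj₂ v ∸ suc n ≡ suc y ∸ x
      drop = trans (cong₂ _∸_ (trans (cong (_+_ (proj₁ u)) j≡) (trans (+-suc (proj₁ u) (proj₂ u)) (trans (cong suc (i+j≡ U)) (sym (+-suc (y + (r + s)) y))))) (N≡ U)) ([m+n]∸[m+o]≡n∸o (y + (r + s)) (suc y) x)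
      drop′ : proj₁ v + proj₂ u ∸ suc n ≡ y ∸ suc x
      drop′ = trans (cong₂ _∸_
          (suc-injective (trans (cong (_+ proj₂ u) i≡) (trans (i+j≡ U) (trans (cong (λ c → y + (c + s) + y) r≡) (regroup₁ y r′ s)))))
          (trans (N≡ U) (trans (cong (λ c → y + (c + s) + x) r≡) (regroup₂ x y r′ s))))
        ([m+n]∸[m+o]≡n∸o (y + (r′ + s)) y (suc x))
        where
        regroup₁ : ∀ y r s → y + (suc r + s) + y ≡ suc (y + (r + s) + y)
        regroup₁ = solve-∀
        regroup₂ : ∀ x y r s → y + (suc r + s) + x ≡ y + (r + s) + suc x
        regroup₂ = solve-∀
      values : x ≡ 0 ⊎ y ≡ 0 → ⟦ α ⟧ ℤ.- ⟦ β ⟧ ≡ 1ℤ ℤ.- (+ (suc y ∸ x) ℤ.- + (y ∸ suc x))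
      values z = split x y refl refl z
        where
        regroupA : ∀ s x r → s + x + r ≡ r + s + x
        regroupA = solve-∀
        regroupB : ∀ r y s → r + y + s ≡ s + r + y
        regroupB = solve-∀
        split : ∀ x₀ y₀ → x ≡ x₀ → y ≡ y₀ → x₀ ≡ 0 ⊎ y₀ ≡ 0 → ⟦ α ⟧ ℤ.- ⟦ β ⟧ ≡ 1ℤ ℤ.- (+ (suc y ∸ x) ℤ.- + (y ∸ suc x))
        split zero zero refl refl _ = cong₂ ℤ._-_ (⟦⟧-false α λ { (_ , _ , () , _) })
          (⟦⟧-false β λ { (_ , _ , y≥1 , _) → contradiction (≤-trans y≥1 (≤-reflexive (sym yy))) (λ ()) })
        split (suc x₀) zero refl refl _ = trans (cong₂ ℤ._-_
          (⟦⟧-true α (trans (regroupA s x r) (without-y U refl) , trans (regroupA s′ x′ r′) (without-y V (sym yy)) , s≤s z≤n , s≡ , x≡ , r≡))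
          (⟦⟧-false β λ { (_ , _ , y≥1 , _) → contradiction (≤-trans y≥1 (≤-reflexive (sym yy))) (λ ()) }))
          (cong (λ c → 1ℤ ℤ.- (+ c ℤ.- + 0)) (sym (0∸n≡0 x₀)))
        split zero (suc y₀) refl refl _ = trans (cong₂ ℤ._-_ (⟦⟧-false α λ { (_ , _ , () , _) })
          (⟦⟧-true β (trans (regroupB r′ y′ s′) (without-x V x≡) , trans (regroupB r y s) (without-x U refl) , ≤-trans (s≤s z≤n) (≤-reflexive yy) , r≡ , yy , s≡)))
          (two (+ y₀))
          where
          two : ∀ y → 0ℤ ℤ.- 1ℤ ≡ 1ℤ ℤ.- ((+ 2 ℤ.+ y) ℤ.- y)
          two = ℤ-Solver.solve-∀
        split (suc _) (suc _) _ _ (inj₁ ())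
        split (suc _) (suc _) _ _ (inj₂ ())
    by : (e : Dec (east v ≡ north u)) → ⟦ α ⟧ ℤ.- ⟦ β ⟧ ≡ ⟦ e ⟧ ℤ.* (1ℤ ℤ.- (finalHeight (proj₁ u , proj₂ v) ℤ.- finalHeight (proj₁ v , proj₂ u)))
    by (no ¬e) = cong₂ ℤ._-_ (⟦⟧-false α (¬e ∘ A⇒)) (⟦⟧-false β (¬e ∘ B⇒))
    by (yes e) = trans (values e (x⊎y-zero U y≡)) (trans (cong₂ (λ c d → 1ℤ ℤ.- (+ c ℤ.- + d)) (sym (drop e)) (sym (drop′ e))) (sym (ℤ.*-identityˡ _)))

  module _ {u v : Coord} {x y r s x′ y′ r′ s′ : ℕ} (U : At u x y r s) (V : At v x′ y′ r′ s′) where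

    edges-initial : y ≡ proj₁ u ⊓ proj₂ u → y′ ≡ proj₁ v ⊓ proj₂ v →
      edges initialHeight u v ≡
        (⟦ arrow? r y x r′ y′ x′ ⟧ ℤ.- ⟦ arrow? s′ x′ y′ s x y ⟧)
        ℤ.- (⟦ arrow? x′ y′ s′ x y s ⟧ ℤ.- ⟦ arrow? y x r y′ x′ r′ ⟧)
        ℤ.+ (⟦ arrow? y s x y′ s′ x′ ⟧ ℤ.- ⟦ arrow? x′ r′ y′ x r y ⟧)
    edges-initial y≡ y′≡ = trans (cong₂ ℤ._+_ (cong₂ ℤ._+_ (cong₂ ℤ._-_ eastTerm northTerm) (sym (initialNorthEast U V y≡ y′≡))) (initialAnti u v)) (ℤ.+-identityʳ _)
      where
      eastTerm : eastAt u v ℤ.* (⟦ inner? (proj₂ u) ⟧ ℤ.* (1ℤ ℤ.- + 2 ℤ.* (initialHeight v ℤ.- initialHeight u))) ≡ ⟦ arrow? r y x r′ y′ x′ ⟧ ℤ.- ⟦ arrow? s′ x′ y′ s x y ⟧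
      eastTerm = trans (cong₂ (horizontalTerm u v) (sym y≡) (sym y′≡)) (sym (initialEast U V y≡ y′≡))
      -- Exchanging R and S reflects the square and turns north into east; `⟦reverse⟧` compensates
      -- the reflected orientation of the triangles.
      northTerm : northAt u v ℤ.* (⟦ inner? (proj₁ u) ⟧ ℤ.* (1ℤ ℤ.- + 2 ℤ.* (initialHeight v ℤ.- initialHeight u))) ≡ ⟦ arrow? x′ y′ s′ x y s ⟧ ℤ.- ⟦ arrow? y x r y′ x′ r′ ⟧
      northTerm = trans (cong₂ (verticalTerm u v) (sym y≡) (sym y′≡)) (trans (sym (transposeVertical {proj₁ u} {proj₂ u} {proj₁ v} {proj₂ v} y y′))
        (trans (sym (initialEast (transpose U) (transpose V) (trans y≡ (⊓-comm (proj₁ u) (proj₂ u))) (trans y′≡ (⊓-comm (proj₁ v) (proj₂ v)))))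
          (cong₂ ℤ._-_ (⟦reverse⟧ s y x s′ y′ x′) (⟦reverse⟧ r′ x′ y′ r x y))))

    edges-final : y ≡ proj₁ u + proj₂ u ∸ suc n → y′ ≡ proj₁ v + proj₂ v ∸ suc n →
      edges finalHeight u v ≡
        (⟦ arrow? r s x r′ s′ x′ ⟧ ℤ.- ⟦ arrow? s′ r′ y′ s r y ⟧)
        ℤ.- (⟦ arrow? x′ r′ s′ x r s ⟧ ℤ.- ⟦ arrow? y s r y′ s′ r′ ⟧)
        ℤ.+ (⟦ arrow? s x r s′ x′ r′ ⟧ ℤ.- ⟦ arrow? r′ y′ s′ r y s ⟧)
    edges-final y≡ y′≡ = cong₂ ℤ._+_ (trans (cong₂ ℤ._+_ (cong₂ ℤ._-_ eastTerm northTerm) (finalNorthEast u v)) (ℤ.+-identityʳ ((⟦ arrow? r s x r′ s′ x′ ⟧ ℤ.- ⟦ arrow? s′ r′ y′ s r y ⟧) ℤ.- (⟦ arrow? x′ r′ s′ x r s ⟧ ℤ.- ⟦ arrow? y s r y′ s′ r′ ⟧)))) (sym (finalAnti U V y≡ y′≡))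
      where
      eastTerm : eastAt u v ℤ.* (⟦ inner? (proj₂ u) ⟧ ℤ.* (1ℤ ℤ.- + 2 ℤ.* (finalHeight v ℤ.- finalHeight u))) ≡ ⟦ arrow? r s x r′ s′ x′ ⟧ ℤ.- ⟦ arrow? s′ r′ y′ s r y ⟧
      eastTerm = trans (cong₂ (horizontalTerm u v) (sym y≡) (sym y′≡)) (sym (finalEast U V y≡ y′≡))
      northTerm : northAt u v ℤ.* (⟦ inner? (proj₁ u) ⟧ ℤ.* (1ℤ ℤ.- + 2 ℤ.* (finalHeight v ℤ.- finalHeight u))) ≡ ⟦ arrow? x′ r′ s′ x r s ⟧ ℤ.- ⟦ arrow? y s r y′ s′ r′ ⟧
      northTerm = trans (cong₂ (verticalTerm u v) (sym y≡) (sym y′≡)) (trans (sym (transposeVertical {proj₁ u} {proj₂ u} {proj₁ v} {proj₂ v} y y′))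
        (trans (sym (finalEast (transpose U) (transpose V) (trans y≡ (cong (_∸ suc n) (+-comm (proj₁ u) (proj₂ u)))) (trans y′≡ (cong (_∸ suc n) (+-comm (proj₁ v) (proj₂ v))))))
          (cong₂ ℤ._-_ (⟦reverse⟧ s r x s′ r′ x′) (⟦reverse⟧ r′ s′ y′ r s y))))

  module _ {u v : Coord} {x y r s x′ y′ r′ s′ : ℕ} (U : At u x y r s) (V : At v x′ y′ r′ s′) where

    form-initial : y ≡ proj₁ u ⊓ proj₂ u → y′ ≡ proj₁ v ⊓ proj₂ v →
      form initialHeight u v ≡ triangleForm x r y x′ r′ y′ ℤ.+ triangleForm x y s x′ y′ s′
    form-initial y≡ y′≡ = trans (cong₂ ℤ._-_ (edges-initial U V y≡ y′≡) (edges-initial V U y′≡ y≡))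
      (collect ⟦ arrow? r y x r′ y′ x′ ⟧ ⟦ arrow? y x r y′ x′ r′ ⟧ ⟦ arrow? x r y x′ r′ y′ ⟧
               ⟦ arrow? s x y s′ x′ y′ ⟧ ⟦ arrow? x y s x′ y′ s′ ⟧ ⟦ arrow? y s x y′ s′ x′ ⟧
               ⟦ arrow? r′ y′ x′ r y x ⟧ ⟦ arrow? y′ x′ r′ y x r ⟧ ⟦ arrow? x′ r′ y′ x r y ⟧
               ⟦ arrow? s′ x′ y′ s x y ⟧ ⟦ arrow? x′ y′ s′ x y s ⟧ ⟦ arrow? y′ s′ x′ y s x ⟧)
      where
      collect : ∀ ryx yxr xry sxy xys ysx ryx′ yxr′ xry′ sxy′ xys′ ysx′ →
        ((ryx ℤ.- sxy′) ℤ.- (xys′ ℤ.- yxr) ℤ.+ (ysx ℤ.- xry′)) ℤ.- ((ryx′ ℤ.- sxy) ℤ.- (xys ℤ.- yxr′) ℤ.+ (ysx′ ℤ.- xry))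
        ≡ ((xry ℤ.+ yxr ℤ.+ ryx) ℤ.- (xry′ ℤ.+ yxr′ ℤ.+ ryx′)) ℤ.+ ((xys ℤ.+ sxy ℤ.+ ysx) ℤ.- (xys′ ℤ.+ sxy′ ℤ.+ ysx′))
      collect = ℤ-Solver.solve-∀

    form-final : y ≡ proj₁ u + proj₂ u ∸ suc n → y′ ≡ proj₁ v + proj₂ v ∸ suc n →
      form finalHeight u v ≡ triangleForm x r s x′ r′ s′ ℤ.+ triangleForm r y s r′ y′ s′
    form-final y≡ y′≡ = trans (cong₂ ℤ._-_ (edges-final U V y≡ y′≡) (edges-final V U y′≡ y≡))
      (collect ⟦ arrow? r s x r′ s′ x′ ⟧ ⟦ arrow? s x r s′ x′ r′ ⟧ ⟦ arrow? x r s x′ r′ s′ ⟧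
               ⟦ arrow? s r y s′ r′ y′ ⟧ ⟦ arrow? r y s r′ y′ s′ ⟧ ⟦ arrow? y s r y′ s′ r′ ⟧
               ⟦ arrow? r′ s′ x′ r s x ⟧ ⟦ arrow? s′ x′ r′ s x r ⟧ ⟦ arrow? x′ r′ s′ x r s ⟧
               ⟦ arrow? s′ r′ y′ s r y ⟧ ⟦ arrow? r′ y′ s′ r y s ⟧ ⟦ arrow? y′ s′ r′ y s r ⟧)
      where
      collect : ∀ rsx sxr xrs sry rys ysr rsx′ sxr′ xrs′ sry′ rys′ ysr′ →
        ((rsx ℤ.- sry′) ℤ.- (xrs′ ℤ.- ysr) ℤ.+ (sxr ℤ.- rys′)) ℤ.- ((rsx′ ℤ.- sry) ℤ.- (xrs ℤ.- ysr′) ℤ.+ (sxr′ ℤ.- rys))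
        ≡ ((xrs ℤ.+ sxr ℤ.+ rsx) ℤ.- (xrs′ ℤ.+ sxr′ ℤ.+ rsx′)) ℤ.+ ((rys ℤ.+ sry ℤ.+ ysr) ℤ.- (rys′ ℤ.+ sry′ ℤ.+ ysr′))
      collect = ℤ-Solver.solve-∀

-- Points of the polygon

module Points (n : ℕ) (ps : List ℕ) (mirror : Bool) where

  open Polygon n ps mirror

  weight-ext : ∀ {k} (p q : Vec ℕ k) → (∀ w → weight w p ≡ weight w q) → p ≡ q
  weight-ext []      []      eq = refl
  weight-ext (x ∷ p) (y ∷ q) eq = cong₂ _∷_ (eq 0) (weight-ext p q (eq ∘ suc))

  weight-⊕ : ∀ {k} w (p q : Vec ℕ k) → weight w (Vec.zipWith _+_ p q) ≡ weight w p + weight w q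
  weight-⊕ w       []      []      = refl
  weight-⊕ zero    (x ∷ p) (y ∷ q) = refl
  weight-⊕ (suc w) (x ∷ p) (y ∷ q) = weight-⊕ w p q

  weight-tabulate : ∀ {k w} (f : ℕ → ℕ) → w < k → weight w (Vec.tabulate {n = k} (f ∘ toℕ)) ≡ f w
  weight-tabulate {suc k} {zero}  f _         = refl
  weight-tabulate {suc k} {suc w} f (s≤s w<k) = weight-tabulate (f ∘ suc) w<k

  weight-tabulate-zero : ∀ {k} w (f : ℕ → ℕ) → f w ≡ 0 → weight w (Vec.tabulate {n = k} (f ∘ toℕ)) ≡ 0
  weight-tabulate-zero {zero}  w       f eq = refl
  weight-tabulate-zero {suc k} zero    f eq = eq
  weight-tabulate-zero {suc k} (suc w) f eq = weight-tabulate-zero {k} w (f ∘ suc) eq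

  weight-⊙ : ∀ c {X} → X < m → weight X (c ⊙ X) ≡ c
  weight-⊙ c {X} X<m = trans (weight-tabulate (λ Y → if Y ℕ.≡ᵇ X then c else 0) X<m) (cong (if_then c else 0) (dec-true (X ≟ X) refl))

  weight-⊙-≢ : ∀ c {w X} → w ≢ X → weight w (c ⊙ X) ≡ 0
  weight-⊙-≢ c {w} {X} w≢X = weight-tabulate-zero {m} w (λ Y → if Y ℕ.≡ᵇ X then c else 0) (cong (if_then c else 0) (dec-false (w ≟ X) w≢X))

  total : ∀ {k} → Vec ℕ k → ℕ
  total = Vec.sum

  total-⊕ : ∀ {k} (p q : Vec ℕ k) → total (Vec.zipWith _+_ p q) ≡ total p + total q
  total-⊕ []      []      = refl
  total-⊕ (x ∷ p) (y ∷ q) = trans (cong (_+_ (x + y)) (total-⊕ p q)) (interchange x y (total p) (total q))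
    where
    interchange : ∀ a b c d → a + b + (c + d) ≡ a + c + (b + d)
    interchange = solve-∀

  total-zero : ∀ {k} (p : Vec ℕ k) → (∀ w → weight w p ≡ 0) → total p ≡ 0
  total-zero []      eq = refl
  total-zero (x ∷ p) eq = cong₂ _+_ (eq 0) (total-zero p (eq ∘ suc))

  clear : ∀ {k} → ℕ → Vec ℕ k → Vec ℕ k
  clear X       []      = []
  clear zero    (x ∷ p) = 0 ∷ p
  clear (suc X) (x ∷ p) = x ∷ clear X p

  total-clear : ∀ {k} X (p : Vec ℕ k) → total p ≡ weight X p + total (clear X p)
  total-clear X       []      = refl
  total-clear zero    (x ∷ p) = refl
  total-clear (suc X) (x ∷ p) = trans (cong (_+_ x) (total-clear X p)) (swap x (weight X p) (total (clear X p)))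
    where
    swap : ∀ a b c → a + (b + c) ≡ b + (a + c)
    swap = solve-∀

  weight-clear : ∀ {k} X (p : Vec ℕ k) → weight X (clear X p) ≡ 0
  weight-clear X       []      = refl
  weight-clear zero    (x ∷ p) = refl
  weight-clear (suc X) (x ∷ p) = weight-clear X p

  weight-clear-≢ : ∀ {k w X} (p : Vec ℕ k) → w ≢ X → weight w (clear X p) ≡ weight w p
  weight-clear-≢ []      w≢X = refl
  weight-clear-≢ {w = zero}  {zero}  (x ∷ p) w≢X = contradiction refl w≢X
  weight-clear-≢ {w = suc w} {zero}  (x ∷ p) w≢X = refl
  weight-clear-≢ {w = zero}  {suc X} (x ∷ p) w≢X = refl
  weight-clear-≢ {w = suc w} {suc X} (x ∷ p) w≢X = weight-clear-≢ p (w≢X ∘ cong suc)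

  total-⊙ : ∀ c {X} → X < m → total (c ⊙ X) ≡ c
  total-⊙ c {X} X<m = trans (total-clear X (c ⊙ X)) (trans (cong₂ _+_ (weight-⊙ c X<m) (total-zero (clear X (c ⊙ X)) zeros)) (+-identityʳ c))
    where
    zeros : ∀ w → weight w (clear X (c ⊙ X)) ≡ 0
    zeros w with w ≟ X
    ... | yes refl = weight-clear X (c ⊙ X)
    ... | no w≢X   = trans (weight-clear-≢ (c ⊙ X) w≢X) (weight-⊙-≢ c w≢X)

  weights : ∀ {k} → List ℕ → Vec ℕ k → ℕ
  weights Xs p = foldr (λ X t → weight X p + t) 0 Xs

  weights≤total : ∀ {k} {Xs} (p : Vec ℕ k) → Unique Xs → weights Xs p ≤ total p
  weights≤total p []       = z≤n
  weights≤total {Xs = X ∷ Xs} p (X# ∷ u) = ≤-trans (+-monoʳ-≤ (weight X p) (≤-trans (≤-reflexive (cleared Xs X#)) (weights≤total (clear X p) u))) (≤-reflexive (sym (total-clear X p)))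
    where
    cleared : ∀ Ys → All (X ≢_) Ys → weights Ys p ≡ weights Ys (clear X p)
    cleared []       []         = refl
    cleared (Y ∷ Ys) (X≢Y ∷ X#) = cong₂ _+_ (sym (weight-clear-≢ p (X≢Y ∘ sym))) (cleared Ys X#)

  -- Otherwise the distinct vertices `w ∷ Xs` would carry more than the total weight.
  weight-outside : ∀ {k w Xs} (p : Vec ℕ k) → Unique Xs → All (w ≢_) Xs → weights Xs p ≡ total p → weight w p ≡ 0
  weight-outside {w = w} {Xs} p u w# eq = n≤0⇒n≡0 (+-cancelʳ-≤ (weights Xs p) (weight w p) 0
    (≤-trans (weights≤total p (w# ∷ u)) (≤-reflexive (sym eq))))

  quad : (X Y R S x y r s : ℕ) → Point
  quad X Y R S x y r s = x ⊙ X ⊕ y ⊙ Y ⊕ r ⊙ R ⊕ s ⊙ S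

  record Quadrilateral (X Y R S : ℕ) : Set where
    field
      X<m : X < m
      Y<m : Y < m
      R<m : R < m
      S<m : S < m
      X≢Y : X ≢ Y
      X≢R : X ≢ R
      X≢S : X ≢ S
      Y≢R : Y ≢ R
      Y≢S : Y ≢ S
      R≢S : R ≢ S

  module _ {X Y R S : ℕ} (Q : Quadrilateral X Y R S) where
    open Quadrilateral Q

    corners : List ℕ
    corners = X ∷ Y ∷ R ∷ S ∷ []

    corners-unique : Unique corners
    corners-unique = (X≢Y ∷ X≢R ∷ X≢S ∷ []) ∷ (Y≢R ∷ Y≢S ∷ []) ∷ (R≢S ∷ []) ∷ [] ∷ []

    private
      weight-quad : ∀ w x y r s → weight w (quad X Y R S x y r s) ≡ weight w (x ⊙ X) + weight w (y ⊙ Y) + weight w (r ⊙ R) + weight w (s ⊙ S)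
      weight-quad w x y r s = trans (weight-⊕ w (x ⊙ X ⊕ y ⊙ Y ⊕ r ⊙ R) (s ⊙ S)) (cong (_+ weight w (s ⊙ S))
        (trans (weight-⊕ w (x ⊙ X ⊕ y ⊙ Y) (r ⊙ R)) (cong (_+ weight w (r ⊙ R)) (weight-⊕ w (x ⊙ X) (y ⊙ Y)))))

    quad-X : ∀ x y r s → weight X (quad X Y R S x y r s) ≡ x
    quad-X x y r s = trans (weight-quad X x y r s) (trans (cong₂ _+_ (cong₂ _+_ (cong₂ _+_ (weight-⊙ x X<m) (weight-⊙-≢ y X≢Y)) (weight-⊙-≢ r X≢R)) (weight-⊙-≢ s X≢S)) (trans (+-identityʳ _) (trans (+-identityʳ _) (+-identityʳ x))))

    quad-Y : ∀ x y r s → weight Y (quad X Y R S x y r s) ≡ y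
    quad-Y x y r s = trans (weight-quad Y x y r s) (trans (cong₂ _+_ (cong₂ _+_ (cong₂ _+_ (weight-⊙-≢ x (X≢Y ∘ sym)) (weight-⊙ y Y<m)) (weight-⊙-≢ r Y≢R)) (weight-⊙-≢ s Y≢S)) (trans (+-identityʳ _) (+-identityʳ y)))

    quad-R : ∀ x y r s → weight R (quad X Y R S x y r s) ≡ r
    quad-R x y r s = trans (weight-quad R x y r s) (trans (cong₂ _+_ (cong₂ _+_ (cong₂ _+_ (weight-⊙-≢ x (X≢R ∘ sym)) (weight-⊙-≢ y (Y≢R ∘ sym))) (weight-⊙ r R<m)) (weight-⊙-≢ s R≢S)) (+-identityʳ r))

    quad-S : ∀ x y r s → weight S (quad X Y R S x y r s) ≡ s
    quad-S x y r s = trans (weight-quad S x y r s) (cong₂ _+_ (cong₂ _+_ (cong₂ _+_ (weight-⊙-≢ x (X≢S ∘ sym)) (weight-⊙-≢ y (Y≢S ∘ sym))) (weight-⊙-≢ r (R≢S ∘ sym))) (weight-⊙ s S<m))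

    quad-other : ∀ {w} x y r s → All (w ≢_) corners → weight w (quad X Y R S x y r s) ≡ 0
    quad-other {w} x y r s (w≢X ∷ w≢Y ∷ w≢R ∷ w≢S ∷ []) = trans (weight-quad w x y r s)
      (cong₂ _+_ (cong₂ _+_ (cong₂ _+_ (weight-⊙-≢ x w≢X) (weight-⊙-≢ y w≢Y)) (weight-⊙-≢ r w≢R)) (weight-⊙-≢ s w≢S))

    total-quad : ∀ x y r s → total (quad X Y R S x y r s) ≡ x + y + r + s
    total-quad x y r s = trans (total-⊕ (x ⊙ X ⊕ y ⊙ Y ⊕ r ⊙ R) (s ⊙ S)) (cong₂ _+_ (trans (total-⊕ (x ⊙ X ⊕ y ⊙ Y) (r ⊙ R))
      (cong₂ _+_ (trans (total-⊕ (x ⊙ X) (y ⊙ Y)) (cong₂ _+_ (total-⊙ x X<m) (total-⊙ y Y<m))) (total-⊙ r R<m))) (total-⊙ s S<m))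

    corner⊎other : ∀ w → w ∈ corners ⊎ All (w ≢_) corners
    corner⊎other w with Any.any? (w ≟_) corners
    ... | yes w∈ = inj₁ w∈
    ... | no w∉  = inj₂ (All.¬Any⇒All¬ corners w∉)

    Inside : ℕ → Point → Set
    Inside k p = (weight X p + weight Y p + weight R p + weight S p ≡ k) × (total p ≡ k)

    inside-other : ∀ {k p w} → Inside k p → All (w ≢_) corners → weight w p ≡ 0
    inside-other {k} {p} (eq , t) w# = weight-outside p corners-unique w# (trans (regroup (weight X p) (weight Y p) (weight R p) (weight S p)) (trans eq (sym t)))
      where
      regroup : ∀ x y r s → x + (y + (r + (s + 0))) ≡ x + y + r + s
      regroup = solve-∀

    inside-ext : ∀ {k p q} → Inside k p → Inside k q → weight X p ≡ weight X q → weight Y p ≡ weight Y q → weight R p ≡ weight R q → weight S p ≡ weight S q → p ≡ q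
    inside-ext {k} {p} {q} p∈ q∈ x y r s = weight-ext p q λ w → by w (corner⊎other w)
      where
      by : ∀ w → w ∈ corners ⊎ All (w ≢_) corners → weight w p ≡ weight w q
      by w (inj₁ (here refl))                         = x
      by w (inj₁ (there (here refl)))                 = y
      by w (inj₁ (there (there (here refl))))         = r
      by w (inj₁ (there (there (there (here refl))))) = s
      by w (inj₂ w#) = trans (inside-other {p = p} p∈ w#) (sym (inside-other {p = q} q∈ w#))

    quad-inside : ∀ x y r s → Inside (x + y + r + s) (quad X Y R S x y r s)
    quad-inside x y r s = cong₂ _+_ (cong₂ _+_ (cong₂ _+_ (quad-X x y r s) (quad-Y x y r s)) (quad-R x y r s)) (quad-S x y r s) , total-quad x y r s

  InTriangle : (X Y Z : ℕ) → Point → Set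
  InTriangle X Y Z p = weight X p + weight Y p + weight Z p ≡ suc n

  triangle-other : ∀ {X Y Z w p} → X ≢ Y → X ≢ Z → Y ≢ Z → total p ≡ suc n → InTriangle X Y Z p → w ≢ X → w ≢ Y → w ≢ Z → weight w p ≡ 0
  triangle-other {X} {Y} {Z} {p = p} X≢Y X≢Z Y≢Z t eq w≢X w≢Y w≢Z =
    weight-outside p ((X≢Y ∷ X≢Z ∷ []) ∷ (Y≢Z ∷ []) ∷ [] ∷ []) (w≢X ∷ w≢Y ∷ w≢Z ∷ [])
      (trans (regroup (weight X p) (weight Y p) (weight Z p)) (trans eq (sym t)))
    where
    regroup : ∀ x y z → x + (y + (z + 0)) ≡ x + y + z
    regroup = solve-∀


  module Values (g : ℕ → ℕ) where

    monomial : ∀ {k} → (ℕ → ℕ) → Vec ℕ k → ℕ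
    monomial f []      = 1
    monomial f (w ∷ p) = f 0 ^ w * monomial (f ∘ suc) p

    -- With g v the λ-length of the diagonal A v and all other λ-lengths in a
    -- triangle at A equal to 1, this is the product of the λ-lengths λ(P,Q) to the
    -- power w_P w_Q.
    value : Point → ℕ
    value p = monomial g p ^ weight A p

    monomial-⊕ : ∀ {k} f (p q : Vec ℕ k) → monomial f (Vec.zipWith _+_ p q) ≡ monomial f p * monomial f q
    monomial-⊕ f []      []      = refl
    monomial-⊕ f (x ∷ p) (y ∷ q) = trans (cong₂ _*_ (^-distribˡ-+-* (f 0) x y) (monomial-⊕ (f ∘ suc) p q)) (interchange (f 0 ^ x) (f 0 ^ y) (monomial (f ∘ suc) p) (monomial (f ∘ suc) q))
      where
      interchange : ∀ a b c d → a * b * (c * d) ≡ a * c * (b * d)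
      interchange = solve-∀

    monomial-zero : ∀ {k} f (p : Vec ℕ k) → (∀ w → weight w p ≡ 0) → monomial f p ≡ 1
    monomial-zero f []      eq = refl
    monomial-zero f (x ∷ p) eq = cong₂ (λ a b → f 0 ^ a * b) (eq 0) (monomial-zero (f ∘ suc) p (eq ∘ suc))

    monomial-clear : ∀ {k} f X (p : Vec ℕ k) → monomial f p ≡ f X ^ weight X p * monomial f (clear X p)
    monomial-clear f X       []      = refl
    monomial-clear f zero    (x ∷ p) = cong (f 0 ^ x *_) (sym (+-identityʳ _))
    monomial-clear f (suc X) (x ∷ p) = trans (cong (f 0 ^ x *_) (monomial-clear (f ∘ suc) X p)) (swap (f 0 ^ x) (f (suc X) ^ weight X p) (monomial (f ∘ suc) (clear X p)))
      where
      swap : ∀ a b c → a * (b * c) ≡ b * (a * c)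
      swap = solve-∀

    monomial-⊙ : ∀ c {X} → X < m → monomial g (c ⊙ X) ≡ g X ^ c
    monomial-⊙ c {X} X<m = trans (monomial-clear g X (c ⊙ X)) (trans (cong₂ (λ a b → g X ^ a * b) (weight-⊙ c X<m) (monomial-zero g (clear X (c ⊙ X)) zeros)) (*-identityʳ _))
      where
      zeros : ∀ w → weight w (clear X (c ⊙ X)) ≡ 0
      zeros w with w ≟ X
      ... | yes refl = weight-clear X (c ⊙ X)
      ... | no w≢X   = trans (weight-clear-≢ (c ⊙ X) w≢X) (weight-⊙-≢ c w≢X)

    monomial-quad : ∀ {X Y R S} → Quadrilateral X Y R S → ∀ x y r s → monomial g (quad X Y R S x y r s) ≡ g X ^ x * g Y ^ y * g R ^ r * g S ^ s
    monomial-quad {X} {Y} {R} {S} Q x y r s = trans (monomial-⊕ g (x ⊙ X ⊕ y ⊙ Y ⊕ r ⊙ R) (s ⊙ S)) (cong₂ _*_ (trans (monomial-⊕ g (x ⊙ X ⊕ y ⊙ Y) (r ⊙ R))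
      (cong₂ _*_ (trans (monomial-⊕ g (x ⊙ X) (y ⊙ Y)) (cong₂ _*_ (monomial-⊙ x X<m) (monomial-⊙ y Y<m))) (monomial-⊙ r R<m))) (monomial-⊙ s S<m))
      where open Quadrilateral Q

    monomial-positive : (∀ v → 1 ≤ g v) → ∀ {k} (p : Vec ℕ k) → 1 ≤ monomial g p
    monomial-positive g≥1 p = go g g≥1 p
      where
      go : ∀ {k} f → (∀ v → 1 ≤ f v) → (p : Vec ℕ k) → 1 ≤ monomial f p
      go f f≥1 []      = ≤-refl
      go f f≥1 (w ∷ p) = *-mono-≤ (subst (_≤ f 0 ^ w) (^-zeroˡ w) (^-monoˡ-≤ w (f≥1 0))) (go (f ∘ suc) (f≥1 ∘ suc) p)

module FarCoordinate (n : ℕ) where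

  open SurfaceQuiver n

  -- The coordinates given to the vertices outside the quadrilateral: not adjacent
  -- to any point of the square.
  far : Coord
  far = 3 + n , 3 + n

  Near : Coord → Set
  Near v = (proj₁ v ≤ suc n × proj₂ v ≤ suc n) ⊎ v ≡ far

  edges-zero : ∀ y {u v} → east u ≢ v → north u ≢ v → east (north u) ≢ v → east v ≢ north u → edges y u v ≡ 0ℤ
  edges-zero y {u} {v} e n′ d t rewrite ⟦⟧-false (east u ≟ᶜ v) e | ⟦⟧-false (north u ≟ᶜ v) n′ | ⟦⟧-false (east (north u) ≟ᶜ v) d | ⟦⟧-false (east v ≟ᶜ north u) t = refl

  form-farˡ : ∀ y {v} → Near v → form y far v ≡ 0ℤ
  form-farˡ y {v} (inj₂ refl) = ℤ.+-inverseʳ (edges y far far)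
  form-farˡ y {v} (inj₁ (i≤ , _)) = cong₂ ℤ._-_
    (edges-zero y (beyond 2 ∘ sym ∘ cong proj₁) (beyond 1 ∘ sym ∘ cong proj₁) (beyond 2 ∘ sym ∘ cong proj₁) (beyond 0 ∘ suc-injective ∘ cong proj₁))
    (edges-zero y (beyond 0 ∘ suc-injective ∘ cong proj₁) (beyond 1 ∘ cong proj₁) (beyond 0 ∘ suc-injective ∘ cong proj₁) (beyond 2 ∘ sym ∘ cong proj₁))
    where
    beyond : ∀ d → proj₁ v ≢ d + (2 + n)
    beyond d eq = <-irrefl refl (≤-trans (≤-trans (m≤n+m (2 + n) d) (≤-reflexive (sym eq))) i≤)

  form-farʳ : ∀ y {u} → Near u → form y u far ≡ 0ℤ
  form-farʳ y {u} near = trans (form-skew y far u) (cong ℤ.-_ (form-farˡ y near))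

-- The flip of one diagonal of the polygon

module OneFlip (n : ℕ) (ps : List ℕ) (mirror : Bool) where

  open Polygon n ps mirror
  open Points n ps mirror
  open TriangleArrows n
  open SurfaceQuiver n
  open FarCoordinate n
  open Heights n using (height; surface-initial; surface-height; height-final; inStep-bounded; surface)

  -- The skew form of the quiver of the triangle with clockwise corners X, Y, Z.
  formOf : (X Y Z : ℕ) → Point → Point → ℤ
  formOf X Y Z p q = triangleForm (weight X p) (weight Y p) (weight Z p) (weight X q) (weight Y q) (weight Z q)

  triangle-zero : ∀ {px py pz qx qy qz} → px + py + pz ≢ suc n ⊎ qx + qy + qz ≢ suc n → triangle px py pz qx qy qz ≡ 0ℤ
  triangle-zero {px} {py} {pz} {qx} {qy} {qz} ¬in = cong₂ ℤ._+_ (cong₂ ℤ._+_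
    (⟦⟧-false (arrow? px py pz qx qy qz) (λ { (p , q , _) → none p q }))
    (⟦⟧-false (arrow? pz px py qz qx qy) (λ { (p , q , _) → none (trans (rotate px py pz) p) (trans (rotate qx qy qz) q) })))
    (⟦⟧-false (arrow? py pz px qy qz qx) (λ { (p , q , _) → none (trans (sym (rotate py pz px)) p) (trans (sym (rotate qy qz qx)) q) }))
    where
    none : px + py + pz ≡ suc n → qx + qy + qz ≡ suc n → ⊥
    none p q = [ (λ ¬p → ¬p p) , (λ ¬q → ¬q q) ]′ ¬in
    rotate : ∀ x y z → x + y + z ≡ z + x + y
    rotate = solve-∀

  formOf-zeroˡ : ∀ {X Y Z p} q → ¬ InTriangle X Y Z p → formOf X Y Z p q ≡ 0ℤ
  formOf-zeroˡ {X} {Y} {Z} {p} q p∉ = cong₂ ℤ._-_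
    (triangle-zero {weight X p} {weight Y p} {weight Z p} {weight X q} {weight Y q} {weight Z q} (inj₁ p∉))
    (triangle-zero {weight X q} {weight Y q} {weight Z q} {weight X p} {weight Y p} {weight Z p} (inj₂ p∉))

  formOf-skew : ∀ X Y Z p q → formOf X Y Z q p ≡ ℤ.- formOf X Y Z p q
  formOf-skew X Y Z p q = skew (triangle (weight X p) (weight Y p) (weight Z p) (weight X q) (weight Y q) (weight Z q)) (triangle (weight X q) (weight Y q) (weight Z q) (weight X p) (weight Y p) (weight Z p))
    where
    skew : ∀ a b → b ℤ.- a ≡ ℤ.- (a ℤ.- b)
    skew = ℤ-Solver.solve-∀

  formOf-zeroʳ : ∀ {X Y Z q} p → ¬ InTriangle X Y Z q → formOf X Y Z p q ≡ 0ℤ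
  formOf-zeroʳ {X} {Y} {Z} {q} p q∉ = trans (formOf-skew X Y Z q p) (cong ℤ.-_ (formOf-zeroˡ {X} {Y} {Z} {q} p q∉))

  located-unique : ∀ {g x x′ y r r′ s s′} → At g x y r s → At g x′ y r′ s′ → x ≡ x′ × r ≡ r′ × s ≡ s′
  located-unique {x = x} {x′} {y} {r} {r′} {s} {s′} U U′ = x≡ , r≡ , s≡
    where
    r≡ : r ≡ r′
    r≡ = +-cancelʳ-≡ y r r′ (trans (At.i≡ U) (sym (At.i≡ U′)))
    s≡ : s ≡ s′
    s≡ = +-cancelʳ-≡ y s s′ (trans (At.j≡ U) (sym (At.j≡ U′)))
    x≡ : x ≡ x′
    x≡ = +-cancelʳ-≡ y x x′ (+-cancelʳ-≡ (r + s) (x + y) (x′ + y) (trans (At.total U) (trans (sym (At.total U′)) (cong₂ (λ a b → x′ + y + (a + b)) (sym r≡) (sym s≡)))))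

  located-bounded : ∀ {g x y r s} → At g x y r s → proj₁ g ≤ suc n × proj₂ g ≤ suc n
  located-bounded {x = x} {y} {r} {s} (located refl refl t) =
    ≤-trans (m≤n+m (r + y) (x + s)) (≤-reflexive (trans (regroup₁ x y r s) t)) ,
    ≤-trans (m≤n+m (s + y) (x + r)) (≤-reflexive (trans (regroup₂ x y r s) t))
    where
    regroup₁ : ∀ x y r s → x + s + (r + y) ≡ x + y + (r + s)
    regroup₁ = solve-∀
    regroup₂ : ∀ x y r s → x + r + (s + y) ≡ x + y + (r + s)
    regroup₂ = solve-∀

  located-computed : ∀ {i j x y r s} → At (i , j) x y r s → suc n + y ∸ (i + j) ≡ x × i ∸ y ≡ r × j ∸ y ≡ s
  located-computed {x = x} {y} {r} {s} (located refl refl t) =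
    trans (cong (_∸ (r + y + (s + y))) (trans (cong (_+ y) (sym t)) (regroup x y r s))) (m+n∸n≡m x (r + y + (s + y))) ,
    m+n∸n≡m r y , m+n∸n≡m s y
    where
    regroup : ∀ x y r s → x + y + (r + s) + y ≡ x + (r + y + (s + y))
    regroup = solve-∀

  ^-distribʳ-* : ∀ k b c → (b * c) ^ k ≡ b ^ k * c ^ k
  ^-distribʳ-* zero    b c = refl
  ^-distribʳ-* (suc k) b c = trans (cong (b * c *_) (^-distribʳ-* k b c)) (interchange b c (b ^ k) (c ^ k))
    where
    interchange : ∀ a b c d → a * b * (c * d) ≡ a * c * (b * d)
    interchange = solve-∀

  -- Ptolemy's relation times a monomial. With the abbreviations below, q = u + w and pq = uv = tw,
  -- so the left side q(pq)^r splits into u(uv)^r + w(tw)^r.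
  octahedron : ∀ b c X Y S r →
    ((b * X) * (c * Y) * S) ^ r * (X * Y * ((b + c) * S)) ^ suc r ≡
    (X * (c * Y) * S) ^ suc r * ((b * X) * Y * ((b + c) * S)) ^ r + (X * (c * Y) * ((b + c) * S)) ^ r * ((b * X) * Y * S) ^ suc r
  octahedron b c X Y S r = begin
    p ^ r * (q * q ^ r)                                   ≡⟨ swap (p ^ r) q (q ^ r) ⟩
    q * (p ^ r * q ^ r)                                   ≡⟨ cong (q *_) (sym (^-distribʳ-* r p q)) ⟩
    q * (p * q) ^ r                                       ≡⟨ cong (_* (p * q) ^ r) (split b c X Y S) ⟩
    (u + w) * (p * q) ^ r                                 ≡⟨ *-distribʳ-+ ((p * q) ^ r) u w ⟩
    u * (p * q) ^ r + w * (p * q) ^ r                     ≡⟨ cong₂ (λ s t → u * s ^ r + w * t ^ r) (same₁ b c X Y S) (same₂ b c X Y S) ⟩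
    u * (u * v) ^ r + w * (t * w) ^ r                     ≡⟨ cong₂ (λ s t → u * s + w * t) (^-distribʳ-* r u v) (^-distribʳ-* r t w) ⟩
    u * (u ^ r * v ^ r) + w * (t ^ r * w ^ r)             ≡⟨ cong₂ _+_ (sym (*-assoc u (u ^ r) (v ^ r))) (sym (swap (t ^ r) w (w ^ r))) ⟩
    u * u ^ r * v ^ r + t ^ r * (w * w ^ r)               ∎
    where
    open ≡-Reasoning
    p q u v t w : ℕ
    p = (b * X) * (c * Y) * S
    q = X * Y * ((b + c) * S)
    u = X * (c * Y) * S
    v = (b * X) * Y * ((b + c) * S)
    t = X * (c * Y) * ((b + c) * S)
    w = (b * X) * Y * S
    swap : ∀ a b c → a * (b * c) ≡ b * (a * c)
    swap = solve-∀
    split : ∀ b c X Y S → X * Y * ((b + c) * S) ≡ X * (c * Y) * S + (b * X) * Y * S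
    split = solve-∀
    same₁ : ∀ b c X Y S → ((b * X) * (c * Y) * S) * (X * Y * ((b + c) * S)) ≡ (X * (c * Y) * S) * ((b * X) * Y * ((b + c) * S))
    same₁ = solve-∀
    same₂ : ∀ b c X Y S → ((b * X) * (c * Y) * S) * (X * Y * ((b + c) * S)) ≡ (X * (c * Y) * ((b + c) * S)) * ((b * X) * Y * S)
    same₂ = solve-∀

  form-height₀ : ∀ {u v x y r s x′ y′ r′ s′} → At u x y r s → At v x′ y′ r′ s′ →
    y ≡ proj₁ u ⊓ proj₂ u → y′ ≡ proj₁ v ⊓ proj₂ v →
    triangleForm x r y x′ r′ y′ ℤ.+ triangleForm x y s x′ y′ s′ ≡ form (+_ ∘ height 0) u v
  form-height₀ {u} {v} U V y≡ y′≡ = trans (sym (form-initial U V y≡ y′≡)) (form-cong {initialHeight} {+_ ∘ height 0} (λ _ → refl) u v)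

  form-heightₙ : ∀ {u v x y r s x′ y′ r′ s′} → At u x y r s → At v x′ y′ r′ s′ →
    y ≡ proj₁ u + proj₂ u ∸ suc n → y′ ≡ proj₁ v + proj₂ v ∸ suc n →
    form (+_ ∘ height n) u v ≡ triangleForm x r s x′ r′ s′ ℤ.+ triangleForm r y s r′ y′ s′
  form-heightₙ {u} {v} U V y≡ y′≡ = trans
    -- The closed formula for `height n` holds only over the square. The form reads just the four
    -- corners of the rectangle spanned by u and v.
    (form-local {+_ ∘ height n} {finalHeight} u v (agree i≤ j≤) (agree i′≤ j′≤) (agree i′≤ j≤) (agree i≤ j′≤))
    (form-final U V y≡ y′≡)
    where
    i≤ = proj₁ (located-bounded U)
    j≤ = proj₂ (located-bounded U)
    i′≤ = proj₁ (located-bounded V)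
    j′≤ = proj₂ (located-bounded V)
    agree : ∀ {i j} → i ≤ suc n → j ≤ suc n → + height n (i , j) ≡ finalHeight (i , j)
    agree a b = cong +_ (height-final a b)

  foldl-upTo : ∀ {S : Set} (P : ℕ → S → Set) (f : S → ℕ → S) → (∀ {k s} → k < n → P k s → P (suc k) (f s k)) →
    ∀ {s} → P 0 s → P n (foldl f s (upTo n))
  foldl-upTo P f step p = go n 0 id (λ i → sym (+-identityʳ i)) (+-identityʳ n) p
    where
    go : ∀ d k (h : ℕ → ℕ) → (∀ i → h i ≡ i + k) → d + k ≡ n → ∀ {s} → P k s → P n (foldl f s (List.applyUpTo h d))
    go zero    k h h≡ refl p = p
    go (suc d) k h h≡ eq p rewrite h≡ 0 = go d (suc k) (h ∘ suc) (λ i → trans (h≡ (suc i)) (sym (+-suc i k))) (trans (+-suc d k) eq)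
      (step (≤-trans (s≤s (m≤n+m k d)) (≤-reflexive eq)) p)

  -- `displacement` carries the information for the other triangles: a vertex that moved had weight
  -- at X and at Y, now has weight at A, and has none outside the quadrilateral. `surjective` covers
  -- X A S, the new triangle that the next flip uses.
  record Flipped (X Y S : ℕ) (σ : Bool) (g : ℕ → ℕ) (pos : Fin K → Point) (rest : Fin K → Fin K → ℤ) (st : State) : Set where
    field
      values       : ∀ v → var (seed st) v at𝟙≡ Values.value g (position st v)
      arrows≡      : PositivePartOf (λ u v → rest u v ℤ.+ signed σ (formOf X A S (position st u) (position st v) ℤ.+ formOf A Y S (position st u) (position st v))) (arrows (seed st))
      totals       : ∀ v → total (position st v) ≡ suc n
      injective    : ∀ {u v} → position st u ≡ position st v → u ≡ v
      kept         : ∀ {w} v → w ≢ X → w ≢ Y → w ≢ A → w ≢ S → weight w (position st v) ≡ weight w (pos v)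
      displacement : ∀ v → position st v ≡ pos v ⊎
        (1 ≤ weight X (pos v) × 1 ≤ weight Y (pos v) × 1 ≤ weight A (position st v) × (∀ {w} → w ≢ X → w ≢ Y → w ≢ A → w ≢ S → weight w (position st v) ≡ 0))
      surjective   : ∀ p → total p ≡ suc n → InTriangle X A S p → (∀ w → weight w p ≤ n) → ∃ λ v → position st v ≡ p

  -- The roles are R = A and S the newest vertex. The condition on `g S` is Ptolemy's relation in X
  -- A Y S, where X Y, X S and Y S have length 1; `fresh` says that all vertices start on the
  -- initial surface.
  module Flipping {X Y S : ℕ} (Q : Quadrilateral X Y A S) (σ : Bool)
    (g : ℕ → ℕ) (g≥1 : ∀ v → 1 ≤ g v) (gA : g A ≡ 1) (gS : g S ≡ g X + g Y)
    (seed₀ : Seed K) (pos : Fin K → Point)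
    (pos-total : ∀ v → total (pos v) ≡ suc n)
    (pos-injective : ∀ {u v} → pos u ≡ pos v → u ≡ v)
    (fresh : ∀ v → weight A (pos v) ≡ 0 ⊎ weight S (pos v) ≡ 0)
    (pos-surjective : ∀ p → total p ≡ suc n → InTriangle X A Y p ⊎ InTriangle X Y S p → (∀ w → weight w p ≤ n) → ∃ λ v → pos v ≡ p)
    (values₀ : ∀ v → var seed₀ v at𝟙≡ Values.value g (pos v))
    (rest : Fin K → Fin K → ℤ) (rest-skew : Skew rest)
    (rest-zero : ∀ p → 1 ≤ weight X (pos p) → 1 ≤ weight Y (pos p) → ∀ v → rest p v ≡ 0ℤ)
    (arrows₀ : PositivePartOf (λ u v → rest u v ℤ.+ signed σ (formOf X A Y (pos u) (pos v) ℤ.+ formOf X Y S (pos u) (pos v))) (arrows seed₀))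
    where

    open Values g
    open Quadrilateral Q
    open Flip X Y A S

    inQ⇒Inside : ∀ {v} → InQuadrilateral (pos v) → Inside Q (suc n) (pos v)
    inQ⇒Inside {v} q = q , pos-total v

    κ : Fin K → Coord
    κ v = if does (inQuadrilateral? (pos v)) then coordinates (pos v) else far

    κ-inside : ∀ {v} → InQuadrilateral (pos v) → κ v ≡ coordinates (pos v)
    κ-inside {v} q = cong (if_then coordinates (pos v) else far) (dec-true (inQuadrilateral? (pos v)) q)

    κ-outside : ∀ {v} → ¬ InQuadrilateral (pos v) → κ v ≡ far
    κ-outside {v} ¬q = cong (if_then coordinates (pos v) else far) (dec-false (inQuadrilateral? (pos v)) ¬q)

    inQ-located : ∀ {p} → InQuadrilateral p → At (coordinates p) (weight X p) (weight Y p) (weight A p) (weight S p)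
    inQ-located {p} q = located refl refl (trans (regroup (weight X p) (weight Y p) (weight A p) (weight S p)) q)
      where
      regroup : ∀ x y r s → x + y + (r + s) ≡ x + y + r + s
      regroup = solve-∀

    κ-located : ∀ {v} → InQuadrilateral (pos v) → At (κ v) (weight X (pos v)) (weight Y (pos v)) (weight A (pos v)) (weight S (pos v))
    κ-located {v} q = subst (λ k → At k (weight X (pos v)) (weight Y (pos v)) (weight A (pos v)) (weight S (pos v))) (sym (κ-inside q)) (inQ-located {pos v} q)

    κ-near : ∀ v → Near (κ v)
    κ-near v = by (inQuadrilateral? (pos v))
      where
      by : Dec (InQuadrilateral (pos v)) → Near (κ v)
      by (yes q) = inj₁ (located-bounded {κ v} (κ-located q))
      by (no ¬q) = inj₂ (κ-outside ¬q)

    inQ-bounded : ∀ {v} → proj₁ (κ v) ≤ suc n → InQuadrilateral (pos v)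
    inQ-bounded {v} i≤ = by (inQuadrilateral? (pos v))
      where
      by : Dec (InQuadrilateral (pos v)) → InQuadrilateral (pos v)
      by (yes q) = q
      by (no ¬q) = contradiction (≤-trans (n≤1+n (2 + n)) (subst (λ k → proj₁ k ≤ suc n) (κ-outside ¬q) i≤)) (<-irrefl refl)

    initial-height : ∀ v → weight Y (pos v) ≡ proj₁ (coordinates (pos v)) ⊓ proj₂ (coordinates (pos v))
    initial-height v = by (weight A (pos v)) (weight S (pos v)) (fresh v)
      where
      y : ℕ
      y = weight Y (pos v)
      by : ∀ r s → r ≡ 0 ⊎ s ≡ 0 → y ≡ (r + y) ⊓ (s + y)
      by r s (inj₁ refl) = sym (m≤n⇒m⊓n≡m (m≤n+m y s))
      by r s (inj₂ refl) = sym (m≥n⇒m⊓n≡n (m≤n+m y r))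

    initial-heightκ : ∀ {v} → InQuadrilateral (pos v) → weight Y (pos v) ≡ proj₁ (κ v) ⊓ proj₂ (κ v)
    initial-heightκ {v} q = trans (initial-height v) (cong (λ k → proj₁ k ⊓ proj₂ k) (sym (κ-inside q)))

    -- By `fresh` the coordinates determine the height as `i ⊓ j`, and coordinates and height
    -- determine all four weights.
    κ-injective : ∀ {u v} → proj₁ (κ u) ≤ suc n → proj₂ (κ u) ≤ suc n → κ u ≡ κ v → u ≡ v
    κ-injective {u} {v} i≤ _ eq = pos-injective (inside-ext Q (inQ⇒Inside qᵤ) (inQ⇒Inside qᵥ) x≡ y≡ r≡ s≡)
      where
      qᵤ : InQuadrilateral (pos u)
      qᵤ = inQ-bounded i≤
      qᵥ : InQuadrilateral (pos v)
      qᵥ = inQ-bounded (subst (λ k → proj₁ k ≤ suc n) eq i≤)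
      y≡ : weight Y (pos u) ≡ weight Y (pos v)
      y≡ = trans (initial-heightκ qᵤ) (trans (cong (λ k → proj₁ k ⊓ proj₂ k) eq) (sym (initial-heightκ qᵥ)))
      others : weight X (pos u) ≡ weight X (pos v) × weight A (pos u) ≡ weight A (pos v) × weight S (pos u) ≡ weight S (pos v)
      others = located-unique (subst (λ y → At (κ u) (weight X (pos u)) y (weight A (pos u)) (weight S (pos u))) y≡ (κ-located qᵤ))
        (subst (λ k → At k (weight X (pos v)) (weight Y (pos v)) (weight A (pos v)) (weight S (pos v))) (sym eq) (κ-located qᵥ))
      x≡ = proj₁ others
      r≡ = proj₁ (proj₂ others)
      s≡ = proj₂ (proj₂ others)

    quad-InQ : ∀ {g x y r s} → At g x y r s → InQuadrilateral (quad X Y A S x y r s) × total (quad X Y A S x y r s) ≡ suc n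
    quad-InQ {x = x} {y} {r} {s} U = trans (proj₁ (quad-inside Q x y r s)) eq , trans (proj₂ (quad-inside Q x y r s)) eq
      where
      eq : x + y + r + s ≡ suc n
      eq = trans (+-assoc (x + y) r s) (At.total U)

    coordinates-quad : ∀ {g x y r s} → At g x y r s → coordinates (quad X Y A S x y r s) ≡ g
    coordinates-quad {x = x} {y} {r} {s} U = cong₂ _,_
      (trans (cong₂ _+_ (quad-R Q x y r s) (quad-Y Q x y r s)) (At.i≡ U))
      (trans (cong₂ _+_ (quad-S Q x y r s) (quad-Y Q x y r s)) (At.j≡ U))

    -- The point of the initial surface over (i , j) lies in X A Y or X Y S. `bounds` says that it
    -- is not a corner, since corners are not quiver vertices.
    vertexAt : ∀ {i j} → i ≤ suc n → j ≤ suc n → (∀ {x r s} → At (i , j) x (i ⊓ j) r s → x ≤ n × i ⊓ j ≤ n × r ≤ n × s ≤ n) → ∃ λ v → κ v ≡ (i , j) × InQuadrilateral (pos v)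
    vertexAt {i} {j} i≤ j≤ bounds with surface-initial i≤ j≤
    ... | surface {x} {r} {s} i≡ j≡ total≡ _ _ = proj₁ vertex , trans (κ-inside inQ) (trans (cong coordinates (proj₂ vertex)) (coordinates-quad U)) , inQ
      where
      y : ℕ
      y = i ⊓ j
      U : At (i , j) x y r s
      U = located i≡ j≡ total≡
      p : Point
      p = quad X Y A S x y r s
      small : ∀ w → weight w p ≤ n
      small w with corner⊎other Q w | bounds U
      ... | inj₁ (here refl)                         | x≤ , _  , _  , _  = ≤-trans (≤-reflexive (quad-X Q x y r s)) x≤
      ... | inj₁ (there (here refl))                 | _  , y≤ , _  , _  = ≤-trans (≤-reflexive (quad-Y Q x y r s)) y≤
      ... | inj₁ (there (there (here refl)))         | _  , _  , r≤ , _  = ≤-trans (≤-reflexive (quad-R Q x y r s)) r≤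
      ... | inj₁ (there (there (there (here refl)))) | _  , _  , _  , s≤ = ≤-trans (≤-reflexive (quad-S Q x y r s)) s≤
      ... | inj₂ w#                                  | _ = ≤-trans (≤-reflexive (quad-other Q x y r s w#)) z≤n
      side : r ≡ 0 ⊎ s ≡ 0 → InTriangle X A Y p ⊎ InTriangle X Y S p
      side (inj₁ r0) = inj₂ (trans (cong₂ _+_ (cong₂ _+_ (quad-X Q x y r s) (quad-Y Q x y r s)) (quad-S Q x y r s)) (trans (sym (cong (λ t → x + y + (t + s)) r0)) total≡))
      side (inj₂ s0) = inj₁ (trans (cong₂ _+_ (cong₂ _+_ (quad-X Q x y r s) (quad-R Q x y r s)) (quad-Y Q x y r s)) (trans (trans (regroup x y r) (cong (λ t → x + y + (r + t)) (sym s0))) total≡))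
        where
        regroup : ∀ x y r → x + r + y ≡ x + y + (r + 0)
        regroup = solve-∀
      vertex : ∃ λ v → pos v ≡ p
      vertex = pos-surjective p (proj₂ (quad-InQ U)) (side (r⊎s-zero U refl)) small
      inQ : InQuadrilateral (pos (proj₁ vertex))
      inQ = subst InQuadrilateral (sym (proj₂ vertex)) (proj₁ (quad-InQ U))

    κ-surjective : ∀ {i j} → i ≤ suc n → j ≤ suc n → Inner i ⊎ Inner j → ∃ λ v → κ v ≡ (i , j)
    κ-surjective {i} {j} i≤ j≤ inner = let v , eq , _ = vertexAt i≤ j≤ bounds in v , eq
      where
      below : ∀ {a b c} → a + b + c ≡ suc n → 1 ≤ b → a ≤ n
      below {a} {b} {c} eq b≥1 = ≤-pred (≤-trans (≤-trans (≤-reflexive (+-comm 1 a)) (≤-trans (+-monoʳ-≤ a b≥1) (m≤m+n (a + b) c))) (≤-reflexive eq))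
      bounds : ∀ {x r s} → At (i , j) x (i ⊓ j) r s → x ≤ n × i ⊓ j ≤ n × r ≤ n × s ≤ n
      bounds {x} {r} {s} U = by inner
        where
        y : ℕ
        y = i ⊓ j
        regroup₁ : ∀ x y r s → x + (r + y) + s ≡ x + y + (r + s)
        regroup₁ = solve-∀
        regroup₂ : ∀ x y r s → x + (s + y) + r ≡ x + y + (r + s)
        regroup₂ = solve-∀
        regroup₃ : ∀ x y r s → s + (r + y) + x ≡ x + y + (r + s)
        regroup₃ = solve-∀
        regroup₄ : ∀ x y r s → r + (s + y) + x ≡ x + y + (r + s)
        regroup₄ = solve-∀
        by : Inner i ⊎ Inner j → x ≤ n × y ≤ n × r ≤ n × s ≤ n
        by (inj₁ (i≥1 , i≤n)) = below (trans (regroup₁ x y r s) (At.total U)) (≤-trans i≥1 (≤-reflexive (sym (At.i≡ U)))) ,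
          ≤-trans (m⊓n≤m i j) i≤n , ≤-trans (≤-trans (m≤m+n r y) (≤-reflexive (At.i≡ U))) i≤n ,
          below (trans (regroup₃ x y r s) (At.total U)) (≤-trans i≥1 (≤-reflexive (sym (At.i≡ U))))
        by (inj₂ (j≥1 , j≤n)) = below (trans (regroup₂ x y r s) (At.total U)) (≤-trans j≥1 (≤-reflexive (sym (At.j≡ U)))) ,
          ≤-trans (m⊓n≤n i j) j≤n , below (trans (regroup₄ x y r s) (At.total U)) (≤-trans j≥1 (≤-reflexive (sym (At.j≡ U)))) ,
          ≤-trans (≤-trans (m≤m+n s y) (≤-reflexive (At.j≡ U))) j≤n

    value-positive : ∀ p → 1 ≤ value p
    value-positive p = ^-positive (monomial-positive g≥1 p) (weight A p)
      where
      ^-positive : ∀ {b} → 1 ≤ b → ∀ k → 1 ≤ b ^ k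
      ^-positive b≥1 zero    = ≤-refl
      ^-positive b≥1 (suc k) = *-mono-≤ b≥1 (^-positive b≥1 k)

    valueAt : Coord → ℕ → ℕ
    valueAt (i , j) h = value (quad X Y A S (suc n + h ∸ (i + j)) h (i ∸ h) (j ∸ h))

    val : Fin K → ℕ → ℕ
    val v h = if does (inQuadrilateral? (pos v)) then valueAt (κ v) h else value (pos v)

    val-inside : ∀ {v} h → InQuadrilateral (pos v) → val v h ≡ valueAt (κ v) h
    val-inside {v} h q = cong (if_then valueAt (κ v) h else value (pos v)) (dec-true (inQuadrilateral? (pos v)) q)

    val-outside : ∀ {v} h → ¬ InQuadrilateral (pos v) → val v h ≡ value (pos v)
    val-outside {v} h ¬q = cong (if_then valueAt (κ v) h else value (pos v)) (dec-false (inQuadrilateral? (pos v)) ¬q)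

    val-positive : ∀ v h → 1 ≤ val v h
    val-positive v h = by (inQuadrilateral? (pos v))
      where
      by : Dec (InQuadrilateral (pos v)) → 1 ≤ val v h
      by (yes q) = ≤-trans (value-positive (quad X Y A S (suc n + h ∸ (proj₁ (κ v) + proj₂ (κ v))) h (proj₁ (κ v) ∸ h) (proj₂ (κ v) ∸ h))) (≤-reflexive (sym (val-inside h q)))
      by (no ¬q) = ≤-trans (value-positive (pos v)) (≤-reflexive (sym (val-outside h ¬q)))

    valueAt-quad : ∀ {k x y r s} → At k x y r s → valueAt k y ≡ value (quad X Y A S x y r s)
    valueAt-quad {i , j} {x} {y} {r} {s} U with x≡ , r≡ , s≡ ← located-computed U =
      trans (cong (λ t → value (quad X Y A S t y (i ∸ y) (j ∸ y))) x≡) (cong₂ (λ t u → value (quad X Y A S x y t u)) r≡ s≡)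

    value-quad : ∀ x y r s → value (quad X Y A S x y r s) ≡ (g X ^ x * g Y ^ y * g S ^ s) ^ r
    value-quad x y r s = cong₂ _^_ (trans (monomial-quad Q x y r s) (cong (_* g S ^ s) (trans (cong (g X ^ x * g Y ^ y *_) (trans (cong (_^ r) gA) (^-zeroˡ r))) (*-identityʳ (g X ^ x * g Y ^ y))))) (quad-R Q x y r s)

    val-located : ∀ {v k} x y r s → At k x y r s → κ v ≡ k → val v y ≡ (g X ^ x * g Y ^ y * g S ^ s) ^ r
    val-located {v} {k} x y r s U κv = trans (val-inside y (inQ-bounded (subst (λ k → proj₁ k ≤ suc n) (sym κv) (proj₁ (located-bounded U)))))
      (trans (cong (λ k → valueAt k y) κv) (trans (valueAt-quad U) (value-quad x y r s)))

    -- The old and new positions of the peak and its four neighbours are the vertices of a lattice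
    -- octahedron in the tetrahedron. The three products are those of its opposite pairs.
    exchange : ∀ {p e w nn ss} x h r s → suc (suc (x + h + (r + s))) ≡ suc n →
      κ p ≡ (suc (r + h) , suc (s + h)) → κ e ≡ (suc (suc (r + h)) , suc (s + h)) → κ w ≡ (r + h , suc (s + h)) →
      κ nn ≡ (suc (r + h) , suc (suc (s + h))) → κ ss ≡ (suc (r + h) , s + h) →
      val p (suc h) * val p h ≡ val e (suc h) * val w h + val nn (suc h) * val ss h
    exchange {p} {e} {w} {nn} {ss} x h r s t κp κe κw κn κs = begin
      val p (suc h) * val p h
        ≡⟨ cong₂ _*_ (val-located (suc x) (suc h) r s (located (+-suc r h) (+-suc s h) (trans (regroup₁ x h r s) t)) κp) (val-located x h (suc r) (suc s) (located refl refl (trans (regroup₂ x h r s) t)) κp) ⟩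
      ((g X * X^x) * (g Y * Y^h) * S^s) ^ r * (X^x * Y^h * (g S * S^s)) ^ suc r
        ≡⟨ cong (λ t → ((g X * X^x) * (g Y * Y^h) * S^s) ^ r * (X^x * Y^h * (t * S^s)) ^ suc r) gS ⟩
      ((g X * X^x) * (g Y * Y^h) * S^s) ^ r * (X^x * Y^h * ((g X + g Y) * S^s)) ^ suc r
        ≡⟨ octahedron (g X) (g Y) X^x Y^h S^s r ⟩
      (X^x * (g Y * Y^h) * S^s) ^ suc r * ((g X * X^x) * Y^h * ((g X + g Y) * S^s)) ^ r + (X^x * (g Y * Y^h) * ((g X + g Y) * S^s)) ^ r * ((g X * X^x) * Y^h * S^s) ^ suc r
        ≡⟨ cong (λ t → (X^x * (g Y * Y^h) * S^s) ^ suc r * ((g X * X^x) * Y^h * (t * S^s)) ^ r + (X^x * (g Y * Y^h) * (t * S^s)) ^ r * ((g X * X^x) * Y^h * S^s) ^ suc r) gS ⟨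
      (X^x * (g Y * Y^h) * S^s) ^ suc r * ((g X * X^x) * Y^h * (g S * S^s)) ^ r + (X^x * (g Y * Y^h) * (g S * S^s)) ^ r * ((g X * X^x) * Y^h * S^s) ^ suc r
        ≡⟨ cong₂ _+_
             (cong₂ _*_ (val-located x (suc h) (suc r) s (located (cong suc (+-suc r h)) (+-suc s h) (trans (regroup₃ x h r s) t)) κe) (val-located (suc x) h r (suc s) (located refl refl (trans (regroup₄ x h r s) t)) κw))
             (cong₂ _*_ (val-located x (suc h) r (suc s) (located (+-suc r h) (cong suc (+-suc s h)) (trans (regroup₅ x h r s) t)) κn) (val-located (suc x) h (suc r) s (located refl refl (trans (regroup₆ x h r s) t)) κs)) ⟨
      val e (suc h) * val w h + val nn (suc h) * val ss h ∎
      where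
      open ≡-Reasoning
      X^x Y^h S^s : ℕ
      X^x = g X ^ x
      Y^h = g Y ^ h
      S^s = g S ^ s
      regroup₁ : ∀ x h r s → suc x + suc h + (r + s) ≡ suc (suc (x + h + (r + s)))
      regroup₁ = solve-∀
      regroup₂ : ∀ x h r s → x + h + (suc r + suc s) ≡ suc (suc (x + h + (r + s)))
      regroup₂ = solve-∀
      regroup₃ : ∀ x h r s → x + suc h + (suc r + s) ≡ suc (suc (x + h + (r + s)))
      regroup₃ = solve-∀
      regroup₄ : ∀ x h r s → suc x + h + (r + suc s) ≡ suc (suc (x + h + (r + s)))
      regroup₄ = solve-∀
      regroup₅ : ∀ x h r s → x + suc h + (r + suc s) ≡ suc (suc (x + h + (r + s)))
      regroup₅ = solve-∀
      regroup₆ : ∀ x h r s → suc x + h + (suc r + s) ≡ suc (suc (x + h + (r + s)))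
      regroup₆ = solve-∀

    -- A point of the initial surface over the interior of the square has weight at both X and Y:
    -- its height is positive, and x+r, x+s are positive while r or s is 0.
    rest-zero′ : ∀ p → Interior (κ p) → ∀ v → rest p v ≡ 0ℤ
    rest-zero′ p (i-inner , j-inner) = rest-zero p x≥1 y≥1
      where
      q : InQuadrilateral (pos p)
      q = inQ-bounded (m≤n⇒m≤1+n (proj₂ i-inner))
      x≥1 : 1 ≤ weight X (pos p)
      x≥1 = by (weight A (pos p)) (weight S (pos p)) (fresh p) (proj₂ (inner⇒ (κ-located q) j-inner)) (proj₂ (inner⇒ (transpose (κ-located q)) i-inner))
        where
        by : ∀ r s → r ≡ 0 ⊎ s ≡ 0 → 1 ≤ weight X (pos p) + r → 1 ≤ weight X (pos p) + s → 1 ≤ weight X (pos p)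
        by r s (inj₁ refl) le _ = ≤-trans le (≤-reflexive (+-identityʳ _))
        by r s (inj₂ refl) _ le = ≤-trans le (≤-reflexive (+-identityʳ _))
      y≥1 : 1 ≤ weight Y (pos p)
      y≥1 = ≤-trans (⊓-glb (proj₁ i-inner) (proj₁ j-inner)) (≤-reflexive (sym (initial-heightκ q)))

    open FlipSteps n κ κ-injective κ-surjective rest rest-skew rest-zero′ σ val val-positive exchange

    fourth-zero : ∀ {P₁ P₂ P₃ P₄ p} → P₁ ≢ P₂ → P₁ ≢ P₃ → P₂ ≢ P₃ → P₄ ≢ P₁ → P₄ ≢ P₂ → P₄ ≢ P₃ → total p ≡ suc n →
      InTriangle P₁ P₂ P₃ p → weight P₁ p + weight P₂ p + weight P₃ p + weight P₄ p ≡ suc n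
    fourth-zero {p = p} a b c d e f t tri = trans (cong (_+_ _) (triangle-other {p = p} a b c t tri d e f)) (trans (+-identityʳ _) tri)

    triangles-inQ : ∀ {p} → total p ≡ suc n → InTriangle X A Y p ⊎ InTriangle X Y S p ⊎ InTriangle X A S p ⊎ InTriangle A Y S p → InQuadrilateral p
    triangles-inQ {p} t = λ
      { (inj₁ i)               → trans (regroup₁ (weight X p) (weight Y p) (weight A p) (weight S p)) (fourth-zero {X} {A} {Y} {S} {p} X≢R X≢Y (Y≢R ∘ sym) (X≢S ∘ sym) (R≢S ∘ sym) (Y≢S ∘ sym) t i)
      ; (inj₂ (inj₁ i))        → trans (regroup₂ (weight X p) (weight Y p) (weight A p) (weight S p)) (fourth-zero {X} {Y} {S} {A} {p} X≢Y X≢S Y≢S (X≢R ∘ sym) (Y≢R ∘ sym) R≢S t i)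
      ; (inj₂ (inj₂ (inj₁ i))) → trans (regroup₃ (weight X p) (weight Y p) (weight A p) (weight S p)) (fourth-zero {X} {A} {S} {Y} {p} X≢R X≢S R≢S (X≢Y ∘ sym) Y≢R Y≢S t i)
      ; (inj₂ (inj₂ (inj₂ i))) → trans (regroup₄ (weight X p) (weight Y p) (weight A p) (weight S p)) (fourth-zero {A} {Y} {S} {X} {p} (Y≢R ∘ sym) R≢S Y≢S X≢R X≢Y X≢S t i) }
      where
      regroup₁ : ∀ x y r s → x + y + r + s ≡ x + r + y + s
      regroup₁ = solve-∀
      regroup₂ : ∀ x y r s → x + y + r + s ≡ x + y + s + r
      regroup₂ = solve-∀
      regroup₃ : ∀ x y r s → x + y + r + s ≡ x + r + s + y
      regroup₃ = solve-∀
      regroup₄ : ∀ x y r s → x + y + r + s ≡ r + y + s + x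
      regroup₄ = solve-∀

    position′ : Fin K → Point
    position′ v = move (pos v)

    move-inside : ∀ {p} → InQuadrilateral p → move p ≡ newPoint (coordinates p)
    move-inside {p} q = cong (if_then newPoint (coordinates p) else p) (dec-true (inQuadrilateral? p) q)

    move-outside : ∀ {p} → ¬ InQuadrilateral p → move p ≡ p
    move-outside {p} ¬q = cong (if_then newPoint (coordinates p) else p) (dec-false (inQuadrilateral? p) ¬q)

    final-located : ∀ {i j} → i ≤ suc n → j ≤ suc n → ∃ λ x → ∃ λ r → ∃ λ s → At (i , j) x (i + j ∸ suc n) r s
    final-located {i} {j} i≤ j≤ with height n (i , j) | height-final i≤ j≤ | surface-height {n} ≤-refl i≤ j≤
    ... | _ | refl | surface {x} {r} {s} i≡ j≡ t _ _ = x , r , s , located i≡ j≡ t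

    newPoint-quad : ∀ {i j x y r s} → At (i , j) x y r s → y ≡ i + j ∸ suc n → newPoint (i , j) ≡ quad X Y A S x y r s
    newPoint-quad {i} {j} {x} {y} {r} {s} U y≡ = quad-cong x≡ (sym y≡)
      (trans (cong (i ∸_) (sym y≡)) (proj₁ (proj₂ (located-computed U)))) (trans (cong (j ∸_) (sym y≡)) (proj₂ (proj₂ (located-computed U))))
      where
      quad-cong : ∀ {x x′ y y′ r r′ s s′} → x ≡ x′ → y ≡ y′ → r ≡ r′ → s ≡ s′ → quad X Y A S x y r s ≡ quad X Y A S x′ y′ r′ s′
      quad-cong refl refl refl refl = refl
      -- `newPoint` computes the X-weight by truncated subtraction as x ∸ y, which is x on the final
      -- surface.
      keep : x ≡ 0 ⊎ y ≡ 0 → x ∸ y ≡ x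
      keep (inj₁ x0) = trans (cong (_∸ y) x0) (trans (0∸n≡0 y) (sym x0))
      keep (inj₂ y0) = cong (x ∸_) y0
      x≡ : suc n ∸ (i + j) ≡ x
      x≡ = trans (cong₂ _∸_ (N≡ U) (i+j≡ U)) (trans ([m+n]∸[m+o]≡n∸o (y + (r + s)) x y) (keep (x⊎y-zero U y≡)))

    final-quad : ∀ {v} → InQuadrilateral (pos v) → ∃ λ x → ∃ λ r → ∃ λ s → At (κ v) x (proj₁ (κ v) + proj₂ (κ v) ∸ suc n) r s ×
      position′ v ≡ quad X Y A S x (proj₁ (κ v) + proj₂ (κ v) ∸ suc n) r s
    final-quad {v} q = let x , r , s , U = final-located (proj₁ (located-bounded (κ-located q))) (proj₂ (located-bounded (κ-located q))) in
      x , r , s , U , trans (move-inside {pos v} q) (trans (cong newPoint (sym (κ-inside q))) (newPoint-quad U refl))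

    final-inQ : ∀ {v} → InQuadrilateral (pos v) → InQuadrilateral (position′ v) × total (position′ v) ≡ suc n ×
      coordinates (position′ v) ≡ κ v × weight Y (position′ v) ≡ proj₁ (κ v) + proj₂ (κ v) ∸ suc n
    final-inQ {v} q = let x , r , s , U , eq = final-quad q in
      subst (λ p → InQuadrilateral p × total p ≡ suc n × coordinates p ≡ κ v × weight Y p ≡ proj₁ (κ v) + proj₂ (κ v) ∸ suc n) (sym eq)
        (proj₁ (quad-InQ U) , proj₂ (quad-InQ U) , coordinates-quad U , quad-Y Q x (proj₁ (κ v) + proj₂ (κ v) ∸ suc n) r s)

    -- With x = 0 or y = 0 the point already lies on the final surface.
    newPoint-fixed : ∀ {p} → InQuadrilateral p → total p ≡ suc n → weight X p ≡ 0 ⊎ weight Y p ≡ 0 → newPoint (coordinates p) ≡ p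
    newPoint-fixed {p} q t z = trans (newPoint-quad (inQ-located {p} q) y≡) (inside-ext Q (quad-InQ (inQ-located {p} q)) (q , t)
        (quad-X Q (weight X p) (weight Y p) (weight A p) (weight S p)) (quad-Y Q (weight X p) (weight Y p) (weight A p) (weight S p))
        (quad-R Q (weight X p) (weight Y p) (weight A p) (weight S p)) (quad-S Q (weight X p) (weight Y p) (weight A p) (weight S p)))
      where
      U : At (coordinates p) (weight X p) (weight Y p) (weight A p) (weight S p)
      U = inQ-located {p} q
      keep : weight X p ≡ 0 ⊎ weight Y p ≡ 0 → weight Y p ≡ weight Y p ∸ weight X p
      keep (inj₁ x0) = cong (weight Y p ∸_) (sym x0)
      keep (inj₂ y0) = trans y0 (sym (trans (cong (_∸ weight X p) y0) (0∸n≡0 (weight X p))))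
      y≡ : weight Y p ≡ proj₁ (coordinates p) + proj₂ (coordinates p) ∸ suc n
      y≡ = trans (keep z) (sym (trans (cong₂ _∸_ (i+j≡ U) (N≡ U)) ([m+n]∸[m+o]≡n∸o (weight Y p + (weight A p + weight S p)) (weight Y p) (weight X p))))

    unmoved : ∀ v → weight X (pos v) ≡ 0 ⊎ weight Y (pos v) ≡ 0 → position′ v ≡ pos v
    unmoved v z = by (inQuadrilateral? (pos v))
      where
      by : Dec (InQuadrilateral (pos v)) → position′ v ≡ pos v
      by (yes q) = trans (move-inside {pos v} q) (newPoint-fixed q (pos-total v) z)
      by (no ¬q) = move-outside {pos v} ¬q

    displaced : ∀ v → position′ v ≡ pos v ⊎
      (1 ≤ weight X (pos v) × 1 ≤ weight Y (pos v) × 1 ≤ weight A (position′ v) × (∀ {w} → w ≢ X → w ≢ Y → w ≢ A → w ≢ S → weight w (position′ v) ≡ 0))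
    displaced v = by (inQuadrilateral? (pos v)) (positive⊎zero (weight X p) (weight Y p))
      where
      p : Point
      p = pos v
      -- The height falls from y to y ∸ x, while the coordinate i, the sum of the weights of A and
      -- Y, is kept; what Y loses goes to A.
      gained : InQuadrilateral p → 1 ≤ weight X p → 1 ≤ weight Y p → 1 ≤ weight A (position′ v)
      gained q x≥1 y≥1 = +-cancelʳ-≤ (weight Y (position′ v)) 1 (weight A (position′ v))
        (≤-trans (s≤s (≤-reflexive (trans y′≡ y≡)))
          (≤-trans (lower x≥1 y≥1) (≤-trans (m≤n+m (weight Y p) (weight A p)) (≤-reflexive (trans (cong proj₁ (sym (κ-inside q))) (cong proj₁ (sym coords)))))))
        where
        coords : coordinates (position′ v) ≡ κ v
        coords = proj₁ (proj₂ (proj₂ (final-inQ q)))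
        y′≡ : weight Y (position′ v) ≡ proj₁ (κ v) + proj₂ (κ v) ∸ suc n
        y′≡ = proj₂ (proj₂ (proj₂ (final-inQ q)))
        U : At (κ v) (weight X p) (weight Y p) (weight A p) (weight S p)
        U = κ-located q
        y≡ : proj₁ (κ v) + proj₂ (κ v) ∸ suc n ≡ weight Y p ∸ weight X p
        y≡ = trans (cong₂ _∸_ (i+j≡ U) (N≡ U)) ([m+n]∸[m+o]≡n∸o (weight Y p + (weight A p + weight S p)) (weight Y p) (weight X p))
        lower : ∀ {x y} → 1 ≤ x → 1 ≤ y → suc (y ∸ x) ≤ y
        lower {suc x} {suc y} _ _ = s≤s (m∸n≤m y x)
      by : Dec (InQuadrilateral p) → (1 ≤ weight X p × 1 ≤ weight Y p) ⊎ (weight X p ≡ 0 ⊎ weight Y p ≡ 0) →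
        position′ v ≡ p ⊎ (1 ≤ weight X p × 1 ≤ weight Y p × 1 ≤ weight A (position′ v) × (∀ {w} → w ≢ X → w ≢ Y → w ≢ A → w ≢ S → weight w (position′ v) ≡ 0))
      by _       (inj₂ z)           = inj₁ (unmoved v z)
      by (no ¬q) (inj₁ _)           = inj₁ (move-outside {pos v} ¬q)
      by (yes q) (inj₁ (x≥1 , y≥1)) = inj₂ (x≥1 , y≥1 , gained q x≥1 y≥1 ,
        λ w≢X w≢Y w≢A w≢S → inside-other Q {p = position′ v} (proj₁ (final-inQ q) , proj₁ (proj₂ (final-inQ q))) (w≢X ∷ w≢Y ∷ w≢A ∷ w≢S ∷ []))

    total′ : ∀ v → total (position′ v) ≡ suc n
    total′ v = by (inQuadrilateral? (pos v))
      where
      by : Dec (InQuadrilateral (pos v)) → total (position′ v) ≡ suc n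
      by (yes q) = proj₁ (proj₂ (final-inQ q))
      by (no ¬q) = trans (cong total (move-outside {pos v} ¬q)) (pos-total v)

    weight-kept : ∀ {w} v → All (w ≢_) (corners Q) → weight w (position′ v) ≡ weight w (pos v)
    weight-kept {w} v w# = by (inQuadrilateral? (pos v))
      where
      by : Dec (InQuadrilateral (pos v)) → weight w (position′ v) ≡ weight w (pos v)
      by (yes q) = trans (inside-other Q {p = position′ v} (proj₁ (final-inQ q) , proj₁ (proj₂ (final-inQ q))) w#) (sym (inside-other Q {p = pos v} (q , pos-total v) w#))
      by (no ¬q) = cong (weight w) (move-outside {pos v} ¬q)

    injective′ : ∀ {u v} → position′ u ≡ position′ v → u ≡ v
    injective′ {u} {v} eq = by (inQuadrilateral? (pos u)) (inQuadrilateral? (pos v))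
      where
      by : Dec (InQuadrilateral (pos u)) → Dec (InQuadrilateral (pos v)) → u ≡ v
      by (yes q) (yes q′) = κ-injective (proj₁ (located-bounded (κ-located q))) (proj₂ (located-bounded (κ-located q))) (trans (sym (proj₁ (proj₂ (proj₂ (final-inQ q))))) (trans (cong coordinates eq) (proj₁ (proj₂ (proj₂ (final-inQ q′))))))
      by (yes q) (no ¬q′) = contradiction (subst InQuadrilateral (trans eq (move-outside {pos v} ¬q′)) (proj₁ (final-inQ q))) ¬q′
      by (no ¬q) (yes q′) = contradiction (subst InQuadrilateral (trans (sym eq) (move-outside {pos u} ¬q)) (proj₁ (final-inQ q′))) ¬q
      by (no ¬q) (no ¬q′) = pos-injective (trans (sym (move-outside {pos u} ¬q)) (trans eq (move-outside {pos v} ¬q′)))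

    surjective′ : ∀ p → total p ≡ suc n → InTriangle X A S p → (∀ w → weight w p ≤ n) → ∃ λ v → position′ v ≡ p
    surjective′ p t tri small = v , trans (move-inside {pos v} inQ) (trans (cong newPoint (trans (sym (κ-inside inQ)) κv)) (newPoint-fixed q t (inj₂ y0)))
      where
      q : InQuadrilateral p
      q = triangles-inQ {p} t (inj₂ (inj₂ (inj₁ tri)))
      U : At (coordinates p) (weight X p) (weight Y p) (weight A p) (weight S p)
      U = inQ-located {p} q
      y0 : weight Y p ≡ 0
      y0 = y-zero U tri refl
      i≤n : proj₁ (coordinates p) ≤ n
      i≤n = ≤-trans (≤-reflexive (trans (cong (_+_ (weight A p)) y0) (+-identityʳ _))) (small A)
      j≤n : proj₂ (coordinates p) ≤ n
      j≤n = ≤-trans (≤-reflexive (trans (cong (_+_ (weight S p)) y0) (+-identityʳ _))) (small S)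
      bounds : ∀ {x r s} → At (coordinates p) x (proj₁ (coordinates p) ⊓ proj₂ (coordinates p)) r s → x ≤ n × proj₁ (coordinates p) ⊓ proj₂ (coordinates p) ≤ n × r ≤ n × s ≤ n
      bounds {x} {r} {s} V = ≤-pred (≰⇒> not-corner) , ≤-trans (m⊓n≤m _ _) i≤n , ≤-trans (m+n≤o⇒m≤o r (≤-reflexive (At.i≡ V))) i≤n , ≤-trans (m+n≤o⇒m≤o s (≤-reflexive (At.j≡ V))) j≤n
        where
        y : ℕ
        y = proj₁ (coordinates p) ⊓ proj₂ (coordinates p)
        -- If the initial point over these coordinates were the corner X, then i = j = 0, and p
        -- itself would be X, contrary to `small`.
        not-corner : ¬ suc n ≤ x
        not-corner x≥ = <-irrefl refl (≤-trans (≤-reflexive (trans (sym tri) (trans (cong₂ _+_ (trans (cong (_+_ (weight X p)) r0) (+-identityʳ _)) s0) (+-identityʳ _)))) (small X))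
          where
          rest0 : y + (r + s) ≡ 0
          rest0 = n≤0⇒n≡0 (+-cancelˡ-≤ x _ 0 (≤-trans (≤-reflexive (trans (sym (+-assoc x y (r + s))) (At.total V))) (≤-trans x≥ (≤-reflexive (sym (+-identityʳ x))))))
          y≡0 : y ≡ 0
          y≡0 = m+n≡0⇒m≡0 y rest0
          r+s≡0 : r + s ≡ 0
          r+s≡0 = m+n≡0⇒n≡0 y rest0
          r0 : weight A p ≡ 0
          r0 = m+n≡0⇒m≡0 (weight A p) (trans (sym (At.i≡ V)) (cong₂ _+_ (m+n≡0⇒m≡0 r r+s≡0) y≡0))
          s0 : weight S p ≡ 0
          s0 = m+n≡0⇒m≡0 (weight S p) (trans (sym (At.j≡ V)) (cong₂ _+_ (m+n≡0⇒n≡0 r r+s≡0) y≡0))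
      vertex : ∃ λ v → κ v ≡ coordinates p × InQuadrilateral (pos v)
      vertex = vertexAt (m≤n⇒m≤1+n i≤n) (m≤n⇒m≤1+n j≤n) bounds
      v : Fin K
      v = proj₁ vertex
      κv : κ v ≡ coordinates p
      κv = proj₁ (proj₂ vertex)
      inQ : InQuadrilateral (pos v)
      inQ = proj₂ (proj₂ vertex)

    -- For a vertex outside the quadrilateral both sides vanish: the two triangles lie inside it,
    -- and `far` is adjacent to nothing in the square.
    formInitial : ∀ u v → formOf X A Y (pos u) (pos v) ℤ.+ formOf X Y S (pos u) (pos v) ≡ form (+_ ∘ height 0) (κ u) (κ v)
    formInitial u v = by (inQuadrilateral? (pos u)) (inQuadrilateral? (pos v))
      where
      by : Dec (InQuadrilateral (pos u)) → Dec (InQuadrilateral (pos v)) → formOf X A Y (pos u) (pos v) ℤ.+ formOf X Y S (pos u) (pos v) ≡ form (+_ ∘ height 0) (κ u) (κ v)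
      by (yes q) (yes q′) = form-height₀ (κ-located q) (κ-located q′) (initial-heightκ q) (initial-heightκ q′)
      by (no ¬q) _ = trans
        (cong₂ ℤ._+_ (formOf-zeroˡ {X} {A} {Y} {pos u} (pos v) (λ i → ¬q (triangles-inQ {pos u} (pos-total u) (inj₁ i)))) (formOf-zeroˡ {X} {Y} {S} {pos u} (pos v) (λ i → ¬q (triangles-inQ {pos u} (pos-total u) (inj₂ (inj₁ i))))))
        (sym (trans (cong (λ k → form (+_ ∘ height 0) k (κ v)) (κ-outside ¬q)) (form-farˡ (+_ ∘ height 0) (κ-near v))))
      by _ (no ¬q) = trans
        (cong₂ ℤ._+_ (formOf-zeroʳ {X} {A} {Y} {pos v} (pos u) (λ i → ¬q (triangles-inQ {pos v} (pos-total v) (inj₁ i)))) (formOf-zeroʳ {X} {Y} {S} {pos v} (pos u) (λ i → ¬q (triangles-inQ {pos v} (pos-total v) (inj₂ (inj₁ i))))))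
        (sym (trans (cong (form (+_ ∘ height 0) (κ u)) (κ-outside ¬q)) (form-farʳ (+_ ∘ height 0) (κ-near u))))

    formFinal : ∀ u v → form (+_ ∘ height n) (κ u) (κ v) ≡ formOf X A S (position′ u) (position′ v) ℤ.+ formOf A Y S (position′ u) (position′ v)
    formFinal u v = by (inQuadrilateral? (pos u)) (inQuadrilateral? (pos v))
      where
      outside : ∀ {v} → ¬ InQuadrilateral (pos v) → InTriangle X A S (position′ v) ⊎ InTriangle A Y S (position′ v) → ⊥
      outside {v} ¬q i = ¬q (subst InQuadrilateral (move-outside {pos v} ¬q) (triangles-inQ {position′ v} (total′ v) (inj₂ (inj₂ i))))
      by : Dec (InQuadrilateral (pos u)) → Dec (InQuadrilateral (pos v)) → form (+_ ∘ height n) (κ u) (κ v) ≡ formOf X A S (position′ u) (position′ v) ℤ.+ formOf A Y S (position′ u) (position′ v)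
      by (yes q) (yes q′) = form-heightₙ (after q) (after q′) (proj₂ (proj₂ (proj₂ (final-inQ q)))) (proj₂ (proj₂ (proj₂ (final-inQ q′))))
        where
        after : ∀ {v} → InQuadrilateral (pos v) → At (κ v) (weight X (position′ v)) (weight Y (position′ v)) (weight A (position′ v)) (weight S (position′ v))
        after {v} q = subst (λ k → At k (weight X (position′ v)) (weight Y (position′ v)) (weight A (position′ v)) (weight S (position′ v)))
          (proj₁ (proj₂ (proj₂ (final-inQ q)))) (inQ-located {position′ v} (proj₁ (final-inQ q)))
      by (no ¬q) _ = trans (trans (cong (λ k → form (+_ ∘ height n) k (κ v)) (κ-outside ¬q)) (form-farˡ (+_ ∘ height n) (κ-near v)))
        (sym (cong₂ ℤ._+_ (formOf-zeroˡ {X} {A} {S} {position′ u} (position′ v) (outside ¬q ∘ inj₁)) (formOf-zeroˡ {A} {Y} {S} {position′ u} (position′ v) (outside ¬q ∘ inj₂))))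
      by _ (no ¬q) = trans (trans (cong (form (+_ ∘ height n) (κ u)) (κ-outside ¬q)) (form-farʳ (+_ ∘ height n) (κ-near u)))
        (sym (cong₂ ℤ._+_ (formOf-zeroʳ {X} {A} {S} {position′ v} (position′ u) (outside ¬q ∘ inj₁)) (formOf-zeroʳ {A} {Y} {S} {position′ v} (position′ u) (outside ¬q ∘ inj₂))))

    seedAt₀ : SeedAt (height 0) seed₀
    seedAt₀ = seedAt
      (λ u v → trans (arrows₀ u v) (cong (λ z → positivePart (rest u v ℤ.+ signed σ z)) (formInitial u v)))
      (λ v → subst (var seed₀ v at𝟙≡_) (initial-value v) (values₀ v))
      where
      initial-value : ∀ v → value (pos v) ≡ val v (height 0 (κ v))
      initial-value v = by (inQuadrilateral? (pos v))
        where
        p : Point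
        p = pos v
        by : Dec (InQuadrilateral (pos v)) → value (pos v) ≡ val v (height 0 (κ v))
        by (yes q) = sym (trans (val-inside (height 0 (κ v)) q) (trans (cong (valueAt (κ v)) (sym (initial-heightκ q))) (trans (valueAt-quad (κ-located q)) (cong value same))))
          where
          same : quad X Y A S (weight X p) (weight Y p) (weight A p) (weight S p) ≡ p
          same = inside-ext Q (quad-InQ (κ-located q)) (q , pos-total v)
            (quad-X Q (weight X p) (weight Y p) (weight A p) (weight S p)) (quad-Y Q (weight X p) (weight Y p) (weight A p) (weight S p))
            (quad-R Q (weight X p) (weight Y p) (weight A p) (weight S p)) (quad-S Q (weight X p) (weight Y p) (weight A p) (weight S p))
        by (no ¬q) = sym (val-outside (height 0 (κ v)) ¬q)

    seed′ : Seed K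
    seed′ = foldl (step pos) seed₀ (upTo n)

    seedAtₙ : SeedAt (height n) seed′
    seedAtₙ = foldl-upTo (λ k → SeedAt (height k)) (step pos) one-step seedAt₀
      where
      one-step : ∀ {k s} → k < n → SeedAt (height k) s → SeedAt (height (suc k)) (step pos s k)
      one-step {k} k<n = SeedAt-step {k} {vs = filter due? (allFin K)} k<n
        (Unique.filter⁺ due? (Unique.allFin⁺ K))
        (λ {v} v∈ → let q , now = proj₂ (∈-filter⁻ due? {v = v} {xs = allFin K} v∈) in subst (Heights.InStep n k) (sym (κ-inside q)) now)
        -- A coordinate in the step is at most n, so it is not `far` and the vertex lies in the
        -- quadrilateral.
        (λ {v} now → let q = inQ-bounded (m≤n⇒m≤1+n (proj₁ (inStep-bounded {i = proj₁ (κ v)} {proj₂ (κ v)} k<n now))) in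
          ∈-filter⁺ due? (∈-allFin v) (q , subst (Heights.InStep n k) (κ-inside q) now))
        where
        due? : ∀ v → Dec (InQuadrilateral (pos v) × InStep k (coordinates (pos v)))
        due? v = inQuadrilateral? (pos v) ×-dec inStep? k (coordinates (pos v))

    values′ : ∀ v → var seed′ v at𝟙≡ value (position′ v)
    values′ v = subst (var seed′ v at𝟙≡_) (by (inQuadrilateral? (pos v))) (SeedAt.values seedAtₙ v)
      where
      by : Dec (InQuadrilateral (pos v)) → val v (height n (κ v)) ≡ value (position′ v)
      by (yes q) = let i≤ , j≤ = located-bounded (κ-located q) ; _ , _ , _ , U , eq = final-quad q in
        trans (val-inside (height n (κ v)) q) (trans (cong (valueAt (κ v)) (height-final i≤ j≤)) (trans (valueAt-quad U) (cong value (sym eq))))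
      by (no ¬q) = trans (val-outside (height n (κ v)) ¬q) (cong value (sym (move-outside {pos v} ¬q)))

    arrows′ : PositivePartOf (λ u v → rest u v ℤ.+ signed σ (formOf X A S (position′ u) (position′ v) ℤ.+ formOf A Y S (position′ u) (position′ v))) (arrows seed′)
    arrows′ u v = trans (SeedAt.arrows≡ seedAtₙ u v) (cong (λ z → positivePart (rest u v ℤ.+ signed σ z)) (formFinal u v))

    flipped : Flipped X Y S σ g pos rest (flip (seed₀ at pos))
    flipped = record
      { values       = values′
      ; arrows≡      = arrows′
      ; totals       = total′
      ; injective    = injective′
      ; kept         = λ v w≢X w≢Y w≢A w≢S → weight-kept v (w≢X ∷ w≢Y ∷ w≢A ∷ w≢S ∷ [])
      ; displacement = displaced
      ; surjective   = surjective′
      }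

-- Flipping e₁, e₂, …

-- (σ , c , w , S) stands for the triangle with corners c, w, S, clockwise if σ;
-- S is the vertex that it introduces.
Triangle : Set
Triangle = Bool × ℕ × ℕ × ℕ

module Invariant (n : ℕ) (ps : List ℕ) (mirror : Bool) (g : ℕ → ℕ) (g≥1 : ∀ v → 1 ≤ g v) (gA : g 0 ≡ 1) where

  open Polygon n ps mirror
  open Points n ps mirror
  open TriangleArrows n
  open OneFlip n ps mirror
  open Values g

  orientedForm : Triangle → Point → Point → ℤ
  orientedForm (σ , c , w , z) p q = signed σ (formOf c w z p q)

  InOriented : Triangle → Point → Set
  InOriented (σ , c , w , z) = InTriangle c w z

  triangle-reverse : ∀ x y z x′ y′ z′ → triangle z y x z′ y′ x′ ≡ triangle x′ y′ z′ x y z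
  triangle-reverse x y z x′ y′ z′ = trans
    (cong₂ ℤ._+_ (cong₂ ℤ._+_ (⟦reverse⟧ z y x z′ y′ x′) (⟦reverse⟧ x z y x′ z′ y′)) (⟦reverse⟧ y x z y′ x′ z′))
    (shuffle ⟦ arrow? x′ y′ z′ x y z ⟧ ⟦ arrow? y′ z′ x′ y z x ⟧ ⟦ arrow? z′ x′ y′ z x y ⟧)
    where
    shuffle : ∀ a b c → a ℤ.+ b ℤ.+ c ≡ a ℤ.+ c ℤ.+ b
    shuffle = ℤ-Solver.solve-∀

  formOf-reverse : ∀ X Y Z p q → formOf Z Y X p q ≡ ℤ.- formOf X Y Z p q
  formOf-reverse X Y Z p q = trans
    (cong₂ ℤ._-_ (triangle-reverse (weight X p) (weight Y p) (weight Z p) (weight X q) (weight Y q) (weight Z q))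
                 (triangle-reverse (weight X q) (weight Y q) (weight Z q) (weight X p) (weight Y p) (weight Z p)))
    (skew (triangle (weight X p) (weight Y p) (weight Z p) (weight X q) (weight Y q) (weight Z q)) (triangle (weight X q) (weight Y q) (weight Z q) (weight X p) (weight Y p) (weight Z p)))
    where
    skew : ∀ a b → b ℤ.- a ≡ ℤ.- (a ℤ.- b)
    skew = ℤ-Solver.solve-∀

  orientedForm-skew : ∀ t p q → orientedForm t q p ≡ ℤ.- orientedForm t p q
  orientedForm-skew (σ , c , w , z) p q = trans (cong (signed σ) (formOf-skew c w z p q)) (signed-neg σ (formOf c w z p q))

  signed-zero : ∀ σ {e} → e ≡ 0ℤ → signed σ e ≡ 0ℤ
  signed-zero true  refl = refl
  signed-zero false refl = refl

  -- Such a triangle does not contain two of the vertices 0, …, z.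
  record Later (z : ℕ) (t : Triangle) : Set where
    constructor later
    private
      c = proj₁ (proj₂ t)
      w = proj₁ (proj₂ (proj₂ t))
      S = proj₂ (proj₂ (proj₂ t))
    field
      z<S   : z < S
      two   : z < c ⊎ z < w
      c≢w   : c ≢ w
      c≢S   : c ≢ S
      w≢S   : w ≢ S
      0<c   : 0 < c
      0<w   : 0 < w

  Avoids : ℕ → Triangle → Set
  Avoids x (σ , c , w , S) = x ≢ c × x ≢ w × x ≢ S

  avoided : ∀ {z t x p} → Later z t → Avoids x t → total p ≡ suc n → 1 ≤ weight x p → ¬ InOriented t p
  avoided {p = p} l (x≢c , x≢w , x≢S) tot x≥1 i = contradiction
    (≤-trans x≥1 (≤-reflexive (triangle-other {p = p} (Later.c≢w l) (Later.c≢S l) (Later.w≢S l) tot i x≢c x≢w x≢S))) (λ ())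

  avoids-0 : ∀ {z t} → Later z t → Avoids 0 t
  avoids-0 l = <⇒≢ (Later.0<c l) , <⇒≢ (Later.0<w l) , <⇒≢ (≤-<-trans z≤n (Later.z<S l))

  -- S and one of c, w exceed z, so at most one corner is available for x and y.
  avoids-one : ∀ {z t x y} → Later z t → x ≤ z → y ≤ z → x ≢ y → Avoids x t ⊎ Avoids y t
  avoids-one {z} {σ , c , w , S} {x} {y} l x≤z y≤z x≢y = by (Later.two l)
    where
    below : ∀ {x v} → x ≤ z → z < v → x ≢ v
    below x≤z z<v = <⇒≢ (≤-<-trans x≤z z<v)
    by : z < c ⊎ z < w → Avoids x (σ , c , w , S) ⊎ Avoids y (σ , c , w , S)
    by (inj₁ z<c) with x ≟ w
    ... | yes refl = inj₂ (below y≤z z<c , (x≢y ∘ sym) , below y≤z (Later.z<S l))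
    ... | no x≢w   = inj₁ (below x≤z z<c , x≢w , below x≤z (Later.z<S l))
    by (inj₂ z<w) with x ≟ c
    ... | yes refl = inj₂ ((x≢y ∘ sym) , below y≤z z<w , below y≤z (Later.z<S l))
    ... | no x≢c   = inj₁ (x≢c , below x≤z z<w , below x≤z (Later.z<S l))

  both-outside : ∀ {z t x y p} → Later z t → x ≤ z → y ≤ z → x ≢ y → total p ≡ suc n → 1 ≤ weight x p → 1 ≤ weight y p → ¬ InOriented t p
  both-outside {p = p} l x≤z y≤z x≢y tot x≥1 y≥1 = [ (λ a → avoided {p = p} l a tot x≥1) , (λ a → avoided {p = p} l a tot y≥1) ]′ (avoids-one l x≤z y≤z x≢y)

  orientedForm-zeroˡ : ∀ t {p} q → ¬ InOriented t p → orientedForm t p q ≡ 0ℤ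
  orientedForm-zeroˡ (σ , c , w , z) {p} q p∉ = signed-zero σ (formOf-zeroˡ {c} {w} {z} {p} q p∉)

  orientedForm-zeroʳ : ∀ t p {q} → ¬ InOriented t q → orientedForm t p q ≡ 0ℤ
  orientedForm-zeroʳ (σ , c , w , z) p {q} q∉ = signed-zero σ (formOf-zeroʳ {c} {w} {z} {q} p q∉)

  ∑-All : ∀ {A : Set} {P : A → Set} {xs} {f h : A → ℤ} → All P xs → (∀ {x} → P x → f x ≡ h x) → ∑ xs f ≡ ∑ xs h
  ∑-All []       eq = refl
  ∑-All (p ∷ ps) eq = cong₂ ℤ._+_ (eq p) (∑-All ps eq)

  ∑-neg : ∀ {A : Set} (xs : List A) (f : A → ℤ) → ∑ xs (λ x → ℤ.- f x) ≡ ℤ.- ∑ xs f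
  ∑-neg []       f = refl
  ∑-neg (x ∷ xs) f = trans (cong (ℤ._+_ (ℤ.- f x)) (∑-neg xs f)) (sym (ℤ.neg-distrib-+ (f x) (∑ xs f)))

  Small : Point → Set
  Small p = ∀ w → weight w p ≤ n

  -- The situation when the vertices 0, …, z are joined to A and the triangle
  -- A c w is next to be crossed; ts are the untouched triangles.
  record Inv (σ : Bool) (c w z : ℕ) (ts : List Triangle) (st : State) : Set where
    field
      values     : ∀ v → var (seed st) v at𝟙≡ value (position st v)
      totals     : ∀ v → total (position st v) ≡ suc n
      injective  : ∀ {u v} → position st u ≡ position st v → u ≡ v
      fresh      : ∀ {x} v → z < x → weight A (position st v) ≡ 0 ⊎ weight x (position st v) ≡ 0
      surjective : ∀ p → total p ≡ suc n → InTriangle c A w p ⊎ Any (λ t → InOriented t p) ts → Small p → ∃ λ v → position st v ≡ p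
      -- the contribution of the triangles that have been left behind
      done       : Fin K → Fin K → ℤ
      done-skew  : Skew done
      done-fresh : ∀ {x u} v → z < x → 1 ≤ weight x (position st u) → done u v ≡ 0ℤ
      done-next  : ∀ {u} v → 1 ≤ weight c (position st u) → 1 ≤ weight w (position st u) → done u v ≡ 0ℤ
      arrows≡    : PositivePartOf (λ u v → done u v ℤ.+ (signed σ (formOf c A w (position st u) (position st v))
                     ℤ.+ ∑ ts (λ t → orientedForm t (position st u) (position st v)))) (arrows (seed st))

  -- Needed between two fans: centre and rim vertex exchange roles, and reading the triangle
  -- backwards changes the sign of its form.
  Inv-swap : ∀ {σ c w z ts st} → Inv σ c w z ts st → Inv (not σ) w c z ts st
  Inv-swap {σ} {c} {w} {z} {ts} {st} inv = record
    { values     = values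
    ; totals     = totals
    ; injective  = injective
    ; fresh      = fresh
    ; surjective = λ p tot i → surjective p tot (Data.Sum.map₁ (trans (backwards (weight c p) (weight A p) (weight w p))) i)
    ; done       = done
    ; done-skew  = done-skew
    ; done-fresh = done-fresh
    ; done-next  = λ v x y → done-next v y x
    ; arrows≡    = λ u v → trans (arrows≡ u v) (cong (λ e → positivePart (done u v ℤ.+ (e ℤ.+ ∑ ts (λ t → orientedForm t (position st u) (position st v)))))
        (sym (trans (cong (signed (not σ)) (formOf-reverse c A w (position st u) (position st v))) (double σ (formOf c A w (position st u) (position st v))))))
    }
    where
    open Inv inv
    backwards : ∀ x y z → x + y + z ≡ z + y + x
    backwards = solve-∀
    double : ∀ σ e → signed (not σ) (ℤ.- e) ≡ signed σ e
    double true  e = ℤ.neg-involutive e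
    double false e = refl

  module Step {σ : Bool} {c w z : ℕ} {ts : List Triangle} {st : State}
    (inv : Inv σ c w z ((σ , c , w , suc z) ∷ ts) st)
    (c≢w : c ≢ w) (0<c : 0 < c) (0<w : 0 < w) (c≤z : c ≤ z) (w≤z : w ≤ z) (S<m : suc z < m)
    (gS : g (suc z) ≡ g c + g w) (laters : All (Later z) ts) where

    open Inv inv

    S : ℕ
    S = suc z

    pos : Fin K → Point
    pos = position st

    Q : Quadrilateral c w A S
    Q = record
      { X<m = <-trans (s≤s c≤z) S<m ; Y<m = <-trans (s≤s w≤z) S<m ; R<m = s≤s z≤n ; S<m = S<m
      ; X≢Y = c≢w ; X≢R = >⇒≢ 0<c ; X≢S = <⇒≢ (s≤s c≤z) ; Y≢R = >⇒≢ 0<w ; Y≢S = <⇒≢ (s≤s w≤z) ; R≢S = λ () }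
    open Quadrilateral Q using (X≢R; X≢S; Y≢R; Y≢S)

    untouched : Fin K → Fin K → ℤ
    untouched u v = ∑ ts (λ t → orientedForm t (pos u) (pos v))

    rest : Fin K → Fin K → ℤ
    rest u v = done u v ℤ.+ untouched u v

    rest-skew : Skew rest
    rest-skew u v = trans (cong₂ ℤ._+_ (done-skew u v) (trans (∑-cong ts (λ t → orientedForm-skew t (pos u) (pos v))) (∑-neg ts (λ t → orientedForm t (pos u) (pos v)))))
      (sym (ℤ.neg-distrib-+ (done u v) (untouched u v)))

    outside : ∀ {t} v → Later z t → 1 ≤ weight c (pos v) → 1 ≤ weight w (pos v) → ¬ InOriented t (pos v)
    outside v l = both-outside {p = pos v} l c≤z w≤z c≢w (totals v)

    rest-zero : ∀ p → 1 ≤ weight c (pos p) → 1 ≤ weight w (pos p) → ∀ v → rest p v ≡ 0ℤ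
    rest-zero p x y v = cong₂ ℤ._+_ (done-next v x y)
      (trans (∑-All laters (λ {t} l → orientedForm-zeroˡ t {pos p} (pos v) (outside p l x y))) (∑-zero ts))

    arrows₀ : PositivePartOf (λ u v → rest u v ℤ.+ signed σ (formOf c A w (pos u) (pos v) ℤ.+ formOf c w S (pos u) (pos v))) (arrows (seed st))
    arrows₀ u v = trans (arrows≡ u v) (cong positivePart
      (trans (regroup (done u v) (signed σ (formOf c A w (pos u) (pos v))) (signed σ (formOf c w S (pos u) (pos v))) (untouched u v))
        (cong (ℤ._+_ (rest u v)) (sym (signed-+ σ (formOf c A w (pos u) (pos v)) (formOf c w S (pos u) (pos v)))))))
      where
      regroup : ∀ d e f h → d ℤ.+ (e ℤ.+ (f ℤ.+ h)) ≡ (d ℤ.+ h) ℤ.+ (e ℤ.+ f)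
      regroup = ℤ-Solver.solve-∀

    st′ : State
    st′ = Flip.flip c w A S st

    flip-result : Flipped c w S σ g pos rest st′
    flip-result = Flipping.flipped Q σ g g≥1 gA gS (seed st) pos totals injective (λ v → fresh v ≤-refl)
      (λ p tot i → surjective p tot ([ inj₁ , inj₂ ∘ here ]′ i)) values rest rest-skew rest-zero arrows₀

    open Flipped flip-result using (displacement; kept) renaming (arrows≡ to arrows′; totals to totals′)

    pos′ : Fin K → Point
    pos′ = position st′

    -- A vertex that moved is outside t both before and after: first it has weight at both c and w,
    -- then at A. So either both ends stay or both sides vanish.
    untouched-kept : ∀ u v {t} → Later z t → orientedForm t (pos u) (pos v) ≡ orientedForm t (pos′ u) (pos′ v)
    untouched-kept u v {t} l = by (displacement u) (displacement v)
      where
      gone : ∀ v → 1 ≤ weight A (pos′ v) → ¬ InOriented t (pos′ v)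
      gone v = avoided {p = pos′ v} l (avoids-0 l) (totals′ v)
      by : _ → _ → orientedForm t (pos u) (pos v) ≡ orientedForm t (pos′ u) (pos′ v)
      by (inj₁ eq) (inj₁ eq′) = sym (cong₂ (orientedForm t) eq eq′)
      by (inj₂ (x , y , r , _)) _ = trans (orientedForm-zeroˡ t {pos u} (pos v) (outside u l x y)) (sym (orientedForm-zeroˡ t {pos′ u} (pos′ v) (gone u r)))
      by _ (inj₂ (x , y , r , _)) = trans (orientedForm-zeroʳ t (pos u) {pos v} (outside v l x y)) (sym (orientedForm-zeroʳ t (pos′ u) {pos′ v} (gone v r)))

    -- Of the two triangles created by the flip, c A S contains the next diagonal c S, also when the
    -- next fan begins; A w S is never touched again.
    behind : Triangle
    behind = σ , A , w , S

    behind-outside : ∀ {x} u → x ≢ A → x ≢ w → x ≢ S → 1 ≤ weight x (pos′ u) → ¬ InTriangle A w S (pos′ u)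
    behind-outside u x≢A x≢w x≢S x≥1 i = contradiction
      (≤-trans x≥1 (≤-reflexive (triangle-other {p = pos′ u} (Y≢R ∘ sym) (λ ()) Y≢S (totals′ u) i x≢A x≢w x≢S))) (λ ())

    done′ : Fin K → Fin K → ℤ
    done′ u v = done u v ℤ.+ orientedForm behind (pos′ u) (pos′ v)

    next : Inv σ c S S ts st′
    next = record
      { values     = Flipped.values flip-result
      ; totals     = totals′
      ; injective  = Flipped.injective flip-result
      ; fresh      = fresh′
      ; surjective = surjective′
      ; done       = done′
      ; done-skew  = λ u v → trans (cong₂ ℤ._+_ (done-skew u v) (orientedForm-skew behind (pos′ u) (pos′ v))) (sym (ℤ.neg-distrib-+ (done u v) _))
      ; done-fresh = done-fresh′
      ; done-next  = done-next′
      ; arrows≡    = λ u v → trans (arrows′ u v) (cong positivePart (trans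
          (cong₂ (λ e f → (done u v ℤ.+ e) ℤ.+ f) (∑-All laters (λ {t} → untouched-kept u v {t})) (signed-+ σ (formOf c A S (pos′ u) (pos′ v)) (formOf A w S (pos′ u) (pos′ v))))
          (regroup (done u v) (∑ ts (λ t → orientedForm t (pos′ u) (pos′ v))) (signed σ (formOf c A S (pos′ u) (pos′ v))) (signed σ (formOf A w S (pos′ u) (pos′ v))))))
      }
      where
      regroup : ∀ d h e f → (d ℤ.+ h) ℤ.+ (e ℤ.+ f) ≡ (d ℤ.+ f) ℤ.+ (e ℤ.+ h)
      regroup = ℤ-Solver.solve-∀
      new : ∀ {x} → S < x → x ≢ c × x ≢ w × x ≢ A × x ≢ S
      new S<x = >⇒≢ (≤-<-trans (m≤n⇒m≤1+n c≤z) S<x) , >⇒≢ (≤-<-trans (m≤n⇒m≤1+n w≤z) S<x) , >⇒≢ (≤-<-trans z≤n S<x) , >⇒≢ S<x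
      weight-new : ∀ {x} v → S < x → weight x (pos′ v) ≡ weight x (pos v)
      weight-new v S<x = let a , b , c , d = new S<x in kept v a b c d
      fresh′ : ∀ {x} v → S < x → weight A (pos′ v) ≡ 0 ⊎ weight x (pos′ v) ≡ 0
      fresh′ {x} v S<x = by (displacement v)
        where
        by : _ → weight A (pos′ v) ≡ 0 ⊎ weight x (pos′ v) ≡ 0
        by (inj₁ eq) = subst (λ p → weight A p ≡ 0 ⊎ weight x p ≡ 0) (sym eq) (fresh v (<⇒≤ S<x))
        by (inj₂ (_ , _ , _ , others)) = let a , b , c , d = new S<x in inj₂ (others a b c d)
      surjective′ : ∀ p → total p ≡ suc n → InTriangle c A S p ⊎ Any (λ t → InOriented t p) ts → Small p → ∃ λ v → pos′ v ≡ p
      surjective′ p tot (inj₁ i) small = Flipped.surjective flip-result p tot i small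
      surjective′ p tot (inj₂ i) small = v , by (displacement v)
        where
        v : Fin K
        v = proj₁ (surjective p tot (inj₂ (there i)) small)
        eq : pos v ≡ p
        eq = proj₂ (surjective p tot (inj₂ (there i)) small)
        by : _ → pos′ v ≡ p
        by (inj₁ eq′) = trans eq′ eq
        by (inj₂ (x , y , _)) = let t , t∈ , p∈ = find i in
          contradiction (subst (InOriented t) (sym eq) p∈) (outside v (All.lookup laters t∈) x y)
      done-fresh′ : ∀ {x u} v → S < x → 1 ≤ weight x (pos′ u) → done′ u v ≡ 0ℤ
      done-fresh′ {x} {u} v S<x x≥1 = cong₂ ℤ._+_ (done-fresh v (<⇒≤ S<x) (subst (1 ≤_) (weight-new u S<x) x≥1))
        (let _ , b , c , d = new S<x in orientedForm-zeroˡ behind {pos′ u} (pos′ v) (behind-outside u c b d x≥1))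
      -- If u stayed, its weight at the then fresh vertex S suffices; if it moved, it had weight at
      -- the old diagonal c w. The triangle just left behind does not contain c.
      done-next′ : ∀ {u} v → 1 ≤ weight c (pos′ u) → 1 ≤ weight S (pos′ u) → done′ u v ≡ 0ℤ
      done-next′ {u} v c≥1 S≥1 = cong₂ ℤ._+_ (by (displacement u)) (orientedForm-zeroˡ behind {pos′ u} (pos′ v) (behind-outside u X≢R c≢w X≢S c≥1))
        where
        by : _ → done u v ≡ 0ℤ
        by (inj₁ eq) = done-fresh v ≤-refl (subst (λ p → 1 ≤ weight S p) eq S≥1)
        by (inj₂ (x , y , _)) = done-next v x y

-- The initial quiver

module Triples where

  ∑-pick : ∀ N {α} (h : ℕ → ℤ) → α < N → ∑ (upTo N) (λ a → ⟦ α ≟ a ⟧ ℤ.* h a) ≡ h α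
  ∑-pick N {α} h α<N = begin
    ∑ (upTo N) (λ a → ⟦ α ≟ a ⟧ ℤ.* h a)   ≡⟨ ∑-cong (upTo N) (λ a → trans (⟦⟧-guard (α ≟ a) (λ { refl → refl })) (ℤ.*-comm ⟦ α ≟ a ⟧ (h α))) ⟩
    ∑ (upTo N) (λ a → h α ℤ.* ⟦ α ≟ a ⟧)   ≡⟨ ∑-*ˡ (upTo N) (h α) (λ a → ⟦ α ≟ a ⟧) ⟩
    h α ℤ.* ∑ (upTo N) (λ a → ⟦ α ≟ a ⟧)   ≡⟨ cong (h α ℤ.*_) (∑-indicator _≟_ (Unique.upTo⁺ N) (∈-upTo⁺ α<N)) ⟩
    h α ℤ.* 1ℤ                             ≡⟨ ℤ.*-identityʳ (h α) ⟩
    h α                                    ∎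
    where open ≡-Reasoning

  module _ (n : ℕ) (ps : List ℕ) (mirror : Bool) where
    open Polygon n ps mirror using (triples)

    row : ℕ → ℕ → List (ℕ × ℕ × ℕ)
    row k a = List.map (λ b → a , b , k ∸ a ∸ b) (upTo (suc (k ∸ a)))

    ∑-triples : ∀ k f → ∑ (triples k) f ≡ ∑ (upTo (suc k)) (λ a → ∑ (upTo (suc (k ∸ a))) (λ b → f (a , b , k ∸ a ∸ b)))
    ∑-triples k f = trans (∑-concatMap (row k) (upTo (suc k)) f) (∑-cong (upTo (suc k)) (λ a → ∑-map (λ b → a , b , k ∸ a ∸ b) (upTo (suc (k ∸ a))) f))

    ∑-triples-unique : ∀ {k} {D : ℕ × ℕ × ℕ → Set} (d : ∀ t → Dec (D t)) {α β γ} → α + β + γ ≡ k →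
      (∀ {t} → D t → t ≡ (α , β , γ)) → D (α , β , γ) → ∑ (triples k) (λ t → ⟦ d t ⟧) ≡ 1ℤ
    ∑-triples-unique {k} {D} d {α} {β} {γ} refl only holds = begin
      ∑ (triples k) (λ t → ⟦ d t ⟧)                       ≡⟨ ∑-triples k (λ t → ⟦ d t ⟧) ⟩
      ∑ (upTo (suc k)) (λ a → ∑ (upTo (suc (k ∸ a))) (λ b → ⟦ d (a , b , k ∸ a ∸ b) ⟧))
        ≡⟨ ∑-cong (upTo (suc k)) (λ a → trans (∑-cong (upTo (suc (k ∸ a))) (λ b → factor a b)) (∑-*ˡ (upTo (suc (k ∸ a))) ⟦ α ≟ a ⟧ (λ b → ⟦ β ≟ b ⟧))) ⟩
      ∑ (upTo (suc k)) (λ a → ⟦ α ≟ a ⟧ ℤ.* ∑ (upTo (suc (k ∸ a))) (λ b → ⟦ β ≟ b ⟧))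
        ≡⟨ ∑-pick (suc k) _ (s≤s (≤-trans (m≤m+n α β) (m≤m+n (α + β) γ))) ⟩
      ∑ (upTo (suc (k ∸ α))) (λ b → ⟦ β ≟ b ⟧)
        ≡⟨ ∑-indicator _≟_ (Unique.upTo⁺ (suc (k ∸ α))) (∈-upTo⁺ (s≤s (≤-trans (m≤m+n β γ) (≤-reflexive (sym k∸α))))) ⟩
      1ℤ ∎
      where
      open ≡-Reasoning
      k∸α : k ∸ α ≡ β + γ
      k∸α = trans (cong (_∸ α) (+-assoc α β γ)) (m+n∸m≡n α (β + γ))
      factor : ∀ a b → ⟦ d (a , b , k ∸ a ∸ b) ⟧ ≡ ⟦ α ≟ a ⟧ ℤ.* ⟦ β ≟ b ⟧
      factor a b = trans (⟦⟧-cong (d (a , b , k ∸ a ∸ b)) ((α ≟ a) ×-dec (β ≟ b))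
        (λ D → sym (cong proj₁ (only D)) , sym (cong (proj₁ ∘ proj₂) (only D)))
        (λ { (refl , refl) → subst (λ c → D (α , β , c)) (sym (trans (cong (_∸ β) k∸α) (m+n∸m≡n β γ))) holds })) (⟦⟧-× (α ≟ a) (β ≟ b))

    ∑-triples-none : ∀ {k} {D : ℕ × ℕ × ℕ → Set} (d : ∀ t → Dec (D t)) → (∀ {t} → ¬ D t) → ∑ (triples k) (λ t → ⟦ d t ⟧) ≡ 0ℤ
    ∑-triples-none {k} d none = trans (∑-cong (triples k) (λ t → ⟦⟧-false (d t) none)) (∑-zero (triples k))

    ∈-triples : ∀ {k} α β γ → α + β + γ ≡ k → (α , β , γ) ∈ triples k
    ∈-triples α β γ refl = ∈-concatMap⁺ (row (α + β + γ)) (lose (∈-upTo⁺ (s≤s (≤-trans (m≤m+n α β) (m≤m+n (α + β) γ))))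
      (subst (λ c → (α , β , c) ∈ row (α + β + γ) α) (trans (cong (_∸ β) k∸α) (m+n∸m≡n β γ)) (∈-map⁺ (λ b → α , b , α + β + γ ∸ α ∸ b) (∈-upTo⁺ (s≤s (≤-trans (m≤m+n β γ) (≤-reflexive (sym k∸α))))))))
      where
      k∸α : α + β + γ ∸ α ≡ β + γ
      k∸α = trans (cong (_∸ α) (+-assoc α β γ)) (m+n∸m≡n α (β + γ))

    ∈-triples⁻ : ∀ {k t} → t ∈ triples k → proj₁ t + proj₁ (proj₂ t) + proj₂ (proj₂ t) ≡ k
    ∈-triples⁻ {k} t∈ with find (∈-concatMap⁻ (row k) {xs = upTo (suc k)} t∈)
    ... | a , a∈ , t∈row with ∈-map⁻ (λ b → a , b , k ∸ a ∸ b) t∈row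
    ... | b , b∈ , refl = trans (+-assoc a b (k ∸ a ∸ b)) (trans (cong (_+_ a) (m+[n∸m]≡n (≤-pred (∈-upTo⁻ b∈)))) (m+[n∸m]≡n (≤-pred (∈-upTo⁻ a∈))))

open Triples

module InitialQuiver (n : ℕ) (1≤n : 1 ≤ n) (ps : List ℕ) (mirror : Bool) where

  open Polygon n ps mirror
  open Points n ps mirror
  open TriangleArrows n
  open OneFlip n ps mirror using (formOf; formOf-skew; triangle-zero)

  record Corners (X Y Z : ℕ) : Set where
    field
      X<m : X < m
      Y<m : Y < m
      Z<m : Z < m
      X≢Y : X ≢ Y
      X≢Z : X ≢ Z
      Y≢Z : Y ≢ Z

  point : (X Y Z a b c : ℕ) → Point
  point X Y Z a b c = a ⊙ X ⊕ b ⊙ Y ⊕ c ⊙ Z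

  module _ {X Y Z : ℕ} (corners : Corners X Y Z) where
    open Corners corners

    private
      weight-point : ∀ w a b c → weight w (point X Y Z a b c) ≡ weight w (a ⊙ X) + weight w (b ⊙ Y) + weight w (c ⊙ Z)
      weight-point w a b c = trans (weight-⊕ w (a ⊙ X ⊕ b ⊙ Y) (c ⊙ Z)) (cong (_+ weight w (c ⊙ Z)) (weight-⊕ w (a ⊙ X) (b ⊙ Y)))

    point-X : ∀ a b c → weight X (point X Y Z a b c) ≡ a
    point-X a b c = trans (weight-point X a b c) (trans (cong₂ _+_ (cong₂ _+_ (weight-⊙ a X<m) (weight-⊙-≢ b X≢Y)) (weight-⊙-≢ c X≢Z)) (trans (+-identityʳ _) (+-identityʳ a)))

    point-Y : ∀ a b c → weight Y (point X Y Z a b c) ≡ b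
    point-Y a b c = trans (weight-point Y a b c) (trans (cong₂ _+_ (cong₂ _+_ (weight-⊙-≢ a (X≢Y ∘ sym)) (weight-⊙ b Y<m)) (weight-⊙-≢ c Y≢Z)) (+-identityʳ b))

    point-Z : ∀ a b c → weight Z (point X Y Z a b c) ≡ c
    point-Z a b c = trans (weight-point Z a b c) (cong₂ _+_ (cong₂ _+_ (weight-⊙-≢ a (X≢Z ∘ sym)) (weight-⊙-≢ b (Y≢Z ∘ sym))) (weight-⊙ c Z<m))

    point-other : ∀ {w} a b c → w ≢ X → w ≢ Y → w ≢ Z → weight w (point X Y Z a b c) ≡ 0
    point-other {w} a b c w≢X w≢Y w≢Z = trans (weight-point w a b c) (cong₂ _+_ (cong₂ _+_ (weight-⊙-≢ a w≢X) (weight-⊙-≢ b w≢Y)) (weight-⊙-≢ c w≢Z))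

    total-point : ∀ a b c → total (point X Y Z a b c) ≡ a + b + c
    total-point a b c = trans (total-⊕ (a ⊙ X ⊕ b ⊙ Y) (c ⊙ Z)) (cong₂ _+_ (trans (total-⊕ (a ⊙ X) (b ⊙ Y)) (cong₂ _+_ (total-⊙ a X<m) (total-⊙ b Y<m))) (total-⊙ c Z<m))

    point-ext : ∀ {p a b c} → total p ≡ suc n → InTriangle X Y Z p → weight X p ≡ a → weight Y p ≡ b → weight Z p ≡ c → point X Y Z a b c ≡ p
    point-ext {p} {a} {b} {c} tot i x y z = weight-ext (point X Y Z a b c) p by
      where
      by : ∀ w → weight w (point X Y Z a b c) ≡ weight w p
      by w with w ≟ X | w ≟ Y | w ≟ Z
      ... | yes refl | _        | _        = trans (point-X a b c) (sym x)
      ... | no _     | yes refl | _        = trans (point-Y a b c) (sym y)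
      ... | no _     | no _     | yes refl = trans (point-Z a b c) (sym z)
      ... | no w≢X   | no w≢Y   | no w≢Z   = trans (point-other a b c w≢X w≢Y w≢Z) (sym (triangle-other {p = p} X≢Y X≢Z Y≢Z tot i w≢X w≢Y w≢Z))

    record Matches (a b c : ℕ) (p : Point) : Set where
      constructor matches
      field
        x≡ : weight X p ≡ a
        y≡ : weight Y p ≡ b
        z≡ : weight Z p ≡ c
        inside : InTriangle X Y Z p

    point⇒ : ∀ {a b c p} → total p ≡ suc n → point X Y Z a b c ≡ p → Matches a b c p
    point⇒ {a} {b} {c} tot refl = matches (point-X a b c) (point-Y a b c) (point-Z a b c)
      (trans (cong₂ _+_ (cong₂ _+_ (point-X a b c) (point-Y a b c)) (point-Z a b c)) (trans (sym (total-point a b c)) tot))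

    module _ (p q : Point) (tp : total p ≡ suc n) (tq : total q ≡ suc n) where

      private
        px py pz qx qy qz : ℕ
        px = weight X p
        py = weight Y p
        pz = weight Z p
        qx = weight X q
        qy = weight Y q
        qz = weight Z q

        equal? : ∀ e → Dec (e ≡ (p , q))
        equal? e = Product.≡-dec _≟ᴾ_ _≟ᴾ_ e (p , q)

        u v w : ℕ × ℕ × ℕ → Point
        u (a , b , c) = point X Y Z a (suc b) (suc c)
        v (a , b , c) = point X Y Z (suc a) (suc b) c
        w (a , b , c) = point X Y Z (suc a) b (suc c)

        split : ∀ {r s : Point} → (r , s) ≡ (p , q) → r ≡ p × s ≡ q
        split refl = refl , refl

        join : ∀ {r s : Point} → r ≡ p → s ≡ q → (r , s) ≡ (p , q)
        join = cong₂ _,_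

        one-fewer : ∀ {x y} → suc (suc x) ≡ suc y → 1 ≤ y → x ≡ y ∸ 1
        one-fewer refl _ = refl

      -- A 3-cycle is recovered from any one of its arrows, so the count is 0 or 1. The triple
      -- consists of the smaller weights at X and Z and the common weight at Y minus 1.
      countUV : ∑ (triples (n ∸ 1)) (λ t → ⟦ equal? (u t , v t) ⟧) ≡ ⟦ arrow? px py pz qx qy qz ⟧
      countUV = by (arrow? px py pz qx qy qz)
        where
        by : Dec (Arrow px py pz qx qy qz) → ∑ (triples (n ∸ 1)) (λ t → ⟦ equal? (u t , v t) ⟧) ≡ ⟦ arrow? px py pz qx qy qz ⟧
        by (no ¬arrow) = trans (∑-triples-none n ps mirror (λ t → equal? (u t , v t)) λ {t} eq → ¬arrow (to t eq)) (sym (⟦⟧-false (arrow? px py pz qx qy qz) ¬arrow))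
          where
          to : ∀ t → (u t , v t) ≡ (p , q) → Arrow px py pz qx qy qz
          to (a , b , c) eq with point⇒ tp (proj₁ (split eq)) | point⇒ tq (proj₂ (split eq))
          ... | matches x y z i | matches x′ y′ z′ i′ = i , i′ , ≤-trans (s≤s z≤n) (≤-reflexive (sym y)) , trans x′ (cong suc (sym x)) , trans y′ (sym y) , trans z (cong suc (sym z′))
        by (yes arrow@(i , i′ , y≥1 , x≡ , y≡ , z≡)) = trans (∑-triples-unique n ps mirror (λ t → equal? (u t , v t)) {px} {pred py} {qz}
          (one-fewer (trans (regroup px (pred py) qz) (trans (cong₂ (λ b c → px + b + c) y⁺ (sym z≡)) i)) 1≤n)
          (λ {t} eq → only t eq)
          (join (point-ext {p} tp i refl (sym y⁺) z≡) (point-ext {q} tq i′ x≡ (trans y≡ (sym y⁺)) refl))) (sym (⟦⟧-true (arrow? px py pz qx qy qz) arrow))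
          where
          y⁺ : suc (pred py) ≡ py
          y⁺ = suc-pred py ⦃ ℕ.>-nonZero y≥1 ⦄
          regroup : ∀ a b c → suc (suc (a + b + c)) ≡ a + suc b + suc c
          regroup = solve-∀
          only : ∀ t → (u t , v t) ≡ (p , q) → t ≡ (px , pred py , qz)
          only (a , b , c) eq with point⇒ tp (proj₁ (split eq)) | point⇒ tq (proj₂ (split eq))
          ... | matches x y z _ | matches _ _ z′ _ = cong₂ _,_ (sym x) (cong₂ _,_ (sym (cong pred y)) (sym z′))

      countVW : ∑ (triples (n ∸ 1)) (λ t → ⟦ equal? (v t , w t) ⟧) ≡ ⟦ arrow? pz px py qz qx qy ⟧
      countVW = by (arrow? pz px py qz qx qy)
        where
        by : Dec (Arrow pz px py qz qx qy) → ∑ (triples (n ∸ 1)) (λ t → ⟦ equal? (v t , w t) ⟧) ≡ ⟦ arrow? pz px py qz qx qy ⟧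
        by (no ¬arrow) = trans (∑-triples-none n ps mirror (λ t → equal? (v t , w t)) λ {t} eq → ¬arrow (to t eq)) (sym (⟦⟧-false (arrow? pz px py qz qx qy) ¬arrow))
          where
          rotate : ∀ a b c → c + a + b ≡ a + b + c
          rotate = solve-∀
          to : ∀ t → (v t , w t) ≡ (p , q) → Arrow pz px py qz qx qy
          to (a , b , c) eq with point⇒ tp (proj₁ (split eq)) | point⇒ tq (proj₂ (split eq))
          ... | matches x y z i | matches x′ y′ z′ i′ = trans (rotate px py pz) i , trans (rotate qx qy qz) i′ , ≤-trans (s≤s z≤n) (≤-reflexive (sym x)) , trans z′ (cong suc (sym z)) , trans x′ (sym x) , trans y (cong suc (sym y′))
        by (yes arrow@(i , i′ , x≥1 , z≡ , x≡ , y≡)) = trans (∑-triples-unique n ps mirror (λ t → equal? (v t , w t)) {pred px} {qy} {pz}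
          (one-fewer (trans (regroup (pred px) qy pz) (trans (cong₂ (λ a b → pz + a + b) x⁺ (sym y≡)) i)) 1≤n)
          (λ {t} eq → only t eq)
          (join (point-ext {p} tp (trans (rotate px py pz) i) (sym x⁺) y≡ refl) (point-ext {q} tq (trans (rotate qx qy qz) i′) (trans x≡ (sym x⁺)) refl z≡))) (sym (⟦⟧-true (arrow? pz px py qz qx qy) arrow))
          where
          rotate : ∀ a b c → a + b + c ≡ c + a + b
          rotate = solve-∀
          x⁺ : suc (pred px) ≡ px
          x⁺ = suc-pred px ⦃ ℕ.>-nonZero x≥1 ⦄
          regroup : ∀ a b c → suc (suc (a + b + c)) ≡ c + suc a + suc b
          regroup = solve-∀
          only : ∀ t → (v t , w t) ≡ (p , q) → t ≡ (pred px , qy , pz)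
          only (a , b , c) eq with point⇒ tp (proj₁ (split eq)) | point⇒ tq (proj₂ (split eq))
          ... | matches x _ z _ | matches _ y′ _ _ = cong₂ _,_ (sym (cong pred x)) (cong₂ _,_ (sym y′) (sym z))

      countWU : ∑ (triples (n ∸ 1)) (λ t → ⟦ equal? (w t , u t) ⟧) ≡ ⟦ arrow? py pz px qy qz qx ⟧
      countWU = by (arrow? py pz px qy qz qx)
        where
        by : Dec (Arrow py pz px qy qz qx) → ∑ (triples (n ∸ 1)) (λ t → ⟦ equal? (w t , u t) ⟧) ≡ ⟦ arrow? py pz px qy qz qx ⟧
        by (no ¬arrow) = trans (∑-triples-none n ps mirror (λ t → equal? (w t , u t)) λ {t} eq → ¬arrow (to t eq)) (sym (⟦⟧-false (arrow? py pz px qy qz qx) ¬arrow))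
          where
          rotate : ∀ a b c → b + c + a ≡ a + b + c
          rotate = solve-∀
          to : ∀ t → (w t , u t) ≡ (p , q) → Arrow py pz px qy qz qx
          to (a , b , c) eq with point⇒ tp (proj₁ (split eq)) | point⇒ tq (proj₂ (split eq))
          ... | matches x y z i | matches x′ y′ z′ i′ = trans (rotate px py pz) i , trans (rotate qx qy qz) i′ , ≤-trans (s≤s z≤n) (≤-reflexive (sym z)) , trans y′ (cong suc (sym y)) , trans z′ (sym z) , trans x (cong suc (sym x′))
        by (yes arrow@(i , i′ , z≥1 , y≡ , z≡ , x≡)) = trans (∑-triples-unique n ps mirror (λ t → equal? (w t , u t)) {qx} {py} {pred pz}
          (one-fewer (trans (regroup qx py (pred pz)) (trans (cong₂ (λ c a → py + c + a) z⁺ (sym x≡)) i)) 1≤n)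
          (λ {t} eq → only t eq)
          (join (point-ext {p} tp (trans (rotate px py pz) i) x≡ refl (sym z⁺)) (point-ext {q} tq (trans (rotate qx qy qz) i′) refl y≡ (trans z≡ (sym z⁺))))) (sym (⟦⟧-true (arrow? py pz px qy qz qx) arrow))
          where
          rotate : ∀ a b c → a + b + c ≡ b + c + a
          rotate = solve-∀
          z⁺ : suc (pred pz) ≡ pz
          z⁺ = suc-pred pz ⦃ ℕ.>-nonZero z≥1 ⦄
          regroup : ∀ a b c → suc (suc (a + b + c)) ≡ b + suc c + suc a
          regroup = solve-∀
          only : ∀ t → (w t , u t) ≡ (p , q) → t ≡ (qx , py , pred pz)
          only (a , b , c) eq with point⇒ tp (proj₁ (split eq)) | point⇒ tq (proj₂ (split eq))
          ... | matches _ y z _ | matches x′ _ _ _ = cong₂ _,_ (sym x′) (cong₂ _,_ (sym y) (sym (cong pred z)))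

      count-triangle : ∑ (arrowsOf (X , Y , Z)) (λ e → ⟦ equal? e ⟧) ≡ triangle px py pz qx qy qz
      count-triangle = begin
        ∑ (arrowsOf (X , Y , Z)) (λ e → ⟦ equal? e ⟧)
          ≡⟨ cong (λ es → ∑ es (λ e → ⟦ equal? e ⟧)) (List.concatMap-cong {g = cycle} (λ _ → refl) (triples (n ∸ 1))) ⟩
        ∑ (concatMap cycle (triples (n ∸ 1))) (λ e → ⟦ equal? e ⟧)
          ≡⟨ ∑-concatMap cycle (triples (n ∸ 1)) (λ e → ⟦ equal? e ⟧) ⟩
        ∑ (triples (n ∸ 1)) (λ t → ⟦ equal? (u t , v t) ⟧ ℤ.+ (⟦ equal? (v t , w t) ⟧ ℤ.+ (⟦ equal? (w t , u t) ⟧ ℤ.+ 0ℤ)))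
          ≡⟨ ∑-cong (triples (n ∸ 1)) (λ t → regroup ⟦ equal? (u t , v t) ⟧ ⟦ equal? (v t , w t) ⟧ ⟦ equal? (w t , u t) ⟧) ⟩
        ∑ (triples (n ∸ 1)) (λ t → ⟦ equal? (u t , v t) ⟧ ℤ.+ ⟦ equal? (v t , w t) ⟧ ℤ.+ ⟦ equal? (w t , u t) ⟧)
          ≡⟨ trans (∑-+ (triples (n ∸ 1)) (λ t → ⟦ equal? (u t , v t) ⟧ ℤ.+ ⟦ equal? (v t , w t) ⟧) (λ t → ⟦ equal? (w t , u t) ⟧))
               (cong₂ ℤ._+_ (∑-+ (triples (n ∸ 1)) (λ t → ⟦ equal? (u t , v t) ⟧) (λ t → ⟦ equal? (v t , w t) ⟧)) refl) ⟩
        ∑ (triples (n ∸ 1)) (λ t → ⟦ equal? (u t , v t) ⟧) ℤ.+ ∑ (triples (n ∸ 1)) (λ t → ⟦ equal? (v t , w t) ⟧) ℤ.+ ∑ (triples (n ∸ 1)) (λ t → ⟦ equal? (w t , u t) ⟧)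
          ≡⟨ cong₂ ℤ._+_ (cong₂ ℤ._+_ countUV countVW) countWU ⟩
        triangle px py pz qx qy qz ∎
        where
        open ≡-Reasoning
        cycle : ℕ × ℕ × ℕ → List (Point × Point)
        cycle t = (u t , v t) ∷ (v t , w t) ∷ (w t , u t) ∷ []
        regroup : ∀ a b c → a ℤ.+ (b ℤ.+ (c ℤ.+ 0ℤ)) ≡ a ℤ.+ b ℤ.+ c
        regroup = ℤ-Solver.solve-∀

    ∈-pointsOf : ∀ p → total p ≡ suc n → InTriangle X Y Z p → (∀ w → weight w p ≤ n) → p ∈ pointsOf (X , Y , Z)
    ∈-pointsOf p tot i small = subst (_∈ pointsOf (X , Y , Z)) (point-ext {p} tot i refl refl refl)
      (∈-map⁺ _ (∈-filter⁺ (λ { (a , b , c) → (a ≤? n) ×-dec (b ≤? n) ×-dec (c ≤? n) }) (∈-triples n ps mirror (weight X p) (weight Y p) (weight Z p) i) (small X , small Y , small Z)))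

    pointsOf⇒ : ∀ {p} → p ∈ pointsOf (X , Y , Z) → total p ≡ suc n × InTriangle X Y Z p
    pointsOf⇒ {p} p∈ = subst (λ p → total p ≡ suc n × InTriangle X Y Z p) (sym eq) (trans (total-point α β γ) sum≡ , inside)
      where
      preimage : ∃ λ t → t ∈ filter (λ { (a , b , c) → (a ≤? n) ×-dec (b ≤? n) ×-dec (c ≤? n) }) (triples (suc n)) × p ≡ point X Y Z (proj₁ t) (proj₁ (proj₂ t)) (proj₂ (proj₂ t))
      preimage = ∈-map⁻ _ p∈
      α β γ : ℕ
      α = proj₁ (proj₁ preimage)
      β = proj₁ (proj₂ (proj₁ preimage))
      γ = proj₂ (proj₂ (proj₁ preimage))
      eq : p ≡ point X Y Z α β γ
      eq = proj₂ (proj₂ preimage)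
      sum≡ : α + β + γ ≡ suc n
      sum≡ = ∈-triples⁻ n ps mirror (proj₁ (∈-filter⁻ (λ { (a , b , c) → (a ≤? n) ×-dec (b ≤? n) ×-dec (c ≤? n) }) {xs = triples (suc n)} (proj₁ (proj₂ preimage))))
      inside : InTriangle X Y Z (point X Y Z α β γ)
      inside = trans (cong₂ _+_ (cong₂ _+_ (point-X α β γ) (point-Y α β γ)) (point-Z α β γ)) sum≡

-- Weaker than `Chain`, so that it also covers the first triangle, which has the corner A = 0.
data Growing (M : ℕ) : ℕ → List Triangle → Set where
  []  : ∀ {z} → Growing M z []
  _∷_ : ∀ {z σ c w S ts} → z < S × c < S × w < S × c ≢ w × S < M → Growing M S ts → Growing M z ((σ , c , w , S) ∷ ts)

-- The triangles e₁, e₂, … cross one after the other, beginning with c w (1+z),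
-- where z is the newest vertex.
data Chain (M : ℕ) : ℕ → List Triangle → Set where
  []   : ∀ {z} → Chain M z []
  link : ∀ {z σ c w ts} → c ≢ w → 0 < c → 0 < w → c ≤ z → w ≤ z → z ≤ c ⊎ z ≤ w → suc z < M →
         Chain M (suc z) ts → Chain M z ((σ , c , w , suc z) ∷ ts)

chain-growing : ∀ {M z ts} → Chain M z ts → Growing M z ts
chain-growing []                                       = []
chain-growing (link c≢w _ _ c≤z w≤z _ S<M chain) = (≤-refl , s≤s c≤z , s≤s w≤z , c≢w , S<M) ∷ chain-growing chain

lookup-injective : ∀ {A : Set} {xs : List A} → Unique xs → ∀ {i j} → lookup xs i ≡ lookup xs j → i ≡ j
lookup-injective (x# ∷ u) {Fin.zero}  {Fin.zero}  eq = refl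
lookup-injective (x# ∷ u) {Fin.zero}  {Fin.suc j} eq = contradiction eq (All.lookup x# (∈-lookup j))
lookup-injective (x# ∷ u) {Fin.suc i} {Fin.zero}  eq = contradiction (sym eq) (All.lookup x# (∈-lookup i))
lookup-injective (x# ∷ u) {Fin.suc i} {Fin.suc j} eq = cong Fin.suc (lookup-injective u eq)

length-filter-∑ : ∀ {A : Set} {P : A → Set} (P? : ∀ x → Dec (P x)) xs → + length (filter P? xs) ≡ ∑ xs (λ x → ⟦ P? x ⟧)
length-filter-∑ P? []       = refl
length-filter-∑ P? (x ∷ xs) with P? x
... | yes _ = cong (ℤ._+_ 1ℤ) (length-filter-∑ P? xs)
... | no _  = trans (length-filter-∑ P? xs) (sym (ℤ.+-identityˡ _))

-- No 2-cycles in the initial quiver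

module Reducedness (n : ℕ) where

  open TriangleArrows n

  triangle-rotate : ∀ x y z x′ y′ z′ → triangle z x y z′ x′ y′ ≡ triangle x y z x′ y′ z′
  triangle-rotate x y z x′ y′ z′ = rotate ⟦ arrow? z x y z′ x′ y′ ⟧ ⟦ arrow? y z x y′ z′ x′ ⟧ ⟦ arrow? x y z x′ y′ z′ ⟧
    where
    rotate : ∀ a b c → a ℤ.+ b ℤ.+ c ≡ c ℤ.+ a ℤ.+ b
    rotate = ℤ-Solver.solve-∀

  -- What an arrow reveals: both ends lie in the triangle and each corner has weight at one of them.
  -- So the triangle can be read off from the two ends.
  record Occupied (x y z x′ y′ z′ : ℕ) : Set where
    constructor occupied
    field
      source : x + y + z ≡ suc n
      target : x′ + y′ + z′ ≡ suc n
      atX    : 1 ≤ x + x′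
      atY    : 1 ≤ y + y′
      atZ    : 1 ≤ z + z′
      oneWay : triangle x′ y′ z′ x y z ≡ 0ℤ

  arrow-occupied : ∀ {x y z x′ y′ z′} → Arrow x y z x′ y′ z′ → Occupied x y z x′ y′ z′
  arrow-occupied {x} {y} {z} {x′} {y′} {z′} (i , i′ , y≥1 , x≡ , y≡ , z≡) = occupied i i′
    (≤-trans (≤-trans (s≤s z≤n) (≤-reflexive (sym x≡))) (m≤n+m x′ x))
    (≤-trans y≥1 (m≤m+n y y′))
    (≤-trans (≤-trans (s≤s z≤n) (≤-reflexive (sym z≡))) (m≤m+n z z′))
    (cong₂ ℤ._+_ (cong₂ ℤ._+_
      (⟦⟧-false (arrow? x′ y′ z′ x y z) (λ { (_ , _ , _ , x≡′ , _ , _) → <-asym (≤-reflexive (sym x≡)) (≤-reflexive (sym x≡′)) }))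
      (⟦⟧-false (arrow? z′ x′ y′ z x y) (λ { (_ , _ , _ , _ , x≡′ , _) → 1+n≢n (trans (sym x≡) (sym x≡′)) })))
      (⟦⟧-false (arrow? y′ z′ x′ y z x) (λ { (_ , _ , _ , _ , z≡′ , _) → 1+n≢n (trans (sym z≡) z≡′) })))

  occupied-rotate : ∀ {x y z x′ y′ z′} → Occupied z x y z′ x′ y′ → Occupied x y z x′ y′ z′
  occupied-rotate {x} {y} {z} {x′} {y′} {z′} (occupied i i′ a b c o) =
    occupied (trans (rotate x y z) i) (trans (rotate x′ y′ z′) i′) b c a (trans (sym (triangle-rotate x′ y′ z′ x y z)) o)
    where
    rotate : ∀ x y z → x + y + z ≡ z + x + y
    rotate = solve-∀

  triangle-dichotomy : ∀ x y z x′ y′ z′ → triangle x y z x′ y′ z′ ≡ 0ℤ ⊎ Occupied x y z x′ y′ z′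
  triangle-dichotomy x y z x′ y′ z′ = by (arrow? x y z x′ y′ z′) (arrow? z x y z′ x′ y′) (arrow? y z x y′ z′ x′)
    where
    by : Dec (Arrow x y z x′ y′ z′) → Dec (Arrow z x y z′ x′ y′) → Dec (Arrow y z x y′ z′ x′) → triangle x y z x′ y′ z′ ≡ 0ℤ ⊎ Occupied x y z x′ y′ z′
    by (yes a) _ _ = inj₂ (arrow-occupied a)
    by _ (yes b) _ = inj₂ (occupied-rotate (arrow-occupied b))
    by _ _ (yes c) = inj₂ (occupied-rotate (occupied-rotate (arrow-occupied c)))
    by (no a) (no b) (no c) = inj₁ (cong₂ ℤ._+_ (cong₂ ℤ._+_ (⟦⟧-false (arrow? x y z x′ y′ z′) a) (⟦⟧-false (arrow? z x y z′ x′ y′) b)) (⟦⟧-false (arrow? y z x y′ z′ x′) c))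

module InitialSeed (n : ℕ) (1≤n : 1 ≤ n) (ps : List ℕ) (mirror : Bool) (g : ℕ → ℕ) (g≥1 : ∀ v → 1 ≤ g v) (gA : g 0 ≡ 1) (g₁ : g 1 ≡ 1) (g₂ : g 2 ≡ 1) where

  open Polygon n ps mirror
  open Points n ps mirror
  open TriangleArrows n
  open OneFlip n ps mirror using (formOf)
  open Invariant n ps mirror g g≥1 gA using (orientedForm; InOriented; triangle-reverse; Inv)
  open Values g
  open InitialQuiver n 1≤n ps mirror
  open Reducedness n

  triangleAt : ℕ × ℕ × ℕ → Point → Point → ℤ
  triangleAt (X , Y , Z) p q = triangle (weight X p) (weight Y p) (weight Z p) (weight X q) (weight Y q) (weight Z q)

  clockwiseCorners : Triangle → ℕ × ℕ × ℕ
  clockwiseCorners (σ , c , w , S) = if σ then (c , w , S) else (c , S , w)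

  arrowsAt : Triangle → Point → Point → ℤ
  arrowsAt t = triangleAt (clockwiseCorners t)

  orientedForm≡ : ∀ t p q → orientedForm t p q ≡ arrowsAt t p q ℤ.- arrowsAt t q p
  orientedForm≡ (true  , c , w , S) p q = refl
  orientedForm≡ (false , c , w , S) p q = trans (negate (triangleAt (c , w , S) p q) (triangleAt (c , w , S) q p)) (cong₂ ℤ._-_ (sym (reversed p q)) (sym (reversed q p)))
    where
    negate : ∀ a b → ℤ.- (a ℤ.- b) ≡ b ℤ.- a
    negate = ℤ-Solver.solve-∀
    reversed : ∀ p q → triangleAt (c , S , w) p q ≡ triangleAt (c , w , S) q p
    reversed p q = trans (triangle-reverse (weight w p) (weight S p) (weight c p) (weight w q) (weight S q) (weight c q))
      (sym (triangle-rotate (weight w q) (weight S q) (weight c q) (weight w p) (weight S p) (weight c p)))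

  record Near (t : Triangle) (p q : Point) : Set where
    constructor near
    private S = proj₂ (proj₂ (proj₂ t))
    field
      touches : 1 ≤ weight S p + weight S q
      only    : ∀ {x} → S < x → weight x p ≡ 0 × weight x q ≡ 0
      oneWay  : arrowsAt t q p ≡ 0ℤ

  arrowsAt-dichotomy : ∀ {M z t ts p q} → Growing M z (t ∷ ts) → total p ≡ suc n → total q ≡ suc n → arrowsAt t p q ≡ 0ℤ ⊎ Near t p q
  arrowsAt-dichotomy {t = true , c , w , S} {p = p} {q} ((_ , c<S , w<S , c≢w , _) ∷ _) tp tq
    with triangle-dichotomy (weight c p) (weight w p) (weight S p) (weight c q) (weight w q) (weight S q)
  ... | inj₁ zero≡ = inj₁ zero≡
  ... | inj₂ (occupied i i′ _ _ atS o) = inj₂ (near atS (λ S<x → beyond {p} tp i S<x , beyond {q} tq i′ S<x) o)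
    where
    beyond : ∀ {p x} → total p ≡ suc n → InTriangle c w S p → S < x → weight x p ≡ 0
    beyond {p} t i S<x = triangle-other {p = p} c≢w (<⇒≢ c<S) (<⇒≢ w<S) t i (>⇒≢ (<-trans c<S S<x)) (>⇒≢ (<-trans w<S S<x)) (>⇒≢ S<x)
  arrowsAt-dichotomy {t = false , c , w , S} {p = p} {q} ((_ , c<S , w<S , c≢w , _) ∷ _) tp tq
    with triangle-dichotomy (weight c p) (weight S p) (weight w p) (weight c q) (weight S q) (weight w q)
  ... | inj₁ zero≡ = inj₁ zero≡
  ... | inj₂ (occupied i i′ _ atS _ o) = inj₂ (near atS (λ S<x → beyond {p} tp i S<x , beyond {q} tq i′ S<x) o)
    where
    beyond : ∀ {p x} → total p ≡ suc n → InTriangle c S w p → S < x → weight x p ≡ 0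
    beyond {p} t i S<x = triangle-other {p = p} (<⇒≢ c<S) c≢w (>⇒≢ w<S) t i (>⇒≢ (<-trans c<S S<x)) (>⇒≢ S<x) (>⇒≢ (<-trans w<S S<x))

  arrowsAll : List Triangle → Point → Point → ℤ
  arrowsAll ts p q = ∑ ts (λ t → arrowsAt t p q)

  -- Each of these triangles introduces a vertex beyond z, at which an arrow of it would need
  -- weight.
  arrowsAll-zero : ∀ {M z ts p q} → Growing M z ts → total p ≡ suc n → total q ≡ suc n →
    (∀ {x} → z < x → weight x p ≡ 0 × weight x q ≡ 0) → arrowsAll ts p q ≡ 0ℤ
  arrowsAll-zero [] tp tq none = refl
  arrowsAll-zero {ts = t ∷ ts} {p} {q} gr@((z<S , _) ∷ growing) tp tq none = cong₂ ℤ._+_ (by (arrowsAt-dichotomy {t = t} {p = p} {q} gr tp tq)) (arrowsAll-zero {p = p} {q} growing tp tq (λ S<x → none (<-trans z<S S<x)))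
    where
    by : arrowsAt t p q ≡ 0ℤ ⊎ Near t p q → arrowsAt t p q ≡ 0ℤ
    by (inj₁ zero≡) = zero≡
    by (inj₂ (near h _ _)) = contradiction (≤-trans h (≤-reflexive (cong₂ _+_ (proj₁ (none z<S)) (proj₂ (none z<S))))) (λ ())

  -- An arrow determines its triangle, hence initially there are no 2-cycles.
  reduced : ∀ {M z ts} p q → Growing M z ts → total p ≡ suc n → total q ≡ suc n → arrowsAll ts p q ≡ 0ℤ ⊎ arrowsAll ts q p ≡ 0ℤ
  reduced p q [] tp tq = inj₁ refl
  reduced {ts = t ∷ ts} p q gr@((z<S , _) ∷ growing) tp tq = by (arrowsAt-dichotomy {t = t} {p = p} {q} gr tp tq) (arrowsAt-dichotomy {t = t} {p = q} {p} gr tq tp) (reduced p q growing tp tq)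
    where
    by : arrowsAt t p q ≡ 0ℤ ⊎ Near t p q → arrowsAt t q p ≡ 0ℤ ⊎ Near t q p → arrowsAll ts p q ≡ 0ℤ ⊎ arrowsAll ts q p ≡ 0ℤ →
      arrowsAll (t ∷ ts) p q ≡ 0ℤ ⊎ arrowsAll (t ∷ ts) q p ≡ 0ℤ
    by (inj₂ (near _ only o)) _ _ = inj₂ (cong₂ ℤ._+_ o (arrowsAll-zero {p = q} {p} growing tq tp (λ S<x → proj₂ (only S<x) , proj₁ (only S<x))))
    by _ (inj₂ (near _ only o)) _ = inj₁ (cong₂ ℤ._+_ o (arrowsAll-zero {p = p} {q} growing tp tq (λ S<x → proj₂ (only S<x) , proj₁ (only S<x))))
    by (inj₁ a) (inj₁ b) (inj₁ c) = inj₁ (cong₂ ℤ._+_ a c)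
    by (inj₁ a) (inj₁ b) (inj₂ c) = inj₂ (cong₂ ℤ._+_ b c)

  clockwise-corners : ∀ {M z t ts} → Growing M z (t ∷ ts) → M ≤ m → Corners (proj₁ (clockwiseCorners t)) (proj₁ (proj₂ (clockwiseCorners t))) (proj₂ (proj₂ (clockwiseCorners t)))
  clockwise-corners {t = true , c , w , S} ((_ , c<S , w<S , c≢w , S<M) ∷ _) M≤m = record
    { X<m = <-trans c<S S<m ; Y<m = <-trans w<S S<m ; Z<m = S<m ; X≢Y = c≢w ; X≢Z = <⇒≢ c<S ; Y≢Z = <⇒≢ w<S }
    where
    S<m : S < m
    S<m = ≤-trans S<M M≤m
  clockwise-corners {t = false , c , w , S} ((_ , c<S , w<S , c≢w , S<M) ∷ _) M≤m = record
    { X<m = <-trans c<S S<m ; Y<m = S<m ; Z<m = <-trans w<S S<m ; X≢Y = <⇒≢ c<S ; X≢Z = c≢w ; Y≢Z = >⇒≢ w<S }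
    where
    S<m : S < m
    S<m = ≤-trans S<M M≤m

  swapLast : ∀ (t : Triangle) p → InTriangle (proj₁ (clockwiseCorners t)) (proj₁ (proj₂ (clockwiseCorners t))) (proj₂ (proj₂ (clockwiseCorners t))) p → InOriented t p
  swapLast (true  , c , w , S) p i = i
  swapLast (false , c , w , S) p i = trans (swap (weight c p) (weight w p) (weight S p)) i
    where
    swap : ∀ a b c → a + b + c ≡ a + c + b
    swap = solve-∀

  swapLast⁻ : ∀ (t : Triangle) p → InOriented t p → InTriangle (proj₁ (clockwiseCorners t)) (proj₁ (proj₂ (clockwiseCorners t))) (proj₂ (proj₂ (clockwiseCorners t))) p
  swapLast⁻ (true  , c , w , S) p i = i
  swapLast⁻ (false , c , w , S) p i = trans (swap (weight c p) (weight S p) (weight w p)) i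
    where
    swap : ∀ a b c → a + b + c ≡ a + c + b
    swap = solve-∀

  module _ (σ : Bool) (ts : List Triangle) (chain : Chain m 2 ts)
    (triangles≡ : triangles ≡ List.map clockwiseCorners ((σ , 1 , 0 , 2) ∷ ts)) where

    private
      all : List Triangle
      all = (σ , 1 , 0 , 2) ∷ ts

      growing : Growing m 1 all
      growing = (s≤s (s≤s z≤n) , s≤s (s≤s z≤n) , s≤s z≤n , (λ ()) , s≤s (s≤s (s≤s z≤n))) ∷ chain-growing chain

      pos : Fin K → Point
      pos = lookup vertices

      ∈-triangle : ∀ v → ∃ λ T → T ∈ triangles × pos v ∈ pointsOf T
      ∈-triangle v = find (∈-concatMap⁻ pointsOf {xs = triangles} (∈-deduplicate⁻ _≟ᴾ_ (concatMap pointsOf triangles) (∈-lookup {xs = vertices} v)))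

      members : ∀ {z us p} → Growing m z us → Any (λ t → p ∈ pointsOf (clockwiseCorners t)) us → total p ≡ suc n × Any (λ t → InOriented t p) us
      members {us = t ∷ _} {p} gr@(_ ∷ _)  (here p∈) = let tot , i = pointsOf⇒ (clockwise-corners gr ≤-refl) p∈ in tot , here (swapLast t p i)
      members (_ ∷ gr) (there p∈) = let tot , i = members gr p∈ in tot , there i

      position-triangle : ∀ v → total (pos v) ≡ suc n × Any (λ t → InOriented t (pos v)) all
      position-triangle v = members growing (from (∈-triangle v))
        where
        from : (∃ λ T → T ∈ triangles × pos v ∈ pointsOf T) → Any (λ t → pos v ∈ pointsOf (clockwiseCorners t)) all
        from (T , T∈ , p∈) with ∈-map⁻ clockwiseCorners (subst (T ∈_) triangles≡ T∈)
        ... | t , t∈ , refl = lose t∈ p∈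

      totals : ∀ v → total (pos v) ≡ suc n
      totals v = proj₁ (position-triangle v)

      surjects : ∀ {z us} p → Growing m z us → total p ≡ suc n → Any (λ t → InOriented t p) us → (∀ w → weight w p ≤ n) → Any (λ t → p ∈ pointsOf (clockwiseCorners t)) us
      surjects {us = t ∷ _} p gr tot (here i) small = here (∈-pointsOf (clockwise-corners gr ≤-refl) p tot (swapLast⁻ t p i) small)
      surjects p (_ ∷ gr) tot (there i) small = there (surjects p gr tot i small)

      surjective : ∀ p → total p ≡ suc n → InTriangle 1 0 2 p ⊎ Any (λ t → InOriented t p) ts → (∀ w → weight w p ≤ n) → ∃ λ v → pos v ≡ p
      surjective p tot i small = Any.index p∈vertices , sym (Any.lookup-index p∈vertices)
        where
        p∈ : Any (λ t → p ∈ pointsOf (clockwiseCorners t)) all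
        p∈ = surjects p growing tot ([ here , there ]′ i) small
        p∈vertices : p ∈ vertices
        p∈vertices = ∈-deduplicate⁺ _≟ᴾ_ {xs = concatMap pointsOf triangles} (∈-concatMap⁺ pointsOf {xs = triangles}
          (let t , t∈ , q = find p∈ in lose (subst (clockwiseCorners t ∈_) (sym triangles≡) (∈-map⁺ clockwiseCorners t∈)) q))

      avoids-A : ∀ {z us p} → Chain m z us → total p ≡ suc n → Any (λ t → InOriented t p) us → weight A p ≡ 0
      avoids-A {p = p} (link c≢w 0<c 0<w c≤z w≤z _ _ _) tot (here i) = triangle-other {p = p} c≢w (<⇒≢ (s≤s c≤z)) (<⇒≢ (s≤s w≤z)) tot i (<⇒≢ 0<c) (<⇒≢ 0<w) (λ ())
      avoids-A {p = p} (link _ _ _ _ _ _ _ chain) tot (there i) = avoids-A {p = p} chain tot i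

      first-or-none : ∀ v → InTriangle 1 0 2 (pos v) ⊎ weight A (pos v) ≡ 0
      first-or-none v with position-triangle v
      ... | tot , here i  = inj₁ i
      ... | tot , there i = inj₂ (avoids-A {p = pos v} chain tot i)

      first-other : ∀ {x} v → InTriangle 1 0 2 (pos v) → 2 < x → weight x (pos v) ≡ 0
      first-other v i 2<x = triangle-other {p = pos v} (λ ()) (λ ()) (λ ()) (totals v) i (>⇒≢ (<-trans (s≤s (s≤s z≤n)) 2<x)) (>⇒≢ (<-trans (s≤s z≤n) 2<x)) (>⇒≢ 2<x)

      monomial-one : ∀ {k} f (p : Vec ℕ k) → (∀ w → weight w p ≡ 0 ⊎ f w ≡ 1) → monomial f p ≡ 1
      monomial-one f []      one≡ = refl
      monomial-one f (x ∷ p) one≡ = cong₂ _*_ (by (one≡ 0)) (monomial-one (f ∘ suc) p (one≡ ∘ suc))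
        where
        by : x ≡ 0 ⊎ f 0 ≡ 1 → f 0 ^ x ≡ 1
        by (inj₁ refl) = refl
        by (inj₂ eq)   = trans (cong (_^ x) eq) (^-zeroˡ x)

      -- In the first triangle all lengths are 1; every other point has weight 0 at A, hence
      -- exponent 0.
      value-one : ∀ v → value (pos v) ≡ 1
      value-one v = by (first-or-none v)
        where
        by : InTriangle 1 0 2 (pos v) ⊎ weight A (pos v) ≡ 0 → value (pos v) ≡ 1
        by (inj₁ i) = trans (cong (_^ weight A (pos v)) (monomial-one g (pos v) ones)) (^-zeroˡ (weight A (pos v)))
          where
          ones : ∀ w → weight w (pos v) ≡ 0 ⊎ g w ≡ 1
          ones 0 = inj₂ gA
          ones 1 = inj₂ g₁
          ones 2 = inj₂ g₂
          ones (suc (suc (suc w))) = inj₁ (first-other v i (s≤s (s≤s (s≤s z≤n))))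
        by (inj₂ z) = cong (monomial g (pos v) ^_) z

      counted : ∀ {z us} p q → Growing m z us → total p ≡ suc n → total q ≡ suc n →
        ∑ (List.map clockwiseCorners us) (λ T → ∑ (arrowsOf T) (λ e → ⟦ Product.≡-dec _≟ᴾ_ _≟ᴾ_ e (p , q) ⟧)) ≡ arrowsAll us p q
      counted p q [] tp tq = refl
      counted p q gr@(_ ∷ rest) tp tq = cong₂ ℤ._+_ (count-triangle (clockwise-corners gr ≤-refl) p q tp tq) (counted p q rest tp tq)

      arrows-counted : ∀ u v → + arrows (seed initial) u v ≡ arrowsAll all (pos u) (pos v)
      arrows-counted u v = begin
        + arrows (seed initial) u v
          ≡⟨ length-filter-∑ (λ e → Product.≡-dec _≟ᴾ_ _≟ᴾ_ e (pos u , pos v)) (concatMap arrowsOf triangles) ⟩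
        ∑ (concatMap arrowsOf triangles) (λ e → ⟦ Product.≡-dec _≟ᴾ_ _≟ᴾ_ e (pos u , pos v) ⟧)
          ≡⟨ ∑-concatMap arrowsOf triangles (λ e → ⟦ Product.≡-dec _≟ᴾ_ _≟ᴾ_ e (pos u , pos v) ⟧) ⟩
        ∑ triangles (λ T → ∑ (arrowsOf T) (λ e → ⟦ Product.≡-dec _≟ᴾ_ _≟ᴾ_ e (pos u , pos v) ⟧))
          ≡⟨ cong (λ Ts → ∑ Ts (λ T → ∑ (arrowsOf T) (λ e → ⟦ Product.≡-dec _≟ᴾ_ _≟ᴾ_ e (pos u , pos v) ⟧))) triangles≡ ⟩
        ∑ (List.map clockwiseCorners all) (λ T → ∑ (arrowsOf T) (λ e → ⟦ Product.≡-dec _≟ᴾ_ _≟ᴾ_ e (pos u , pos v) ⟧))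
          ≡⟨ counted (pos u) (pos v) growing (totals u) (totals v) ⟩
        arrowsAll all (pos u) (pos v) ∎
        where open ≡-Reasoning

      positivePart-difference : ∀ k {a b} → + k ≡ a → a ≡ 0ℤ ⊎ b ≡ 0ℤ → 0ℤ ℤ.≤ b → k ≡ positivePart (a ℤ.- b)
      positivePart-difference k refl (inj₂ refl) _ = cong positivePart (sym (ℤ.+-identityʳ (+ k)))
      positivePart-difference zero {b = + zero}  refl (inj₁ refl) _ = refl
      positivePart-difference zero {b = + suc _} refl (inj₁ refl) _ = refl

      difference : ∀ us p q → ∑ us (λ t → orientedForm t p q) ≡ arrowsAll us p q ℤ.- arrowsAll us q p
      difference []       p q = refl
      difference (t ∷ us) p q = trans (cong₂ ℤ._+_ (orientedForm≡ t p q) (difference us p q)) (regroup (arrowsAt t p q) (arrowsAt t q p) (arrowsAll us p q) (arrowsAll us q p))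
        where
        regroup : ∀ a b c d → (a ℤ.- b) ℤ.+ (c ℤ.- d) ≡ (a ℤ.+ c) ℤ.- (b ℤ.+ d)
        regroup = ℤ-Solver.solve-∀

    initial-inv : Inv σ 1 2 2 ts initial
    initial-inv = record
      { values     = λ v → subst (x⟨ v ⟩ at𝟙≡_) (sym (value-one v)) (x-at𝟙 v)
      ; totals     = totals
      ; injective  = lookup-injective (deduplicate-! _≟ᴾ_ (concatMap pointsOf triangles))
      ; fresh      = λ {x} v 2<x → [ (λ i → inj₂ (first-other v i 2<x)) , inj₁ ]′ (first-or-none v)
      ; surjective = surjective
      ; done       = λ _ _ → 0ℤ
      ; done-skew  = λ _ _ → refl
      ; done-fresh = λ _ _ _ → refl
      ; done-next  = λ _ _ _ → refl
      ; arrows≡    = λ u v → trans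
          (positivePart-difference (arrows (seed initial) u v) (arrows-counted u v) (reduced (pos u) (pos v) growing (totals u) (totals v))
            (subst (0ℤ ℤ.≤_) (arrows-counted v u) (ℤ.+≤+ z≤n)))
          (cong positivePart (trans (sym (difference all (pos u) (pos v))) (sym (ℤ.+-identityˡ _))))
      }

-- Triangles and λ-lengths along the fans

fanSteps : Bool → (c w z p : ℕ) → List Triangle
fanSteps σ c w z zero    = []
fanSteps σ c w z (suc p) = (σ , c , w , suc z) ∷ fanSteps σ c (suc z) (suc z) p

-- The last rim vertex z + p of a fan is the next centre, and the old centre is the first rim vertex
-- of the next fan.
allSteps : Bool → (c w z : ℕ) → List ℕ → List Triangle
allSteps σ c w z []       = []
allSteps σ c w z (p ∷ ps) = fanSteps σ c w z p ++ allSteps (not σ) (z + p) c (z + p) ps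

-- The centre and first rim vertex that one further fan would have.
ends : (c w z : ℕ) → List ℕ → ℕ × ℕ
ends c w z []       = c , w
ends c w z (p ∷ ps) = ends (z + p) c (z + p) ps

record Good (c w z : ℕ) : Set where
  constructor good
  field
    c≢w    : c ≢ w
    0<c    : 0 < c
    0<w    : 0 < w
    c≤z    : c ≤ z
    w≤z    : w ≤ z
    newest : z ≤ c ⊎ z ≤ w

good-next : ∀ {c w z} → Good c w z → ∀ p → Good c (z + suc p) (z + suc p)
good-next {c} {w} {z} (good _ 0<c _ c≤z _ _) p = good (<⇒≢ c<) 0<c (≤-<-trans z≤n c<) (<⇒≤ c<) ≤-refl (inj₂ ≤-refl)
  where
  c< : c < z + suc p
  c< = ≤-trans (s≤s c≤z) (≤-trans (s≤s (m≤m+n z p)) (≤-reflexive (sym (+-suc z p))))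

good-swap : ∀ {c w z} → Good c w z → Good w c z
good-swap (good c≢w 0<c 0<w c≤z w≤z newest) = good (c≢w ∘ sym) 0<w 0<c w≤z c≤z (Data.Sum.swap newest)

fan-chain : ∀ {M σ c w z ts} p → Good c w z → z + p < M → Chain M (z + p) ts → Chain M z (fanSteps σ c w z p ++ ts)
fan-chain {M} {z = z} {ts} zero    G bound chain = subst (λ k → Chain M k ts) (+-identityʳ z) chain
fan-chain {M} {c = c} {z = z} {ts} (suc p) G@(good c≢w 0<c 0<w c≤z w≤z newest) bound chain = link c≢w 0<c 0<w c≤z w≤z newest
  (≤-trans (s≤s (s≤s (m≤m+n z p))) bound′)
  (fan-chain p (subst (λ k → Good c k k) (trans (+-suc z 0) (cong suc (+-identityʳ z))) (good-next G 0)) bound′ (subst (λ k → Chain M k ts) (+-suc z p) chain))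
  where
  bound′ : suc z + p < M
  bound′ = subst (_< M) (+-suc z p) bound

all-chain : ∀ {M σ c w z ps} → Good c w z → All (1 ≤_) ps → z + sum ps < M → Chain M z (allSteps σ c w z ps)
all-chain {ps = []} G [] bound = []
all-chain {M} {σ} {c} {w} {z} {suc p ∷ ps} G (_ ∷ ps≥1) bound = fan-chain (suc p) G
  (≤-trans (s≤s (≤-trans (m≤m+n (z + suc p) (sum ps)) (≤-reflexive (+-assoc z (suc p) (sum ps))))) bound)
  (all-chain (good-swap (good-next G p)) ps≥1 (subst (_< M) (sym (+-assoc z (suc p) (sum ps))) bound))

Ptolemy : (ℕ → ℕ) → Triangle → Set
Ptolemy g (σ , c , w , S) = g S ≡ g c + g w

-- Every triangle of the fan adds the length of A c.
fan-length : ∀ {g σ c} z p → All (Ptolemy g) (fanSteps σ c z z p) → g (z + p) ≡ g z + p * g c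
fan-length {g} z zero [] = trans (cong g (+-identityʳ z)) (sym (+-identityʳ (g z)))
fan-length {g} {σ} {c} z (suc p) (eq ∷ eqs) = trans (cong g (+-suc z p)) (trans (fan-length (suc z) p eqs) (trans (cong (_+ p * g c) eq) (rearrange (g c) (g z) (p * g c))))
  where
  rearrange : ∀ a b d → a + b + d ≡ b + (a + d)
  rearrange = solve-∀

ends-lengths : ∀ {g σ c w z ps} → All (1 ≤_) ps → All (Ptolemy g) (allSteps σ c w z ps) →
  (g (proj₁ (ends c w z ps)) , g (proj₂ (ends c w z ps))) ≡ fanLengths (g c , g w) ps
ends-lengths {ps = []} [] [] = refl
ends-lengths {g} {σ} {c} {w} {z} {suc p ∷ ps} (_ ∷ ps≥1) (eq ∷ eqs) = trans
  (ends-lengths {g} {not σ} {z + suc p} {c} {z + suc p} {ps} ps≥1 (All.++⁻ʳ (fanSteps σ c (suc z) (suc z) p) eqs))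
  (cong (λ t → fanLengths (t , g c) ps) (trans (cong g (+-suc z p))
    (trans (fan-length (suc z) p (All.++⁻ˡ (fanSteps σ c (suc z) (suc z) p) eqs)) (trans (cong (_+ p * g c) eq) (rearrange (g c) (g w) (p * g c))))))
  where
  rearrange : ∀ a b d → a + b + d ≡ b + (a + d)
  rearrange = solve-∀

extend : (ℕ → ℕ) → Triangle → ℕ → ℕ
extend f (σ , c , w , S) v = if does (v ≟ S) then f c + f w else f v

-- The λ-lengths of the diagonals at A, filled in along the chain: each triangle gives its new
-- vertex the length required by Ptolemy's relation.
lengths : (ℕ → ℕ) → List Triangle → ℕ → ℕ
lengths = foldl extend

extend-old : ∀ f σ c w S {v} → v ≢ S → extend f (σ , c , w , S) v ≡ f v
extend-old f σ c w S {v} v≢S = cong (if_then f c + f w else f v) (dec-false (v ≟ S) v≢S)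

extend-new : ∀ f σ c w S → extend f (σ , c , w , S) S ≡ f c + f w
extend-new f σ c w S = cong (if_then f c + f w else f S) (dec-true (S ≟ S) refl)

lengths-old : ∀ {M z ts} f → Chain M z ts → ∀ {v} → v ≤ z → lengths f ts v ≡ f v
lengths-old f [] v≤z = refl
lengths-old f (link {z} {σ} {c} {w} _ _ _ _ _ _ _ chain) v≤z =
  trans (lengths-old (extend f (σ , c , w , suc z)) chain (m≤n⇒m≤1+n v≤z)) (extend-old f σ c w (suc z) (<⇒≢ (s≤s v≤z)))

-- Later triangles assign lengths only to newer vertices, so each relation persists.
lengths-ptolemy : ∀ {M z ts} f → Chain M z ts → All (Ptolemy (lengths f ts)) ts
lengths-ptolemy f [] = []
lengths-ptolemy f (link {z} {σ} {c} {w} {ts} _ _ _ c≤z w≤z _ _ chain) =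
  trans (lengths-old f′ chain ≤-refl) (trans (extend-new f σ c w (suc z)) (sym (cong₂ _+_ (old c≤z) (old w≤z)))) ∷ lengths-ptolemy f′ chain
  where
  f′ : ℕ → ℕ
  f′ = extend f (σ , c , w , suc z)
  old : ∀ {v} → v ≤ z → lengths f′ ts v ≡ f v
  old v≤z = trans (lengths-old f′ chain (m≤n⇒m≤1+n v≤z)) (extend-old f σ c w (suc z) (<⇒≢ (s≤s v≤z)))

lengths-positive : ∀ {f} ts → (∀ v → 1 ≤ f v) → ∀ v → 1 ≤ lengths f ts v
lengths-positive []       f≥1 = f≥1
lengths-positive {f} ((σ , c , w , S) ∷ ts) f≥1 = lengths-positive ts λ v → by v (v ≟ S)
  where
  by : ∀ v → Dec (v ≡ S) → 1 ≤ extend f (σ , c , w , S) v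
  by v (yes refl) = ≤-trans (≤-trans (f≥1 c) (m≤m+n (f c) (f w))) (≤-reflexive (sym (extend-new f σ c w S)))
  by v (no v≢S)   = ≤-trans (f≥1 v) (≤-reflexive (sym (extend-old f σ c w S v≢S)))

drop-∷ : ∀ k (xs : List ℕ) {q qs} → List.drop k xs ≡ q ∷ qs → sum (take (suc k) xs) ≡ sum (take k xs) + q × List.drop (suc k) xs ≡ qs
drop-∷ zero    (x ∷ xs) refl = +-identityʳ x , refl
drop-∷ (suc k) (x ∷ xs) eq   = let s , d = drop-∷ k xs eq in trans (cong (_+_ x) s) (sym (+-assoc x _ _)) , d

fan : ℕ → List ℕ → List (ℕ × ℕ)
fan i []       = []
fan i (q ∷ qs) = List.map (λ s → i , suc s) (upTo q) ++ fan (suc i) qs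

mutual
  -- The local function in the definition of fanIndices; the second clause of
  -- fanIndices≡ determines it.
  go : ℕ → Bool → List ℕ → ℕ → List ℕ → List (ℕ × ℕ)
  go = _

  fanIndices≡ : ∀ n ps mirror → Polygon.fanIndices n ps mirror ≡ fan 1 ps
  fanIndices≡ n []       mirror = refl
  -- With `q ∷ qs` and 2 replaced by variables, the local function stands applied to distinct
  -- variables, so unification can solve for `go`.
  fanIndices≡ n (q ∷ qs) mirror with List._∷_ q qs | 2
  ... | ps | i = cong (List.map (λ s → 1 , suc s) (upTo q) ++_) (go≡ n mirror ps i qs)

  go≡ : ∀ n mirror ps i qs → go n mirror ps i qs ≡ fan i qs
  go≡ n mirror ps i []       = refl
  go≡ n mirror ps i (q ∷ qs) = cong (List.map (λ s → i , suc s) (upTo q) ++_) (go≡ n mirror ps (suc i) qs)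

module Run (n : ℕ) (1≤n : 1 ≤ n) (ps : List ℕ) (mirror : Bool) (ps≥1 : All (1 ≤_) ps) where

  open Polygon n ps mirror

  toStep : ℕ × ℕ → Triangle
  toStep (i , s) = clockwise i , C i , W i s , W i (suc s)

  -- Here x s is the rim vertex `W i (suc s)`: the first may be old, the others are numbered
  -- consecutively after z.
  fan-steps : ∀ σ c w z q (x : ℕ → ℕ) → x 0 ≡ w → (∀ s → x (suc s) ≡ suc (s + z)) →
    List.applyUpTo (λ s → σ , c , x s , x (suc s)) q ≡ fanSteps σ c w z q
  fan-steps σ c w z zero    x x₀ xₛ = refl
  fan-steps σ c w z (suc q) x x₀ xₛ = cong₂ _∷_ (cong₂ (λ a b → σ , c , a , b) x₀ (xₛ 0))
    (fan-steps σ c (suc z) (suc z) q (x ∘ suc) (xₛ 0) (λ s → trans (xₛ (suc s)) (cong suc (sym (+-suc s z)))))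

  W-next : ∀ k s → W (suc k) (suc (suc s)) ≡ suc (s + (P k + 2))
  W-next zero    s = cong suc (+-comm 2 s)
  W-next (suc k) s = rearrange (P (suc k)) s
    where
    rearrange : ∀ p s → p + (1 + (2 + s)) ≡ suc (s + (p + 2))
    rearrange = solve-∀

  P-suc : ∀ k {q qs} → List.drop k ps ≡ q ∷ qs → P (suc k) + 2 ≡ P k + 2 + q
  P-suc k {q} eq = trans (cong (_+ 2) (proj₁ (drop-∷ k ps eq))) (rearrange (P k) q)
    where
    rearrange : ∀ p q → p + q + 2 ≡ p + 2 + q
    rearrange = solve-∀

  steps-suffix : ∀ k qs → List.drop k ps ≡ qs → List.map toStep (fan (suc k) qs) ≡ allSteps (clockwise (suc k)) (C (suc k)) (W (suc k) 1) (P k + 2) qs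
  steps-suffix k []       eq = refl
  steps-suffix k (q ∷ qs) eq = trans (List.map-++ toStep (List.map (λ s → suc k , suc s) (upTo q)) (fan (suc (suc k)) qs)) (cong₂ _++_
    (trans (sym (List.map-∘ (upTo q))) (trans (List.map-applyUpTo id (λ s → toStep (suc k , suc s)) q)
      (fan-steps (clockwise (suc k)) (C (suc k)) (W (suc k) 1) (P k + 2) q (λ s → W (suc k) (suc s)) refl (W-next k))))
    (trans (steps-suffix (suc k) qs (proj₂ (drop-∷ k ps eq))) (cong (λ z → allSteps (clockwise (suc (suc k))) z (C (suc k)) z qs) (P-suc k eq))))

  -- For nonempty `ps`, the numbering makes `C (suc N)` equal to B and `W (suc N) 1` equal to V, so
  -- the fictitious next fan names the last triangle.
  ends-suffix : ∀ k qs → List.drop k ps ≡ qs → k + length qs ≡ N → ends (C (suc k)) (W (suc k) 1) (P k + 2) qs ≡ (C (suc N) , W (suc N) 1)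
  ends-suffix k []       eq len rewrite sym (trans (sym (+-identityʳ k)) len) = refl
  ends-suffix k (q ∷ qs) eq len = trans (cong (λ z → ends z (C (suc k)) z qs) (sym (P-suc k eq)))
    (ends-suffix (suc k) qs (proj₂ (drop-∷ k ps eq)) (trans (sym (+-suc k (length qs))) len))

  σ₁ : Bool
  σ₁ = clockwise 1

  ts : List Triangle
  ts = allSteps σ₁ 1 2 2 ps

  steps≡ : List.map toStep fanIndices ≡ ts
  steps≡ = trans (cong (List.map toStep) (fanIndices≡ n ps mirror)) (steps-suffix 0 ps refl)

  P-N : P N ≡ sum ps
  P-N = cong sum (List.take-all N ps ≤-refl)

  chain : Chain m 2 ts
  chain = all-chain (good (λ ()) (s≤s z≤n) (s≤s z≤n) (s≤s z≤n) ≤-refl (inj₂ ≤-refl)) ps≥1 (s≤s (s≤s (s≤s (≤-reflexive (sym P-N)))))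

  g : ℕ → ℕ
  g = lengths (λ _ → 1) ts

  g≥1 : ∀ v → 1 ≤ g v
  g≥1 = lengths-positive ts (λ _ → ≤-refl)

  g-old : ∀ {v} → v ≤ 2 → g v ≡ 1
  g-old = lengths-old (λ _ → 1) chain

  open Invariant n ps mirror g g≥1 (g-old z≤n)
  open InitialSeed n 1≤n ps mirror g g≥1 (g-old z≤n) (g-old (s≤s z≤n)) (g-old ≤-refl) using (initial-inv; clockwiseCorners)

  flipStep : State → Triangle → State
  flipStep st (σ , c , w , S) = Flip.flip c w A S st

  final≡ : final ≡ foldl flipStep initial ts
  final≡ = trans (sym (List.foldl-map flipStep toStep initial fanIndices)) (cong (foldl flipStep initial) steps≡)

  triangles≡ : triangles ≡ List.map clockwiseCorners ((σ₁ , 1 , 0 , 2) ∷ ts)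
  triangles≡ = cong (clockwiseCorners (σ₁ , 1 , 0 , 2) ∷_) (trans (List.map-∘ {g = clockwiseCorners} {f = toStep} fanIndices) (cong (List.map clockwiseCorners) steps≡))

  chain-later : ∀ {M y z us} → y < z → Chain M z us → All (Later y) us
  chain-later y<z [] = []
  chain-later y<z (link c≢w 0<c 0<w c≤z w≤z newest _ chain) =
    later (m≤n⇒m≤1+n y<z) (Data.Sum.map (≤-trans y<z) (≤-trans y<z) newest) c≢w (<⇒≢ (s≤s c≤z)) (<⇒≢ (s≤s w≤z)) 0<c 0<w ∷ chain-later (m≤n⇒m≤1+n y<z) chain

  inv-next : ∀ {σ c w z us st} → Inv σ c w z ((σ , c , w , suc z) ∷ us) st → Chain m z ((σ , c , w , suc z) ∷ us) → Ptolemy g (σ , c , w , suc z) →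
    Inv σ c (suc z) (suc z) us (flipStep st (σ , c , w , suc z))
  inv-next inv (link c≢w 0<c 0<w c≤z w≤z _ S<m chain) eq = Step.next inv c≢w 0<c 0<w c≤z w≤z S<m eq (chain-later ≤-refl chain)

  chain-tail : ∀ {M z t us} → Chain M z (t ∷ us) → Chain M (suc z) us
  chain-tail (link _ _ _ _ _ _ _ chain) = chain

  run-fan : ∀ {σ c us st} z p → Inv σ c z z (fanSteps σ c z z p ++ us) st → Chain m z (fanSteps σ c z z p ++ us) → All (Ptolemy g) (fanSteps σ c z z p ++ us) →
    Inv σ c (z + p) (z + p) us (foldl flipStep st (fanSteps σ c z z p)) × Chain m (z + p) us
  run-fan {σ} {c} {us} {st} z zero inv chain eqs = subst (λ k → Inv σ c k k us st) (sym (+-identityʳ z)) inv , subst (λ k → Chain m k us) (sym (+-identityʳ z)) chain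
  run-fan {σ} {c} {us} {st} z (suc p) inv chain (eq ∷ eqs) =
    subst (λ k → Inv σ c k k us (foldl flipStep st (fanSteps σ c z z (suc p))) × Chain m k us) (sym (+-suc z p)) (run-fan (suc z) p (inv-next inv chain eq) (chain-tail chain) eqs)

  -- The first flip of a fan is separate, since its rim vertex w need not be the newest vertex; from
  -- the second on it is. `Inv-swap` then prepares the next fan.
  run : ∀ {σ c w z qs st} → All (1 ≤_) qs → Inv σ c w z (allSteps σ c w z qs) st → Chain m z (allSteps σ c w z qs) → All (Ptolemy g) (allSteps σ c w z qs) →
    ∃ λ σ′ → ∃ λ z′ → Inv σ′ (proj₁ (ends c w z qs)) (proj₂ (ends c w z qs)) z′ [] (foldl flipStep st (allSteps σ c w z qs))
  run {σ} {c} {w} {z} {[]} [] inv chain eqs = σ , z , inv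
  run {σ} {c} {w} {z} {suc p ∷ qs} {st} (_ ∷ qs≥1) inv chain (eq ∷ eqs) =
    subst (λ st → ∃ λ σ′ → ∃ λ z′ → Inv σ′ (proj₁ (ends c w z (suc p ∷ qs))) (proj₂ (ends c w z (suc p ∷ qs))) z′ [] st)
      (sym (List.foldl-++ flipStep (flipStep st (σ , c , w , suc z)) (fanSteps σ c (suc z) (suc z) p) (allSteps (not σ) (z + suc p) c (z + suc p) qs)))
      (run qs≥1 (Inv-swap inv′) chain′ (All.++⁻ʳ (fanSteps σ c (suc z) (suc z) p) eqs))
    where
    us : List Triangle
    us = allSteps (not σ) (z + suc p) c (z + suc p) qs
    fanned : Inv σ c (suc z + p) (suc z + p) us (foldl flipStep (flipStep st (σ , c , w , suc z)) (fanSteps σ c (suc z) (suc z) p)) × Chain m (suc z + p) us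
    fanned = run-fan (suc z) p (inv-next inv chain eq) (chain-tail chain) eqs
    inv′ : Inv σ c (z + suc p) (z + suc p) us (foldl flipStep (flipStep st (σ , c , w , suc z)) (fanSteps σ c (suc z) (suc z) p))
    inv′ = subst (λ k → Inv σ c k k us (foldl flipStep (flipStep st (σ , c , w , suc z)) (fanSteps σ c (suc z) (suc z) p))) (sym (+-suc z p)) (proj₁ fanned)
    chain′ : Chain m (z + suc p) us
    chain′ = subst (λ k → Chain m k us) (sym (+-suc z p)) (proj₂ fanned)

  final-inv : ∃ λ σ → ∃ λ z → Inv σ (C (suc N)) (W (suc N) 1) z [] final
  final-inv = subst (λ st → ∃ λ σ → ∃ λ z → Inv σ (C (suc N)) (W (suc N) 1) z [] st) (sym final≡)
    (subst (λ e → ∃ λ σ → ∃ λ z → Inv σ (proj₁ e) (proj₂ e) z [] (foldl flipStep initial ts)) (ends-suffix 0 ps refl refl)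
      (run ps≥1 (initial-inv σ₁ ts chain triangles≡) chain (lengths-ptolemy (λ _ → 1) chain)))

  final-lengths : (g (C (suc N)) , g (W (suc N) 1)) ≡ fanLengths (1 , 1) ps
  final-lengths = trans (cong (λ e → g (proj₁ e) , g (proj₂ e)) (sym (ends-suffix 0 ps refl refl)))
    (trans (ends-lengths {g} {σ₁} ps≥1 (lengths-ptolemy (λ _ → 1) chain)) (cong₂ (λ x y → fanLengths (x , y) ps) (g-old (s≤s z≤n)) (g-old ≤-refl)))


ends-ordered : ∀ {c w z ps} → 0 < w → w < c → c ≤ z → All (1 ≤_) ps → 0 < proj₂ (ends c w z ps) × proj₂ (ends c w z ps) < proj₁ (ends c w z ps)
ends-ordered {ps = []} 0<w w<c c≤z [] = 0<w , w<c
ends-ordered {z = z} {suc p ∷ ps} 0<w w<c c≤z (_ ∷ ps≥1) = ends-ordered (<-trans 0<w w<c)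
  (≤-trans (s≤s c≤z) (≤-trans (s≤s (m≤m+n z p)) (≤-reflexive (sym (+-suc z p))))) ≤-refl ps≥1

-- The variables of the triangle A V B

module FinalTriangle (n : ℕ) (1≤n : 1 ≤ n) (p₁ : ℕ) (ps′ : List ℕ) (mirror : Bool) (ps≥1 : All (1 ≤_) (p₁ ∷ ps′)) where

  private
    ps : List ℕ
    ps = p₁ ∷ ps′

  open Polygon n ps mirror
  open Points n ps mirror
  open Run n 1≤n ps mirror ps≥1 using (g; g≥1; g-old; final-inv; final-lengths; ends-suffix)
  open Invariant n ps mirror g g≥1 (g-old z≤n) using (module Inv)
  open Values g
  open InitialQuiver n 1≤n ps mirror using (Corners; point; point-X; point-Y; point-Z; point-other; total-point)

  gB : g B ≡ a ps
  gB = trans (cong proj₁ final-lengths) (fanLengths₁≡a ps≥1)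

  gV : g V ≡ a (take (N ∸ 1) ps)
  gV = trans (cong proj₂ final-lengths) (fanLengths₂≡a ps≥1 (s≤s z≤n))

  ordered : 0 < V × V < B
  ordered = subst (λ e → 0 < proj₂ e × proj₂ e < proj₁ e) (ends-suffix 0 ps refl refl)
    (start ps≥1)
    -- The order fails for the starting pair (1 , 2), but holds after one fan, whose centre 1 then
    -- becomes the rim vertex.
    where
    start : ∀ {q qs} → All (1 ≤_) (q ∷ qs) → 0 < proj₂ (ends 1 2 2 (q ∷ qs)) × proj₂ (ends 1 2 2 (q ∷ qs)) < proj₁ (ends 1 2 2 (q ∷ qs))
    start (_ ∷ qs≥1) = ends-ordered (s≤s z≤n) (s≤s (s≤s z≤n)) ≤-refl qs≥1

  B<m : B < m
  B<m = s≤s (≤-reflexive (+-comm (P N) 2))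

  finalCorners : Corners A V B
  finalCorners = record
    { X<m = s≤s z≤n ; Y<m = <-trans (proj₂ ordered) B<m ; Z<m = B<m
    ; X≢Y = <⇒≢ (proj₁ ordered) ; X≢Z = <⇒≢ (<-trans (proj₁ ordered) (proj₂ ordered)) ; Y≢Z = <⇒≢ (proj₂ ordered) }

  inv = proj₂ (proj₂ final-inv)

  value-point : ∀ x j i → value (point A V B x j i) ≡ (g V ^ j * g B ^ i) ^ x
  value-point x j i = cong₂ _^_
    (trans (monomial-⊕ g (x ⊙ A ⊕ j ⊙ V) (i ⊙ B)) (cong₂ _*_ (trans (monomial-⊕ g (x ⊙ A) (j ⊙ V))
      (trans (cong₂ _*_ (trans (monomial-⊙ x (Corners.X<m finalCorners)) (trans (cong (_^ x) (g-old z≤n)) (^-zeroˡ x))) (monomial-⊙ j (Corners.Y<m finalCorners))) (*-identityˡ (g V ^ j))))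
      (monomial-⊙ i B<m)))
    (point-X finalCorners x j i)

  variableAt : ∀ x j i → x + j + i ≡ suc n → x ≤ n → j ≤ n → i ≤ n → VariableAt (point A V B x j i) (_HasTerms ((g V ^ j * g B ^ i) ^ x))
  variableAt x j i sum≡ x≤ j≤ i≤ =
    Inv.surjective inv (point A V B x j i) (trans (total-point finalCorners x j i) sum≡)
      -- The invariant names the triangle in the order c, A, w with c = B and w = V, hence the
      -- rotation of the weights.
      (inj₁ (trans (cong₂ _+_ (cong₂ _+_ (point-Z finalCorners x j i) (point-X finalCorners x j i)) (point-Y finalCorners x j i)) (trans (rotate x j i) sum≡))) small ,
    λ v at → hasTerms (subst (var (seed final) v at𝟙≡_) (trans (cong value at) (value-point x j i)) (Inv.values inv v))
    where
    rotate : ∀ x j i → i + x + j ≡ x + j + i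
    rotate = solve-∀
    small : ∀ w → weight w (point A V B x j i) ≤ n
    small w with w ≟ A | w ≟ V | w ≟ B
    ... | yes refl | _        | _        = ≤-trans (≤-reflexive (point-X finalCorners x j i)) x≤
    ... | no _     | yes refl | _        = ≤-trans (≤-reflexive (point-Y finalCorners x j i)) j≤
    ... | no _     | no _     | yes refl = ≤-trans (≤-reflexive (point-Z finalCorners x j i)) i≤
    ... | no w≢A   | no w≢V   | no w≢B   = ≤-trans (≤-reflexive (point-other finalCorners x j i w≢A w≢V w≢B)) z≤n

  edge-point : ∀ x i → point A V B x 0 i ≡ x ⊙ A ⊕ i ⊙ B
  edge-point x i = cong (_⊕ i ⊙ B) (weight-ext (x ⊙ A ⊕ 0 ⊙ V) (x ⊙ A)
    (λ w → trans (weight-⊕ w (x ⊙ A) (0 ⊙ V)) (trans (cong (_+_ (weight w (x ⊙ A))) (zero-weight w)) (+-identityʳ _))))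
    where
    constant : ∀ b → (if b then 0 else 0) ≡ 0
    constant false = refl
    constant true  = refl
    zero-weight : ∀ w → weight w (0 ⊙ V) ≡ 0
    zero-weight w = weight-tabulate-zero {m} w (λ Y → if Y ℕ.≡ᵇ V then 0 else 0) (constant (w ℕ.≡ᵇ V))

  diagonal : ∀ l → 1 ≤ l → l ≤ n → D l (_HasTerms (a ps ^ (l * (n + 1 ∸ l))))
  diagonal l l≥1 l≤n = subst (λ p → VariableAt p (_HasTerms (a ps ^ (l * (n + 1 ∸ l))))) (edge-point (suc n ∸ l) l)
    (subst (λ t → VariableAt (point A V B (suc n ∸ l) 0 l) (_HasTerms t)) exponent
      (variableAt (suc n ∸ l) 0 l (trans (cong (_+ l) (+-identityʳ (suc n ∸ l))) (m∸n+n≡m (m≤n⇒m≤1+n l≤n))) (m∸n≤m′ l≥1) z≤n l≤n))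
    where
    m∸n≤m′ : ∀ {l} → 1 ≤ l → suc n ∸ l ≤ n
    m∸n≤m′ {suc l} _ = m∸n≤m n l
    exponent : (g V ^ 0 * g B ^ l) ^ (suc n ∸ l) ≡ a ps ^ (l * (n + 1 ∸ l))
    exponent = trans (cong₂ (λ b k → b ^ (k ∸ l)) (trans (+-identityʳ (g B ^ l)) (cong (_^ l) gB)) (+-comm 1 n)) (^-*-assoc (a ps) l (n + 1 ∸ l))

  interior : ∀ i j → 1 ≤ i → 1 ≤ j → i + j ≤ n → I i j (_HasTerms (a ps ^ (i * (n + 1 ∸ i ∸ j)) * a (take (N ∸ 1) ps) ^ (j * (n + 1 ∸ i ∸ j))))
  interior i j i≥1 j≥1 i+j≤n = subst (λ t → VariableAt (point A V B x j i) (_HasTerms t)) exponent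
    (variableAt x j i sum≡ (≤-trans (m∸n≤m (suc n ∸ i) j) (lower i≥1)) (≤-trans (m≤n+m j i) i+j≤n) (≤-trans (m≤m+n i j) i+j≤n))
    where
    x : ℕ
    x = suc n ∸ i ∸ j
    lower : ∀ {i} → 1 ≤ i → suc n ∸ i ≤ n
    lower {suc i} _ = m∸n≤m n i
    sum≡ : x + j + i ≡ suc n
    sum≡ = trans (cong (λ t → t + j + i) (∸-+-assoc (suc n) i j)) (trans (regroup (suc n ∸ (i + j)) i j) (m∸n+n≡m (m≤n⇒m≤1+n i+j≤n)))
      where
      regroup : ∀ t i j → t + j + i ≡ t + (i + j)
      regroup = solve-∀
    exponent : (g V ^ j * g B ^ i) ^ x ≡ a ps ^ (i * (n + 1 ∸ i ∸ j)) * a (take (N ∸ 1) ps) ^ (j * (n + 1 ∸ i ∸ j))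
    exponent = begin
      (g V ^ j * g B ^ i) ^ x
        ≡⟨ cong₂ (λ b k → b ^ (k ∸ i ∸ j)) (trans (*-comm (g V ^ j) (g B ^ i)) (cong₂ (λ s t → s ^ i * t ^ j) gB gV)) (+-comm 1 n) ⟩
      (a ps ^ i * a (take (N ∸ 1) ps) ^ j) ^ e
        ≡⟨ OneFlip.^-distribʳ-* n ps mirror e (a ps ^ i) (a (take (N ∸ 1) ps) ^ j) ⟩
      (a ps ^ i) ^ e * (a (take (N ∸ 1) ps) ^ j) ^ e
        ≡⟨ cong₂ _*_ (^-*-assoc (a ps) i e) (^-*-assoc (a (take (N ∸ 1) ps)) j e) ⟩
      a ps ^ (i * e) * a (take (N ∸ 1) ps) ^ (j * e) ∎
      where
      open ≡-Reasoning
      e : ℕ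
      e = n + 1 ∸ i ∸ j

corollary1p5 : (n : ℕ) → 1 ≤ n →
    (ps : List ℕ) → 1 ≤ length ps → All (1 ≤_) ps →
    (mirror : Bool) →
    let open Polygon n ps mirror in
    ((l : ℕ) → 1 ≤ l → l ≤ n →
    D l (_HasTerms (a ps ^ (l * (n + 1 ∸ l)))))
    ×
    ((i j : ℕ) → 1 ≤ i → 1 ≤ j → i + j ≤ n →
    I i j (_HasTerms (a ps ^ (i * (n + 1 ∸ i ∸ j)) * a (take (N ∸ 1) ps) ^ (j * (n + 1 ∸ i ∸ j)))))
corollary1p5 n 1≤n (p₁ ∷ ps) _ ps≥1 mirror = FinalTriangle.diagonal n 1≤n p₁ ps mirror ps≥1 , FinalTriangle.interior n 1≤n p₁ ps mirror ps≥1
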